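{- Let $k\ge 3$ and $r\ge 1$ be integers. The $r\times r$ matrix $$K_{r} = \begin{pmatrix} \binom{k-2}{k-3} & \binom{k-1}{k-3} & \binom{k}{k-3} & \binom{k+1}{k-3} & \cdots & \binom{r+k-3}{k-3} \\ 1 & \binom{k-2}{k-3} & \binom{k-1}{k-3} & \binom{k}{k-3} & \cdots & \binom{r+k-4}{k-3} \\ 0 & 1 & \binom{k-2}{k-3} & \binom{k-1}{k-3} & \cdots & \binom{r+k-5}{k-3} \\ 0 & 0 & 1 & \binom{k-2}{k-3} & \cdots & \binom{r+k-6}{k-3} \\ \vdots & \vdots & \vdots & \vdots & \ddots & \vdots \\ 0 & 0 & 0 & 0 & \cdots & \binom{k-2}{k-3} \end{pmatrix}$$ (whose $(p,q)$ entry is $\binom{k-2+q-p}{k-3}$ if $q\ge p$, $1$ if $q=p-1$, and $0$ if $q<p-1$) is a production matrix for $k$-angulations of point sets in convex position; that is, $v^{i+1}=K_r v^{i}$ for all $i$ with $1\le i\le r-1$.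
   Context: A geometric graph on a finite point set $\mathcal S\subseteq\mathbb R^2$ has vertex set $\mathcal S$ and edges that are straight-line segments with endpoints in $\mathcal S$; it is plane if no two edges intersect except at common endpoints. A $k$-angulation is a 2-connected plane geometric graph in which every internal face is a $k$-gon. A $k$-angulation with exactly $i$ $k$-gons has $(k-2)i+2$ vertices, taken to be points $p_1,\dots,p_{(k-2)i+2}$ in convex position labelled in counter-clockwise order. Its root vertex is $p_{(k-2)i+2}$, and the degree of the root vertex is defined as the number of its incident edges minus $2$. For $1\le i\le r$, $v^i$ is the $r$-dimensional column vector whose $j$-th entry is the number of $k$-angulations with exactly $i$ $k$-gons whose root vertex has degree $j-1$ (so $v^1=(1,0,\dots,0)^\top$). A production matrix is a matrix satisfying $v^{i+1}=K_rv^i$. -}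

module Defs where

open import Level using (Level; _⊔_) renaming (suc to lsuc)
open import Algebra.Bundles using (CommutativeRing)
open import Algebra.Properties.Semiring.Sum using (sum)
open import Data.Bool using (if_then_else_)
open import Data.Fin using (Fin; toℕ; fromℕ)
import Data.Fin as Fin
open import Data.Fin.Subset using (Subset; _∈_; ∣_∣)
open import Data.List using (List; []; _∷_; _∷ʳ_; zip; length)
import Data.List.Membership.Propositional as List
open import Data.List.Relation.Unary.All using (All)
open import Data.List.Relation.Unary.Unique.Propositional using (Unique)
open import Data.Nat using (ℕ; suc; _+_; _*_; _∸_; _≤_; _<_)
import Data.Nat as ℕ
open import Data.Nat.Combinatorics using (_C_)
open import Data.Nat.Properties using (+-*-semiring)
open import Data.Product using (Σ-syntax; ∃-syntax; _×_; _,_; proj₁; proj₂)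
open import Data.Product.Relation.Binary.Pointwise.NonDependent using (Pointwise)
open import Data.Sum using (_⊎_)
open import Data.Vec using (Vec; lookup; toList)
open import Data.Vec.Functional using (Vector)
open import Function.Bundles using (_⇔_)
open import Relation.Binary using (Rel; IsStrictTotalOrder)
import Relation.Binary.Construct.StrictToNonStrict as NonStrict
open import Relation.Binary.Construct.Closure.ReflexiveTransitive using (Star)
open import Relation.Binary.PropositionalEquality using (_≡_; _≢_)
open import Relation.Nullary using (¬_; does)
open import Relation.Unary using (Pred; _≐_)

private
  variable
    a p : Level
    n : ℕ

-- The library has no real numbers, so the plane is taken over an arbitrary
-- ordered field; classically, ℝ is one.
record OrderedField c ℓ₁ ℓ₂ : Set (lsuc (c ⊔ ℓ₁ ⊔ ℓ₂)) where
  field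
    commutativeRing : CommutativeRing c ℓ₁

  open CommutativeRing commutativeRing public
    renaming (_+_ to _⊕_; _*_ to _⊗_; -_ to ⊖_; _-_ to _⊝_)

  infix 4 _≺_

  field
    _≺_                : Rel Carrier ℓ₂
    isStrictTotalOrder : IsStrictTotalOrder _≈_ _≺_
    0≺1                : 0# ≺ 1#
    +-mono-≺           : ∀ x {y z} → y ≺ z → (x ⊕ y) ≺ (x ⊕ z)
    *-pos              : ∀ {x y} → 0# ≺ x → 0# ≺ y → 0# ≺ (x ⊗ y)
    inverse            : ∀ x → ¬ (x ≈ 0#) → ∃[ y ] (x ⊗ y) ≈ 1#

  open NonStrict _≈_ _≺_ public using () renaming (_≤_ to _≼_)

HasCount : {A : Set a} → Pred A p → ℕ → Set (a ⊔ p)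
HasCount {A = A} P N =
  Σ[ xs ∈ List A ] Unique xs × (∀ x → (x List.∈ xs) ⇔ P x) × length xs ≡ N

-- A graph is given by the neighbourhood of each vertex, so that two graphs are
-- equal exactly when they have the same edges.
Graph : ℕ → Set
Graph n = Vec (Subset n) n

Adj : Graph n → Rel (Fin n) _
Adj G u v = v ∈ lookup G u

IsSimple : Graph n → Set
IsSimple G = (∀ u v → Adj G u v → Adj G v u) × (∀ u → ¬ Adj G u u)

degree : Graph n → Fin n → ℕ
degree G u = ∣ lookup G u ∣

AdjAvoiding : Graph n → Fin n → Rel (Fin n) _
AdjAvoiding G w u v = Adj G u v × u ≢ w × v ≢ w

TwoConnected : Graph n → Set
TwoConnected {n} G =
  2 < n ×
  (∀ u v → Star (Adj G) u v) ×
  (∀ w u v → u ≢ w → v ≢ w → Star (AdjAvoiding G w) u v)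

SameEdge : (u v u′ v′ : Fin n) → Set
SameEdge u v u′ v′ = (u ≡ u′ × v ≡ v′) ⊎ (u ≡ v′ × v ≡ u′)

-- The subtraction of 2 in the degree of the root, the last vertex, is moved to
-- the other side so that it is not truncated.
HasRootDegree : ∀ {m} → Graph (suc m) → ℕ → Set
HasRootDegree {m} G d = degree G (fromℕ m) ≡ d + 2

sides : {A : Set} → List A → List (A × A)
sides []       = []
sides (x ∷ xs) = zip (x ∷ xs) (xs ∷ʳ x)

module Plane {c ℓ₁ ℓ₂} (F : OrderedField c ℓ₁ ℓ₂) where
  open OrderedField F

  Point : Set c
  Point = Carrier × Carrier

  _≋_ : Rel Point _
  _≋_ = Pointwise _≈_ _≈_

  orient : Point → Point → Point → Carrier
  orient (x₁ , y₁) (x₂ , y₂) (x₃ , y₃) =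
    ((x₂ ⊝ x₁) ⊗ (y₃ ⊝ y₁)) ⊝ ((y₂ ⊝ y₁) ⊗ (x₃ ⊝ x₁))

  LeftTurn : Point → Point → Point → Set ℓ₂
  LeftTurn P Q R = 0# ≺ orient P Q R

  Segment : Point → Point → Pred Point _
  Segment (x₁ , y₁) (x₂ , y₂) R =
    ∃[ t ] 0# ≼ t × t ≼ 1# ×
      R ≋ (((1# ⊝ t) ⊗ x₁) ⊕ (t ⊗ x₂) , ((1# ⊝ t) ⊗ y₁) ⊕ (t ⊗ y₂))

  Bounded : ∀ {ℓ} → Pred Point ℓ → Set _
  Bounded R = ∃[ M ] (∀ x y → R (x , y) → (⊖ M ≼ x × x ≼ M) × (⊖ M ≼ y × y ≼ M))

  -- Strictly convex position, labelled in counter-clockwise order.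
  ConvexPosition : (Fin n → Point) → Set _
  ConvexPosition S =
    ∀ u v w → u Fin.< v → v Fin.< w → LeftTurn (S u) (S v) (S w)

  module _ {n} (S : Fin n → Point) where

    IsPlane : Graph n → Set _
    IsPlane G =
      ∀ u v u′ v′ → Adj G u v → Adj G u′ v′ → ¬ SameEdge u v u′ v′ →
      ∀ Q → Segment (S u) (S v) Q → Segment (S u′) (S v′) Q →
      ∃[ w ] (w ≡ u ⊎ w ≡ v) × (w ≡ u′ ⊎ w ≡ v′) × Q ≋ S w

    Drawing : Graph n → Pred Point _
    Drawing G Q = ∃[ u ] ∃[ v ] Adj G u v × Segment (S u) (S v) Q

    Visible : Graph n → Rel Point _
    Visible G P Q = ∀ R → Segment P Q R → ¬ Drawing G R

    -- The connected component of P in the complement of the drawing.  That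
    -- complement is open, so its components are those of polygonal paths.
    Face : Graph n → Point → Pred Point _
    Face G P Q = Star (Visible G) P Q

    InternalFaceAt : Graph n → Pred Point _
    InternalFaceAt G P = ¬ Drawing G P × Bounded (Face G P)

    -- The open polygon with the given corners.  For points in convex position a
    -- simple polygon is convex and visits its corners in the order of their
    -- labels, so a k-gon is an increasing vector of k labels.
    Interior : ∀ {k} → Vec (Fin n) k → Pred Point _
    Interior T Q = All (λ (u , v) → LeftTurn (S u) (S v) Q) (sides (toList T))

    FaceIsPolygon : ∀ {k} → Graph n → Point → Vec (Fin n) k → Set _
    FaceIsPolygon G P T =
      (∀ i j → i Fin.< j → lookup T i Fin.< lookup T j) ×
      All (λ (u , v) → Adj G u v) (sides (toList T)) ×
      Face G P ≐ Interior T

    IsKAngulation : ℕ → Graph n → Set _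
    IsKAngulation k G =
      IsSimple G × IsPlane G × TwoConnected G ×
      (∀ P → InternalFaceAt G P → Σ[ T ∈ Vec (Fin n) k ] FaceIsPolygon G P T)

    HasKGons : ℕ → ℕ → Graph n → Set _
    HasKGons k i G =
      HasCount {A = Vec (Fin n) k}
        (λ T → ∃[ P ] InternalFaceAt G P × FaceIsPolygon G P T) i

-- The number of vertices of a k-angulation with i k-gons.
order : ℕ → ℕ → ℕ
order k i = 2 + (k ∸ 2) * i

Matrix : ℕ → Set
Matrix r = Fin r → Fin r → ℕ

_·_ : ∀ {r} → Matrix r → Vector ℕ r → Vector ℕ r
(M · v) p = sum +-*-semiring (λ q → M p q * v q)

module _ {c ℓ₁ ℓ₂} (F : OrderedField c ℓ₁ ℓ₂) (k r : ℕ) where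
  open Plane F

  -- S i is the point set carrying the k-angulations with i k-gons.  The entry
  -- of v i at the 0-based index j counts those of root degree j.
  IsDegreeVector : (∀ i → Fin (order k i) → Point) → ℕ → Vector ℕ r → Set _
  IsDegreeVector S i v =
    ∀ j → HasCount
      (λ G → IsKAngulation (S i) k G × HasKGons (S i) k i G × HasRootDegree G (toℕ j))
      (v j)

  -- The degree vectors are unique, so it does not matter whether v is
  -- quantified existentially or universally; as stated, finiteness of the
  -- counts is part of the claim.
  IsProductionMatrix : (∀ i → Fin (order k i) → Point) → Matrix r → Set _
  IsProductionMatrix S M =
    Σ[ v ∈ (ℕ → Vector ℕ r) ]
      (∀ i → 1 ≤ i → i ≤ r → IsDegreeVector S i (v i)) ×
      (∀ i → 1 ≤ i → i ≤ r ∸ 1 → ∀ p → v (suc i) p ≡ (M · v i) p)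

K : ℕ → (r : ℕ) → Matrix r
K k r p q =
  if does (toℕ p ℕ.≤? toℕ q)
  then (k ∸ 2 + (toℕ q ∸ toℕ p)) C (k ∸ 3)
  else (if does (toℕ p ℕ.≟ suc (toℕ q)) then 1 else 0)

{-# OPTIONS --safe #-}

-- In convex position a 2-connected plane graph contains the hull cycle: a path from
-- one hull neighbour of a missing hull edge to the other, avoiding the farthest
-- neighbour of the first, would cross an edge.  Its bounded faces are the convex
-- polygons spanned by its cycles without chords, since a segment leaving a convex
-- polygon meets one of its sides, while a ray shows that any point beyond a hull
-- edge lies in an unbounded face.  Hence k-angulations are the dissections of a
-- convex polygon into k-gons, and these correspond to Łukasiewicz words.
-- Those with i polygons and root degree j − 1 are counted by the coefficient of x^i
-- in B^j, where A = 1 + x A^(k−1) and B = x A^(k−2).  As A = 1 + A B, one has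
-- B^p = x B^(p−1) (1 − B)^(−(k−2)), and the binomial series of the last factor is
-- row p of the matrix.
module Submission where

open import Algebra.Bundles using (CommutativeRing)
import Algebra.Properties.AbelianGroup as AbelianGroupProperties
import Algebra.Properties.Ring as RingProperties
import Algebra.Properties.Semiring.Mult as SemiringMult
open import Algebra.Properties.Semiring.Sum using (sum)
import Algebra.Solver.Ring as RingSolver
open import Algebra.Solver.Ring.AlmostCommutativeRing
  using (fromCommutativeRing; _-Raw-AlmostCommutative⟶_)
open import Data.Bool using (Bool; true; false; if_then_else_)
open import Data.Empty using (⊥; ⊥-elim)
open import Data.Fin using (Fin; zero; suc; toℕ; fromℕ; fromℕ<; inject₁; opposite)
import Data.Fin as Fin
import Data.Fin.Properties as Fin
open import Data.Fin.Relation.Unary.Top using (view; ‵fromℕ; ‵inject₁)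
open import Data.Fin.Subset using (∣_∣)
open import Data.Fin.Subset.Properties using (_∈?_; ⊆-antisym)
open import Data.Integer using (ℤ)
import Data.Integer as ℤ
import Data.Integer.Properties as ℤ
open import Data.List using (List; []; _∷_; _∷ʳ_; _++_; zip; map; length)
open import Data.List.Membership.Propositional using (_∈_)
open import Data.List.Membership.Propositional.Properties
  using (∈-map⁺; ∈-map⁻; ∈-++⁺ˡ; ∈-++⁺ʳ)
open import Data.List.Properties using (length-map; length-++)
open import Data.List.Relation.Unary.All using (All; []; _∷_)
import Data.List.Relation.Unary.All as All
import Data.List.Relation.Unary.All.Properties as All
open import Data.List.Relation.Unary.AllPairs using ([]; _∷_)
open import Data.List.Relation.Unary.Any using (here; there)
open import Data.List.Relation.Unary.Unique.Propositional using (Unique)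
import Data.List.Relation.Unary.Unique.Propositional.Properties as Unique
open import Data.Maybe using (Maybe; just; nothing)
open import Data.Nat using (ℕ; zero; suc; _≤_; z≤n; s≤s)
import Data.Nat as ℕ
import Data.Nat.Properties as ℕ
open import Data.Nat.Tactic.RingSolver using (solve-∀)
open import Data.Product using (Σ-syntax; ∃-syntax; _×_; _,_; proj₁; proj₂)
import Data.Sign as Sign
open import Data.Sum using (_⊎_; inj₁; inj₂; swap; [_,_]′)
import Data.Sum as Sum
open import Data.Vec using (Vec; []; _∷_; lookup; toList; tabulate)
open import Data.Vec.Properties
  using (lookup∘tabulate; tabulate∘lookup; tabulate-cong; lookup⇒[]=; []=⇒lookup;
         length-toList; toList-injective; cast-is-id)
open import Function using (_∘_; mk⇔)
open import Level using (_⊔_)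
open import Relation.Binary using (IsStrictTotalOrder; tri<; tri≈; tri>)
open import Relation.Binary.Construct.Closure.ReflexiveTransitive
  using (Star; ε; _◅_; _◅◅_; reverse)
open import Relation.Binary.PropositionalEquality using (_≡_; _≢_)
import Relation.Binary.PropositionalEquality as ≡
import Relation.Binary.Reasoning.Setoid as SetoidReasoning
open import Relation.Nullary using (¬_; Dec; does; yes; no)
open import Relation.Nullary.Decidable using (_⊎-dec_; dec-true; dec-false; does-⇔)
open import Relation.Unary using (_≐_)
open import Defs

-- A ring solver with integer coefficients

module IntegerCoefficients {c ℓ} (R : CommutativeRing c ℓ) where
  open import Data.Integer using (+_; -[1+_]; +[1+_]; _⊖_; _◃_)
  open CommutativeRing R
    renaming (refl to ≈-refl; sym to ≈-sym; trans to ≈-trans; reflexive to ≈-reflexive)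
  open RingProperties ring
  open AbelianGroupProperties +-abelianGroup
  open SemiringMult semiring using (×-homo-+; ×1-homo-*; ×-homo-1) renaming (_×_ to infixr 8 _•_)
  open SetoidReasoning setoid

  ⟦_⟧ : ℤ → Carrier
  ⟦ + n ⟧      = n • 1#
  ⟦ -[1+ n ] ⟧ = - (suc n • 1#)

  ⟦⟧-neg : ∀ n → ⟦ ℤ.- (+ n) ⟧ ≈ - (n • 1#)
  ⟦⟧-neg zero    = ≈-sym ε⁻¹≈ε
  ⟦⟧-neg (suc n) = ≈-refl

  ⟦⟧-‿homo : ∀ i → ⟦ ℤ.- i ⟧ ≈ - ⟦ i ⟧
  ⟦⟧-‿homo (+ n)      = ⟦⟧-neg n
  ⟦⟧-‿homo -[1+ n ] = ≈-sym (⁻¹-involutive _)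

  cancel-suc : ∀ x y → x - y ≈ (1# + x) - (1# + y)
  cancel-suc x y = ≈-sym (begin
    (1# + x) - (1# + y)       ≈⟨ +-congˡ (≈-sym (⁻¹-∙-comm 1# y)) ⟩
    (1# + x) + (- 1# + - y)   ≈⟨ +-congʳ (+-comm 1# x) ⟩
    (x + 1#) + (- 1# + - y)   ≈⟨ +-assoc x 1# _ ⟩
    x + (1# + (- 1# + - y))   ≈⟨ +-congˡ (≈-sym (+-assoc 1# _ _)) ⟩
    x + ((1# + - 1#) + - y)   ≈⟨ +-congˡ (+-congʳ (-‿inverseʳ 1#)) ⟩
    x + (0# + - y)            ≈⟨ +-congˡ (+-identityˡ _) ⟩
    x - y                     ∎)

  ⟦⟧-⊖ : ∀ m n → ⟦ m ⊖ n ⟧ ≈ m • 1# - n • 1#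
  ⟦⟧-⊖ zero    zero    = ≈-sym (-‿inverseʳ 0#)
  ⟦⟧-⊖ zero    (suc n) = ≈-sym (+-identityˡ _)
  ⟦⟧-⊖ (suc m) zero    = ≈-sym (≈-trans (+-congˡ ε⁻¹≈ε) (+-identityʳ _))
  ⟦⟧-⊖ (suc m) (suc n) = begin
    ⟦ suc m ⊖ suc n ⟧              ≡⟨ ≡.cong ⟦_⟧ (ℤ.[1+m]⊖[1+n]≡m⊖n m n) ⟩
    ⟦ m ⊖ n ⟧                      ≈⟨ ⟦⟧-⊖ m n ⟩
    m • 1# - n • 1#                ≈⟨ cancel-suc _ _ ⟩
    suc m • 1# - suc n • 1#        ∎

  ⟦⟧-+-homo : ∀ i j → ⟦ i ℤ.+ j ⟧ ≈ ⟦ i ⟧ + ⟦ j ⟧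
  ⟦⟧-+-homo (+ m)    (+ n)    = ×-homo-+ 1# m n
  ⟦⟧-+-homo (+ m)    -[1+ n ] = ⟦⟧-⊖ m (suc n)
  ⟦⟧-+-homo -[1+ m ] (+ n)    = ≈-trans (⟦⟧-⊖ n (suc m)) (+-comm _ _)
  ⟦⟧-+-homo -[1+ m ] -[1+ n ] = begin
    - (suc (suc (m ℕ.+ n)) • 1#)        ≡⟨ ≡.cong (λ k → - (suc k • 1#)) (ℕ.+-suc m n) ⟨
    - ((suc m ℕ.+ suc n) • 1#)          ≈⟨ -‿cong (×-homo-+ 1# (suc m) (suc n)) ⟩
    - (suc m • 1# + suc n • 1#)         ≈⟨ ⁻¹-∙-comm _ _ ⟨
    - (suc m • 1#) + - (suc n • 1#)     ∎

  ⟦⟧-*-homo : ∀ i j → ⟦ i ℤ.* j ⟧ ≈ ⟦ i ⟧ * ⟦ j ⟧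
  ⟦⟧-*-homo (+ m) (+ n) = begin
    ⟦ Sign.+ ◃ m ℕ.* n ⟧    ≡⟨ ≡.cong ⟦_⟧ (ℤ.+◃n≡+n (m ℕ.* n)) ⟩
    (m ℕ.* n) • 1#          ≈⟨ ×1-homo-* m n ⟩
    m • 1# * n • 1#         ∎
  ⟦⟧-*-homo (+ m) -[1+ n ] = begin
    ⟦ Sign.- ◃ m ℕ.* suc n ⟧      ≡⟨ ≡.cong ⟦_⟧ (ℤ.-◃n≡-n (m ℕ.* suc n)) ⟩
    ⟦ ℤ.- (+ (m ℕ.* suc n)) ⟧     ≈⟨ ⟦⟧-neg (m ℕ.* suc n) ⟩
    - ((m ℕ.* suc n) • 1#)        ≈⟨ -‿cong (×1-homo-* m (suc n)) ⟩
    - (m • 1# * suc n • 1#)       ≈⟨ -‿distribʳ-* _ _ ⟩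
    m • 1# * - (suc n • 1#)       ∎
  ⟦⟧-*-homo -[1+ m ] (+ n) = begin
    ⟦ Sign.- ◃ suc m ℕ.* n ⟧      ≡⟨ ≡.cong ⟦_⟧ (ℤ.-◃n≡-n (suc m ℕ.* n)) ⟩
    ⟦ ℤ.- (+ (suc m ℕ.* n)) ⟧     ≈⟨ ⟦⟧-neg (suc m ℕ.* n) ⟩
    - ((suc m ℕ.* n) • 1#)        ≈⟨ -‿cong (×1-homo-* (suc m) n) ⟩
    - (suc m • 1# * n • 1#)       ≈⟨ -‿distribˡ-* _ _ ⟩
    - (suc m • 1#) * n • 1#       ∎
  ⟦⟧-*-homo -[1+ m ] -[1+ n ] = begin
    (suc m ℕ.* suc n) • 1#              ≈⟨ ×1-homo-* (suc m) (suc n) ⟩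
    suc m • 1# * suc n • 1#             ≈⟨ ⁻¹-involutive _ ⟨
    - - (suc m • 1# * suc n • 1#)       ≈⟨ -‿cong (-‿distribʳ-* _ _) ⟩
    - (suc m • 1# * - (suc n • 1#))     ≈⟨ -‿distribˡ-* _ _ ⟩
    - (suc m • 1#) * - (suc n • 1#)     ∎

  -- Sends + 1 to 1# itself rather than to 1 • 1#, so that the constant 1 of the
  -- solver is interpreted by the 1# of the goals.
  ⟦_⟧₁ : ℤ → Carrier
  ⟦ +[1+ 0 ] ⟧₁ = 1#
  ⟦ i ⟧₁        = ⟦ i ⟧

  ⟦⟧₁≈⟦⟧ : ∀ i → ⟦ i ⟧₁ ≈ ⟦ i ⟧
  ⟦⟧₁≈⟦⟧ (+ 0)            = ≈-refl
  ⟦⟧₁≈⟦⟧ +[1+ 0 ]         = ≈-sym (×-homo-1 1#)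
  ⟦⟧₁≈⟦⟧ +[1+ suc n ]     = ≈-refl
  ⟦⟧₁≈⟦⟧ -[1+ n ]         = ≈-refl

  morphism : ℤ.+-*-rawRing -Raw-AlmostCommutative⟶ fromCommutativeRing R
  morphism = record
    { ⟦_⟧    = ⟦_⟧₁
    ; +-homo = λ i j → ≈-trans (⟦⟧₁≈⟦⟧ (i ℤ.+ j))
                 (≈-trans (⟦⟧-+-homo i j) (≈-sym (+-cong (⟦⟧₁≈⟦⟧ i) (⟦⟧₁≈⟦⟧ j))))
    ; *-homo = λ i j → ≈-trans (⟦⟧₁≈⟦⟧ (i ℤ.* j))
                 (≈-trans (⟦⟧-*-homo i j) (≈-sym (*-cong (⟦⟧₁≈⟦⟧ i) (⟦⟧₁≈⟦⟧ j))))
    ; -‿homo = λ i → ≈-trans (⟦⟧₁≈⟦⟧ (ℤ.- i))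
                 (≈-trans (⟦⟧-‿homo i) (≈-sym (-‿cong (⟦⟧₁≈⟦⟧ i))))
    ; 0-homo = ≈-refl
    ; 1-homo = ≈-refl
    }

  _coeff≟_ : ∀ i j → Maybe (⟦ i ⟧₁ ≈ ⟦ j ⟧₁)
  i coeff≟ j with i ℤ.≟ j
  ... | yes i≡j = just (≈-reflexive (≡.cong ⟦_⟧₁ i≡j))
  ... | no  _   = nothing

  open RingSolver ℤ.+-*-rawRing (fromCommutativeRing R) morphism _coeff≟_ public
    using (solve; con; _:=_; _:+_; _:*_; _:-_; :-_; Polynomial)

-- Ordered fields and orientation

module OrderedFieldProperties {c ℓ₁ ℓ₂} (F : OrderedField c ℓ₁ ℓ₂) where
  open OrderedField F
    renaming (refl to ≈-refl; sym to ≈-sym; trans to ≈-trans)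
  open IntegerCoefficients commutativeRing using (solve; con; _:=_; _:+_; _:*_; _:-_; :-_)
  module ≺ = IsStrictTotalOrder isStrictTotalOrder

  private variable x y z : Carrier

  pos-resp : x ≈ y → 0# ≺ x → 0# ≺ y
  pos-resp = ≺.<-respʳ-≈

  nonneg-resp : x ≈ y → 0# ≼ x → 0# ≼ y
  nonneg-resp x≈y (inj₁ 0≺x) = inj₁ (pos-resp x≈y 0≺x)
  nonneg-resp x≈y (inj₂ 0≈x) = inj₂ (≈-trans 0≈x x≈y)

  zero⇒nonneg : x ≈ 0# → 0# ≼ x
  zero⇒nonneg x≈0 = inj₂ (≈-sym x≈0)

  pos⇒nonzero : 0# ≺ x → ¬ (x ≈ 0#)
  pos⇒nonzero 0≺x x≈0 = ≺.irrefl (≈-sym x≈0) 0≺x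

  ≺⇒pos : x ≺ y → 0# ≺ (y ⊝ x)
  ≺⇒pos {x} {y} x≺y =
    ≺.<-respˡ-≈ (-‿inverseˡ x) (≺.<-respʳ-≈ (+-comm (⊖ x) y) (+-mono-≺ (⊖ x) x≺y))

  pos⇒≺ : 0# ≺ (y ⊝ x) → x ≺ y
  pos⇒≺ {y} {x} p =
    ≺.<-respˡ-≈ (+-identityʳ x)
      (≺.<-respʳ-≈ (solve 2 (λ x y → x :+ (y :- x) := y) ≈-refl x y) (+-mono-≺ x p))

  nonneg⇒≼ : 0# ≼ (y ⊝ x) → x ≼ y
  nonneg⇒≼ (inj₁ p) = inj₁ (pos⇒≺ p)
  nonneg⇒≼ {y} {x} (inj₂ p) = inj₂ (begin
    x               ≈⟨ +-identityʳ x ⟨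
    x ⊕ 0#          ≈⟨ +-congˡ p ⟩
    x ⊕ (y ⊝ x)     ≈⟨ solve 2 (λ x y → x :+ (y :- x) := y) ≈-refl x y ⟩
    y               ∎)
    where open SetoidReasoning setoid

  ≼⇒nonneg : x ≼ y → 0# ≼ (y ⊝ x)
  ≼⇒nonneg (inj₁ p) = inj₁ (≺⇒pos p)
  ≼⇒nonneg {x} {y} (inj₂ p) = inj₂ (≈-sym (≈-trans (+-congˡ (-‿cong p)) (-‿inverseʳ y)))

  data Signed (x : Carrier) : Set (ℓ₁ ⊔ ℓ₂) where
    positive : 0# ≺ x → Signed x
    null     : x ≈ 0# → Signed x
    negative : 0# ≺ (⊖ x) → Signed x

  sign : ∀ x → Signed x
  sign x with ≺.compare 0# x
  ... | tri< 0≺x _ _ = positive 0≺x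
  ... | tri≈ _ 0≈x _ = null (≈-sym 0≈x)
  ... | tri> _ _ x≺0 = negative (pos-resp (+-identityˡ (⊖ x)) (≺⇒pos x≺0))

  nonneg-+ : 0# ≼ x → 0# ≼ y → 0# ≼ (x ⊕ y)
  pos-+-nonneg : 0# ≺ x → 0# ≼ y → 0# ≺ (x ⊕ y)
  pos-+-nonneg {x} {y} 0≺x (inj₁ 0≺y) =
    ≺.trans 0≺x (≺.<-respˡ-≈ (+-identityʳ x) (+-mono-≺ x 0≺y))
  pos-+-nonneg {x} {y} 0≺x (inj₂ 0≈y) =
    pos-resp (≈-trans (≈-sym (+-identityʳ x)) (+-congˡ 0≈y)) 0≺x
  nonneg-+ (inj₁ 0≺x) 0≼y = inj₁ (pos-+-nonneg 0≺x 0≼y)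
  nonneg-+ {x} {y} (inj₂ 0≈x) 0≼y =
    nonneg-resp (≈-trans (≈-sym (+-identityˡ y)) (+-congʳ 0≈x)) 0≼y

  nonneg-+-pos : 0# ≼ x → 0# ≺ y → 0# ≺ (x ⊕ y)
  nonneg-+-pos 0≼x 0≺y = pos-resp (+-comm _ _) (pos-+-nonneg 0≺y 0≼x)

  pos-+ : 0# ≺ x → 0# ≺ y → 0# ≺ (x ⊕ y)
  pos-+ 0≺x 0≺y = pos-+-nonneg 0≺x (inj₁ 0≺y)

  nonneg-* : 0# ≼ x → 0# ≼ y → 0# ≼ (x ⊗ y)
  nonneg-* (inj₁ 0≺x) (inj₁ 0≺y) = inj₁ (*-pos 0≺x 0≺y)
  nonneg-* {x} {y} (inj₂ 0≈x) _ = inj₂ (≈-trans (≈-sym (zeroˡ y)) (*-congʳ 0≈x))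
  nonneg-* {x} {y} (inj₁ _) (inj₂ 0≈y) = inj₂ (≈-trans (≈-sym (zeroʳ x)) (*-congˡ 0≈y))

  nonneg-pos-⊥ : 0# ≼ x → 0# ≺ (⊖ x) → ⊥
  nonneg-pos-⊥ {x} 0≼x 0≺-x = pos⇒nonzero (nonneg-+-pos 0≼x 0≺-x) (-‿inverseʳ x)

  nonneg-cancelˡ : 0# ≺ x → 0# ≼ (x ⊗ y) → 0# ≼ y
  nonneg-cancelˡ {x} {y} 0≺x p with sign y
  ... | positive q  = inj₁ q
  ... | null q = inj₂ (≈-sym q)
  ... | negative q  = ⊥-elim (nonneg-pos-⊥ p
    (pos-resp (solve 2 (λ x y → x :* (:- y) := :- (x :* y)) ≈-refl x y) (*-pos 0≺x q)))

  pos-cancelˡ : 0# ≺ x → 0# ≺ (x ⊗ y) → 0# ≺ y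
  pos-cancelˡ {x} {y} 0≺x p with nonneg-cancelˡ 0≺x (inj₁ p)
  ... | inj₁ q = q
  ... | inj₂ q = ⊥-elim (pos⇒nonzero p (≈-trans (*-congˡ (≈-sym q)) (zeroʳ x)))

  pos-inverse : 0# ≺ x → ∃[ y ] 0# ≺ y × (x ⊗ y) ≈ 1#
  pos-inverse {x} 0≺x with inverse x (pos⇒nonzero 0≺x)
  ... | y , xy≈1 = y , pos-cancelˡ 0≺x (pos-resp (≈-sym xy≈1) 0≺1) , xy≈1

  nonzero⇒square-pos : ¬ (x ≈ 0#) → 0# ≺ (x ⊗ x)
  nonzero⇒square-pos {x} x≉0 with sign x
  ... | positive p = *-pos p p
  ... | null p     = ⊥-elim (x≉0 p)
  ... | negative p = pos-resp (solve 1 (λ x → :- x :* :- x := x :* x) ≈-refl x) (*-pos p p)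

  square-nonneg : ∀ x → 0# ≼ (x ⊗ x)
  square-nonneg x with sign x
  ... | positive p  = inj₁ (*-pos p p)
  ... | null p = zero⇒nonneg (≈-trans (*-congʳ p) (zeroˡ x))
  ... | negative p  =
    inj₁ (pos-resp (solve 1 (λ x → :- x :* :- x := x :* x) ≈-refl x) (*-pos p p))

module PlaneProperties {c ℓ₁ ℓ₂} (F : OrderedField c ℓ₁ ℓ₂) where
  open OrderedField F
    renaming (refl to ≈-refl; sym to ≈-sym; trans to ≈-trans)
  open Plane F
  open OrderedFieldProperties F
  open IntegerCoefficients commutativeRing
    using (solve; con; _:=_; _:+_; _:*_; _:-_; :-_; Polynomial)
  open SetoidReasoning setoid

  private variable A B C P Q R : Point

  private
    :area : ∀ {n} (a b c d e f : Polynomial n) → Polynomial n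
    :area a b c d e f = ((c :- a) :* (f :- b)) :- ((d :- b) :* (e :- a))

  lerp : Carrier → Point → Point → Point
  lerp t (x₁ , y₁) (x₂ , y₂) =
    ((1# ⊝ t) ⊗ x₁) ⊕ (t ⊗ x₂) , ((1# ⊝ t) ⊗ y₁) ⊕ (t ⊗ y₂)

  -- A copy of orient that does not unfold, so that unification sees its arguments.
  opaque
    area : Point → Point → Point → Carrier
    area = orient

  Left : Point → Point → Point → Set ℓ₂
  Left A B Q = 0# ≺ area A B Q

  opaque
    unfolding area

    leftTurn⇒left : ∀ A B Q → LeftTurn A B Q → Left A B Q
    leftTurn⇒left A B Q l = l

    left⇒leftTurn : ∀ A B Q → Left A B Q → LeftTurn A B Q
    left⇒leftTurn A B Q l = l

    area-cong : ∀ A B {P Q} → P ≋ Q → area A B P ≈ area A B Q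
    area-cong A B (p , q) =
      +-cong (*-congˡ (+-congʳ q)) (-‿cong (*-congˡ (+-congʳ p)))

    area-cycle : ∀ A B C → area A B C ≈ area B C A
    area-cycle (a , b) (c , d) (e , f) =
      solve 6 (λ a b c d e f → :area a b c d e f := :area c d e f a b) ≈-refl a b c d e f

    area-swap : ∀ A B C → ⊖ area A B C ≈ area B A C
    area-swap (a , b) (c , d) (e , f) =
      solve 6 (λ a b c d e f → :- :area a b c d e f := :area c d a b e f) ≈-refl a b c d e f

    area-startpoint : ∀ A B → area A B A ≈ 0#
    area-startpoint (a , b) (c , d) =
      solve 4 (λ a b c d → :area a b c d a b := con (ℤ.+ 0)) ≈-refl a b c d

    area-endpoint : ∀ A B → area A B B ≈ 0#
    area-endpoint (a , b) (c , d) =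
      solve 4 (λ a b c d → :area a b c d c d := con (ℤ.+ 0)) ≈-refl a b c d

    area-lerp : ∀ A B t P Q →
      area A B (lerp t P Q) ≈ ((1# ⊝ t) ⊗ area A B P) ⊕ (t ⊗ area A B Q)
    area-lerp (a , b) (c , d) t (e , f) (g , h) =
      solve 9 (λ a b c d t e f g h →
        let u = con (ℤ.+ 1) :- t in
        :area a b c d (u :* e :+ t :* g) (u :* f :+ t :* h) :=
        u :* :area a b c d e f :+ t :* :area a b c d g h)
        ≈-refl a b c d t e f g h

    barycentric-sum : ∀ A B C Q →
      area A B C ≈ (area B C Q ⊕ area C A Q) ⊕ area A B Q
    barycentric-sum (a , b) (c , d) (e , f) (g , h) =
      solve 8 (λ a b c d e f g h →
        :area a b c d e f :=
        (:area c d e f g h :+ :area e f a b g h) :+ :area a b c d g h)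
        ≈-refl a b c d e f g h

    barycentric-x : ∀ (A B C Q : Point) →
      area A B C ⊗ proj₁ Q ≈
      ((area B C Q ⊗ proj₁ A) ⊕ (area C A Q ⊗ proj₁ B)) ⊕ (area A B Q ⊗ proj₁ C)
    barycentric-x (a , b) (c , d) (e , f) (g , h) =
      solve 8 (λ a b c d e f g h →
        :area a b c d e f :* g :=
        (:area c d e f g h :* a :+ :area e f a b g h :* c) :+ :area a b c d g h :* e)
        ≈-refl a b c d e f g h

    barycentric-y : ∀ (A B C Q : Point) →
      area A B C ⊗ proj₂ Q ≈
      ((area B C Q ⊗ proj₂ A) ⊕ (area C A Q ⊗ proj₂ B)) ⊕ (area A B Q ⊗ proj₂ C)
    barycentric-y (a , b) (c , d) (e , f) (g , h) =
      solve 8 (λ a b c d e f g h →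
        :area a b c d e f :* h :=
        (:area c d e f g h :* b :+ :area e f a b g h :* d) :+ :area a b c d g h :* f)
        ≈-refl a b c d e f g h

    left⇒distinct : ∀ (A B C : Point) → Left A B C →
      proj₁ B ⊝ proj₁ A ≈ 0# → ¬ (proj₂ B ⊝ proj₂ A ≈ 0#)
    left⇒distinct (a , b) (c , d) (e , f) l dx dy = pos⇒nonzero l (begin
      ((c ⊝ a) ⊗ (f ⊝ b)) ⊝ ((d ⊝ b) ⊗ (e ⊝ a))
        ≈⟨ +-cong (*-congʳ dx) (-‿cong (*-congʳ dy)) ⟩
      (0# ⊗ (f ⊝ b)) ⊝ (0# ⊗ (e ⊝ a))
        ≈⟨ solve 2 (λ x y → con (ℤ.+ 0) :* x :- con (ℤ.+ 0) :* y := con (ℤ.+ 0)) ≈-refl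
             (f ⊝ b) (e ⊝ a) ⟩
      0# ∎)

    area-normal : ∀ (A B P : Point) s →
      let dx = proj₁ B ⊝ proj₁ A ; dy = proj₂ B ⊝ proj₂ A in
      area B A (proj₁ P ⊕ (s ⊗ dy) , proj₂ P ⊕ (s ⊗ (⊖ dx))) ≈
      area B A P ⊕ (s ⊗ ((dx ⊗ dx) ⊕ (dy ⊗ dy)))
    area-normal (a , b) (c , d) (e , f) s =
      solve 7 (λ a b c d e f s →
        :area c d a b (e :+ s :* (d :- b)) (f :+ s :* (:- (c :- a))) :=
        :area c d a b e f :+ s :* ((c :- a) :* (c :- a) :+ (d :- b) :* (d :- b)))
        ≈-refl a b c d e f s

  data Side (A B Q : Point) : Set (ℓ₁ ⊔ ℓ₂) where
    left  : Left A B Q → Side A B Q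
    on    : area A B Q ≈ 0# → Side A B Q
    right : Left B A Q → Side A B Q

  side : ∀ A B Q → Side A B Q
  side A B Q with sign (area A B Q)
  ... | positive p  = left p
  ... | null p = on p
  ... | negative p  = right (pos-resp (area-swap A B Q) p)

  WeakLeft : Point → Point → Point → Set (ℓ₁ ⊔ ℓ₂)
  WeakLeft A B Q = 0# ≼ area A B Q

  left-right-⊥ : WeakLeft A B Q → ¬ Left B A Q
  left-right-⊥ {A} {B} {Q} l r = nonneg-pos-⊥ l (pos-resp (≈-sym (area-swap A B Q)) r)

  ≋-refl : P ≋ P
  ≋-refl = ≈-refl , ≈-refl

  ≋-sym : P ≋ Q → Q ≋ P
  ≋-sym (p , q) = ≈-sym p , ≈-sym q

  segment-resp : ∀ {P Q R R′} → R ≋ R′ → Segment P Q R → Segment P Q R′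
  segment-resp (p , q) (t , 0≼t , t≼1 , x , y) =
    t , 0≼t , t≼1 , ≈-trans (≈-sym p) x , ≈-trans (≈-sym q) y

  segment-sym : ∀ {P Q R} → Segment P Q R → Segment Q P R
  segment-sym {P} {Q} (t , 0≼t , t≼1 , x , y) =
    1# ⊝ t , ≼⇒nonneg t≼1 , nonneg⇒≼ (nonneg-resp (flip t) 0≼t) ,
    ≈-trans x (exchange t (proj₁ P) (proj₁ Q)) , ≈-trans y (exchange t (proj₂ P) (proj₂ Q))
    where
    flip : ∀ t → t ≈ 1# ⊝ (1# ⊝ t)
    flip = solve 1 (λ t → t := con (ℤ.+ 1) :- (con (ℤ.+ 1) :- t)) ≈-refl
    exchange : ∀ t a b →
      ((1# ⊝ t) ⊗ a) ⊕ (t ⊗ b) ≈ ((1# ⊝ (1# ⊝ t)) ⊗ b) ⊕ ((1# ⊝ t) ⊗ a)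
    exchange = solve 3 (λ t a b →
      ((con (ℤ.+ 1) :- t) :* a) :+ (t :* b) :=
      ((con (ℤ.+ 1) :- (con (ℤ.+ 1) :- t)) :* b) :+ ((con (ℤ.+ 1) :- t) :* a)) ≈-refl

  startpoint : ∀ P Q → Segment P Q P
  startpoint (a , b) (c , d) = 0# , inj₂ ≈-refl , inj₁ 0≺1 , lemma a c , lemma b d
    where
    lemma : ∀ a c → a ≈ ((1# ⊝ 0#) ⊗ a) ⊕ (0# ⊗ c)
    lemma = solve 2 (λ a c → a := (con (ℤ.+ 1) :- con (ℤ.+ 0)) :* a :+ con (ℤ.+ 0) :* c) ≈-refl

  endpoint : ∀ P Q → Segment P Q Q
  endpoint (a , b) (c , d) = 1# , inj₁ 0≺1 , inj₂ ≈-refl , lemma a c , lemma b d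
    where
    lemma : ∀ a c → c ≈ ((1# ⊝ 1#) ⊗ a) ⊕ (1# ⊗ c)
    lemma = solve 2 (λ a c → c := (con (ℤ.+ 1) :- con (ℤ.+ 1)) :* a :+ con (ℤ.+ 1) :* c) ≈-refl

  area-segment : ∀ A B t P Q {R} → R ≋ lerp t P Q →
    area A B R ≈ ((1# ⊝ t) ⊗ area A B P) ⊕ (t ⊗ area A B Q)
  area-segment A B t P Q R≋ = ≈-trans (area-cong A B R≋) (area-lerp A B t P Q)

  segment-weakLeft : ∀ A B → Segment P Q R → WeakLeft A B P → WeakLeft A B Q → WeakLeft A B R
  segment-weakLeft {P} {Q} A B (t , 0≼t , t≼1 , R≋) p q =
    nonneg-resp (≈-sym (area-segment A B t P Q R≋))
      (nonneg-+ (nonneg-* (≼⇒nonneg t≼1) p) (nonneg-* 0≼t q))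

  segment-end-cases : Segment P Q R →
    R ≋ Q ⊎ (∀ A B → Left A B P → WeakLeft A B Q → Left A B R)
  segment-end-cases {P} {Q} {R} (t , 0≼t , inj₁ t≺1 , R≋) = inj₂ λ A B p q →
    pos-resp (≈-sym (area-segment A B t P Q R≋))
      (pos-+-nonneg (*-pos (≺⇒pos t≺1) p) (nonneg-* 0≼t q))
  segment-end-cases {P} {Q} {R} (t , 0≼t , inj₂ t≈1 , R≋) =
    inj₁ (≈-trans (proj₁ R≋) (lemma (proj₁ P) (proj₁ Q)) ,
          ≈-trans (proj₂ R≋) (lemma (proj₂ P) (proj₂ Q)))
    where
    lemma : ∀ a c → ((1# ⊝ t) ⊗ a) ⊕ (t ⊗ c) ≈ c
    lemma a c = begin
      ((1# ⊝ t) ⊗ a) ⊕ (t ⊗ c)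
        ≈⟨ +-cong (*-congʳ (+-congˡ (-‿cong t≈1))) (*-congʳ t≈1) ⟩
      ((1# ⊝ 1#) ⊗ a) ⊕ (1# ⊗ c)
        ≈⟨ solve 2 (λ a c → (con (ℤ.+ 1) :- con (ℤ.+ 1)) :* a :+ con (ℤ.+ 1) :* c := c) ≈-refl a c ⟩
      c ∎

  segment-left : ∀ A B → Segment P Q R → Left A B P → WeakLeft A B Q →
    Left A B R ⊎ R ≋ Q
  segment-left {P} {Q} {R} A B s p q with segment-end-cases {P} {Q} {R} s
  ... | inj₁ R≋Q = inj₂ R≋Q
  ... | inj₂ l   = inj₁ (l A B p q)

  segment-left-left : ∀ A B → Segment P Q R → Left A B P → Left A B Q → Left A B R
  segment-left-left A B s p q with segment-left A B s p (inj₁ q)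
  ... | inj₁ r   = r
  ... | inj₂ R≋Q = pos-resp (≈-sym (area-cong A B R≋Q)) q

  segment-start-left : ∀ A B → Segment P Q R → WeakLeft A B P → Left A B Q →
    Left A B R ⊎ R ≋ P
  segment-start-left {P} {Q} {R} A B (t , inj₁ 0≺t , t≼1 , R≋) p q =
    inj₁ (pos-resp (≈-sym (area-segment A B t P Q R≋))
      (nonneg-+-pos (nonneg-* (≼⇒nonneg t≼1) p) (*-pos 0≺t q)))
  segment-start-left {P} {Q} {R} A B (t , inj₂ 0≈t , t≼1 , R≋) p q =
    inj₂ (≈-trans (proj₁ R≋) (lemma (proj₁ P) (proj₁ Q)) ,
          ≈-trans (proj₂ R≋) (lemma (proj₂ P) (proj₂ Q)))
    where
    lemma : ∀ a c → ((1# ⊝ t) ⊗ a) ⊕ (t ⊗ c) ≈ a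
    lemma a c = begin
      ((1# ⊝ t) ⊗ a) ⊕ (t ⊗ c)
        ≈⟨ +-cong (*-congʳ (+-congˡ (-‿cong (≈-sym 0≈t)))) (*-congʳ (≈-sym 0≈t)) ⟩
      ((1# ⊝ 0#) ⊗ a) ⊕ (0# ⊗ c)
        ≈⟨ solve 2 (λ a c → (con (ℤ.+ 1) :- con (ℤ.+ 0)) :* a :+ con (ℤ.+ 0) :* c := a) ≈-refl a c ⟩
      a ∎

  segment-trans : Segment P Q R → ∀ {R′} → Segment P R R′ → Segment P Q R′
  segment-trans {P} {Q} {R} (t , 0≼t , t≼1 , R≋) (s , 0≼s , s≼1 , R′≋) =
    s ⊗ t , nonneg-* 0≼s 0≼t , nonneg⇒≼ 0≼1-st ,
    ≈-trans (proj₁ R′≋) (lemma (proj₁ R≋)) , ≈-trans (proj₂ R′≋) (lemma (proj₂ R≋))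
    where
    0≼1-st : 0# ≼ (1# ⊝ (s ⊗ t))
    0≼1-st = nonneg-resp
      (solve 2 (λ s t → (con (ℤ.+ 1) :- s) :+ s :* (con (ℤ.+ 1) :- t) := con (ℤ.+ 1) :- s :* t) ≈-refl s t)
      (nonneg-+ (≼⇒nonneg s≼1) (nonneg-* 0≼s (≼⇒nonneg t≼1)))
    lemma : ∀ {a b c} → b ≈ ((1# ⊝ t) ⊗ a) ⊕ (t ⊗ c) →
      ((1# ⊝ s) ⊗ a) ⊕ (s ⊗ b) ≈ ((1# ⊝ (s ⊗ t)) ⊗ a) ⊕ ((s ⊗ t) ⊗ c)
    lemma {a} {b} {c} b≈ = ≈-trans (+-congˡ (*-congˡ b≈))
      (solve 4 (λ a c s t →
        (con (ℤ.+ 1) :- s) :* a :+ s :* ((con (ℤ.+ 1) :- t) :* a :+ t :* c) :=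
        (con (ℤ.+ 1) :- s :* t) :* a :+ (s :* t) :* c) ≈-refl a c s t)

  private
    cross-cancel : ∀ p q w → ((q ⊗ w) ⊗ p) ⊕ ((p ⊗ w) ⊗ (⊖ q)) ≈ 0#
    cross-cancel = solve 3 (λ p q w → (q :* w) :* p :+ (p :* w) :* (:- q) := con (ℤ.+ 0)) ≈-refl

    cross-complement : ∀ p q w → ((p ⊕ q) ⊗ w) ⊝ (p ⊗ w) ≈ q ⊗ w
    cross-complement = solve 3 (λ p q w → (p :+ q) :* w :- p :* w := q :* w) ≈-refl

    isolate : ∀ a b c → a ≈ (((a ⊕ b) ⊕ c) ⊝ b) ⊝ c
    isolate = solve 3 (λ a b c → a := ((a :+ b) :+ c) :- b :- c) ≈-refl

    minus-zero : ∀ d b → (d ⊝ b) ⊝ 0# ≈ d ⊝ b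
    minus-zero = solve 2 (λ d b → d :- b :- con (ℤ.+ 0) := d :- b) ≈-refl

    rotate : ∀ d i r → (d ⊗ i) ⊗ r ≈ i ⊗ (d ⊗ r)
    rotate = solve 3 (λ d i r → (d :* i) :* r := i :* (d :* r)) ≈-refl

    collect : ∀ d i b x y z →
      i ⊗ ((((d ⊝ b) ⊗ x) ⊕ (b ⊗ y)) ⊕ (0# ⊗ z)) ≈
      (((d ⊗ i) ⊝ (i ⊗ b)) ⊗ x) ⊕ ((i ⊗ b) ⊗ y)
    collect = solve 6 (λ d i b x y z →
      i :* (((d :- b) :* x :+ b :* y) :+ con (ℤ.+ 0) :* z) :=
      (d :* i :- i :* b) :* x :+ (i :* b) :* y) ≈-refl

    drop-start : ∀ t f → ((1# ⊝ t) ⊗ 0#) ⊕ (t ⊗ f) ≈ f ⊗ t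
    drop-start = solve 2 (λ t f → (con (ℤ.+ 1) :- t) :* con (ℤ.+ 0) :+ t :* f := f :* t) ≈-refl

    drop-end : ∀ t f → ((1# ⊝ t) ⊗ f) ⊕ (t ⊗ 0#) ≈ f ⊗ (1# ⊝ t)
    drop-end = solve 2
      (λ t f → (con (ℤ.+ 1) :- t) :* f :+ t :* con (ℤ.+ 0) := f :* (con (ℤ.+ 1) :- t)) ≈-refl

  crossing-point : ∀ A B → Left A B P → Left B A Q →
    ∃[ R ] Segment P Q R × area A B R ≈ 0#
  crossing-point {P} {Q} A B l r with pos-inverse (pos-+ l r)
  ... | w , 0≺w , w-inv =
    lerp t P Q ,
    (t , inj₁ (*-pos l 0≺w) , nonneg⇒≼ (inj₁ (pos-resp (≈-sym 1-t≈) (*-pos r 0≺w))) , ≋-refl) ,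
    (begin
      area A B (lerp t P Q)
        ≈⟨ area-lerp A B t P Q ⟩
      ((1# ⊝ t) ⊗ p) ⊕ (t ⊗ area A B Q)
        ≈⟨ +-cong (*-congʳ 1-t≈) (*-congˡ (≈-sym (area-swap B A Q))) ⟩
      ((q ⊗ w) ⊗ p) ⊕ ((p ⊗ w) ⊗ (⊖ q))
        ≈⟨ cross-cancel p q w ⟩
      0# ∎)
    where
    p q t : Carrier
    p = area A B P
    q = area B A Q
    t = p ⊗ w
    1-t≈ : 1# ⊝ t ≈ q ⊗ w
    1-t≈ = begin
      1# ⊝ t                    ≈⟨ +-congʳ (≈-sym w-inv) ⟩
      ((p ⊕ q) ⊗ w) ⊝ (p ⊗ w)   ≈⟨ cross-complement p q w ⟩
      q ⊗ w                     ∎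

  segment-of-line : ¬ (area A B C ≈ 0#) → area A B R ≈ 0# → ∀ {P₁ P₂ Q₁ Q₂} →
    area P₁ P₂ A ≈ 0# → Left P₁ P₂ B → WeakLeft P₁ P₂ R →
    area Q₁ Q₂ B ≈ 0# → Left Q₁ Q₂ A → WeakLeft Q₁ Q₂ R →
    Segment A B R
  segment-of-line {A} {B} {C} {R} D≉0 o {P₁} {P₂} {Q₁} {Q₂} pA pB pR qB qA qR
    with inverse (area A B C) D≉0
  ... | i , Di≈1 = t , 0≼t , nonneg⇒≼ 0≼1-t , R≋
    where
    D a b t : Carrier
    D = area A B C
    a = area B C R
    b = area C A R
    t = i ⊗ b
    a≈ : a ≈ D ⊝ b
    a≈ = begin
      a                  ≈⟨ isolate a b (area A B R) ⟩
      (((a ⊕ b) ⊕ area A B R) ⊝ b) ⊝ area A B R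
        ≈⟨ +-cong (+-congʳ (≈-sym (barycentric-sum A B C R))) (-‿cong o) ⟩
      (D ⊝ b) ⊝ 0#       ≈⟨ minus-zero D b ⟩
      D ⊝ b              ∎
    coordinate : ∀ {r x y z} →
      D ⊗ r ≈ ((a ⊗ x) ⊕ (b ⊗ y)) ⊕ (area A B R ⊗ z) →
      r ≈ ((1# ⊝ t) ⊗ x) ⊕ (t ⊗ y)
    coordinate {r} {x} {y} {z} eq = begin
      r                          ≈⟨ *-identityˡ r ⟨
      1# ⊗ r                     ≈⟨ *-congʳ Di≈1 ⟨
      (D ⊗ i) ⊗ r                ≈⟨ rotate D i r ⟩
      i ⊗ (D ⊗ r)                ≈⟨ *-congˡ eq ⟩
      i ⊗ (((a ⊗ x) ⊕ (b ⊗ y)) ⊕ (area A B R ⊗ z))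
        ≈⟨ *-congˡ (+-cong (+-congʳ (*-congʳ a≈)) (*-congʳ o)) ⟩
      i ⊗ ((((D ⊝ b) ⊗ x) ⊕ (b ⊗ y)) ⊕ (0# ⊗ z))
        ≈⟨ collect D i b x y z ⟩
      (((D ⊗ i) ⊝ t) ⊗ x) ⊕ (t ⊗ y)
        ≈⟨ +-congʳ (*-congʳ (+-congʳ Di≈1)) ⟩
      ((1# ⊝ t) ⊗ x) ⊕ (t ⊗ y)   ∎
    R≋ : R ≋ lerp t A B
    R≋ = coordinate (barycentric-x A B C R) , coordinate (barycentric-y A B C R)
    0≼t : 0# ≼ t
    0≼t = nonneg-cancelˡ pB (nonneg-resp (begin
      area P₁ P₂ R
        ≈⟨ area-segment P₁ P₂ t A B R≋ ⟩
      ((1# ⊝ t) ⊗ area P₁ P₂ A) ⊕ (t ⊗ area P₁ P₂ B)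
        ≈⟨ +-congʳ (*-congˡ pA) ⟩
      ((1# ⊝ t) ⊗ 0#) ⊕ (t ⊗ area P₁ P₂ B)
        ≈⟨ drop-start t _ ⟩
      area P₁ P₂ B ⊗ t ∎) pR)
    0≼1-t : 0# ≼ (1# ⊝ t)
    0≼1-t = nonneg-cancelˡ qA (nonneg-resp (begin
      area Q₁ Q₂ R
        ≈⟨ area-segment Q₁ Q₂ t A B R≋ ⟩
      ((1# ⊝ t) ⊗ area Q₁ Q₂ A) ⊕ (t ⊗ area Q₁ Q₂ B)
        ≈⟨ +-congˡ (*-congˡ qB) ⟩
      ((1# ⊝ t) ⊗ area Q₁ Q₂ A) ⊕ (t ⊗ 0#)
        ≈⟨ drop-end t _ ⟩
      area Q₁ Q₂ A ⊗ (1# ⊝ t) ∎) qR)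

  AllLeft : List (Point × Point) → Point → Set _
  AllLeft ls Q = All (λ (A , B) → Left A B Q) ls

  AllWeakLeft : List (Point × Point) → Point → Set _
  AllWeakLeft ls Q = All (λ (A , B) → WeakLeft A B Q) ls

  FirstExit : List (Point × Point) → Point → Point → Set _
  FirstExit ls P Q =
    ∃[ R ] Segment P Q R × AllWeakLeft ls R × ∃[ A ] ∃[ B ] (A , B) ∈ ls × area A B R ≈ 0#

  segment-allWeakLeft : ∀ P Q R → Segment P Q R → ∀ ls → AllLeft ls P → AllWeakLeft ls Q →
    AllWeakLeft ls R
  segment-allWeakLeft P Q R s []             []       []       = []
  segment-allWeakLeft P Q R s ((A , B) ∷ ls) (p ∷ ps) (q ∷ qs) =
    segment-weakLeft {P} {Q} {R} A B s (inj₁ p) q ∷ segment-allWeakLeft P Q R s ls ps qs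

  first-exit : ∀ P Q ls → AllLeft ls P → AllLeft ls Q ⊎ FirstExit ls P Q
  first-exit P Q [] [] = inj₁ []
  first-exit P Q ((A , B) ∷ ls) (p ∷ ps) with first-exit P Q ls ps
  ... | inj₁ qs = extend (side A B Q)
    where
    extend : Side A B Q → AllLeft ((A , B) ∷ ls) Q ⊎ FirstExit ((A , B) ∷ ls) P Q
    extend (left q)  = inj₁ (q ∷ qs)
    extend (on q)    =
      inj₂ (Q , endpoint P Q , zero⇒nonneg q ∷ All.map inj₁ qs , A , B , here ≡.refl , q)
    extend (right q) =
      let R , s , r = crossing-point {P} {Q} A B p q in
      inj₂ (R , s , zero⇒nonneg r ∷ segment-allWeakLeft P Q R s ls ps (All.map inj₁ qs) ,
            A , B , here ≡.refl , r)
  ... | inj₂ (R , s , rs , A′ , B′ , ∈ls , r) = inj₂ (extend (side A B R))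
    where
    extend : Side A B R → FirstExit ((A , B) ∷ ls) P Q
    extend (left q)  = R , s , inj₁ q ∷ rs , A′ , B′ , there ∈ls , r
    extend (on q)    = R , s , zero⇒nonneg q ∷ rs , A′ , B′ , there ∈ls , r
    extend (right q) =
      let R′ , s′ , r′ = crossing-point {P} {R} A B p q in
      R′ , segment-trans {P} {Q} {R} s s′ ,
      zero⇒nonneg r′ ∷ segment-allWeakLeft P R R′ s′ ls ps rs ,
      A , B , here ≡.refl , r′

-- Polygons and points in convex position

data IsSide {A : Set} {q : ℕ} (T : Vec A (suc q)) : A → A → Set where
  forward : ∀ j → IsSide T (lookup T (inject₁ j)) (lookup T (suc j))
  closing : IsSide T (lookup T (fromℕ q)) (lookup T zero)

module _ {A : Set} where

  data IsStep (y : A) {q : ℕ} (T : Vec A (suc q)) : A → A → Set where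
    forward : ∀ j → IsStep y T (lookup T (inject₁ j)) (lookup T (suc j))
    closing : IsStep y T (lookup T (fromℕ q)) y

  ∈-zip⇒IsStep : ∀ {q} (x : A) (xs : Vec A q) {y u v} →
    (u , v) ∈ zip (x ∷ toList xs) (toList xs ∷ʳ y) → IsStep y (x ∷ xs) u v
  ∈-zip⇒IsStep x []        (here ≡.refl) = closing
  ∈-zip⇒IsStep x (x′ ∷ xs) (here ≡.refl) = forward zero
  ∈-zip⇒IsStep x (x′ ∷ xs) (there ∈zip) with ∈-zip⇒IsStep x′ xs ∈zip
  ... | forward j = forward (suc j)
  ... | closing   = closing

  forward-∈-zip : ∀ {q} (x : A) (xs : Vec A q) {y} (j : Fin q) →
    (lookup (x ∷ xs) (inject₁ j) , lookup xs j) ∈ zip (x ∷ toList xs) (toList xs ∷ʳ y)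
  forward-∈-zip x (x′ ∷ xs) zero    = here ≡.refl
  forward-∈-zip x (x′ ∷ xs) (suc j) = there (forward-∈-zip x′ xs j)

  closing-∈-zip : ∀ {q} (x : A) (xs : Vec A q) {y} →
    (lookup (x ∷ xs) (fromℕ q) , y) ∈ zip (x ∷ toList xs) (toList xs ∷ʳ y)
  closing-∈-zip x []        = here ≡.refl
  closing-∈-zip x (x′ ∷ xs) = there (closing-∈-zip x′ xs)

  ∈-sides⇒IsSide : ∀ {q} (T : Vec A (suc q)) {u v} → (u , v) ∈ sides (toList T) → IsSide T u v
  ∈-sides⇒IsSide (x ∷ xs) ∈sides with ∈-zip⇒IsStep x xs ∈sides
  ... | forward j = forward j
  ... | closing   = closing

  IsSide⇒∈-sides : ∀ {q} (T : Vec A (suc q)) {u v} → IsSide T u v → (u , v) ∈ sides (toList T)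
  IsSide⇒∈-sides (x ∷ xs) (forward j) = forward-∈-zip x xs j
  IsSide⇒∈-sides (x ∷ xs) closing     = closing-∈-zip x xs

  out-side : ∀ {q} (T : Vec A (suc q)) i → ∃[ v ] IsSide T (lookup T i) v
  out-side {q} T i with view i
  ... | ‵fromℕ    = lookup T zero , closing
  ... | ‵inject₁ j = lookup T (suc j) , forward j

discrete-IVT : ∀ {p q} {m} (P : Fin (suc m) → Set p) (Q : Fin (suc m) → Set q) →
  (∀ i → P i ⊎ Q i) → (∀ i → P i → Q i → ⊥) → P zero → Q (fromℕ m) →
  ∃[ j ] P (inject₁ {m} j) × Q (suc j)
discrete-IVT {m = zero}  P Q cover disjoint p q = ⊥-elim (disjoint zero p q)
discrete-IVT {m = suc m} P Q cover disjoint p q with cover (suc zero)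
... | inj₂ q₁ = zero , p , q₁
... | inj₁ p₁ =
  let j , pj , qj = discrete-IVT (λ i → P (suc i)) (λ i → Q (suc i))
                      (λ i → cover (suc i)) (λ i → disjoint (suc i)) p₁ q
  in suc j , pj , qj

StrictlyIncreasing : ∀ {n m} → Vec (Fin n) m → Set
StrictlyIncreasing T = ∀ i j → i Fin.< j → lookup T i Fin.< lookup T j

module BoundProperties {c ℓ₁ ℓ₂} (F : OrderedField c ℓ₁ ℓ₂) where
  open OrderedField F hiding (zero)
    renaming (refl to ≈-refl; sym to ≈-sym; trans to ≈-trans)
  open OrderedFieldProperties F
  open IntegerCoefficients commutativeRing using (solve; con; _:=_; _:+_; _:*_; _:-_; :-_)

  Bounds : Carrier → Carrier → Set _
  Bounds M x = 0# ≼ (x ⊕ M) × 0# ≼ (M ⊝ x)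

  bound : ∀ x → ∃[ M ] 0# ≼ M × Bounds M x
  bound x with sign x
  ... | positive p = x , inj₁ p , inj₁ (pos-+ p p) , zero⇒nonneg (-‿inverseʳ x)
  ... | null p     = 0# , inj₂ ≈-refl , zero⇒nonneg (≈-trans (+-identityʳ x) p) ,
    zero⇒nonneg (≈-trans (+-congˡ (-‿cong p)) (-‿inverseʳ 0#))
  ... | negative p = ⊖ x , inj₁ p , zero⇒nonneg (-‿inverseʳ x) , inj₁ (pos-+ p p)

  bounds-widen : ∀ {M x} N → 0# ≼ N → Bounds M x → Bounds (M ⊕ N) x
  bounds-widen {M} {x} N 0≼N (l , u) =
    nonneg-resp (solve 3 (λ x M N → (x :+ M) :+ N := x :+ (M :+ N)) ≈-refl x M N) (nonneg-+ l 0≼N) ,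
    nonneg-resp (solve 3 (λ x M N → (M :- x) :+ N := (M :+ N) :- x) ≈-refl x M N) (nonneg-+ u 0≼N)

  bound-all : ∀ {m} (f : Fin m → Carrier) → ∃[ M ] 0# ≼ M × (∀ i → Bounds M (f i))
  bound-all {zero}  f = 0# , inj₂ ≈-refl , λ ()
  bound-all {suc m} f with bound (f zero) | bound-all (λ i → f (suc i))
  ... | M , 0≼M , b | N , 0≼N , bs = M ⊕ N , nonneg-+ 0≼M 0≼N , λ where
    zero    → bounds-widen N 0≼N b
    (suc i) → let l , u = bounds-widen M 0≼M (bs i) in
      nonneg-resp (+-congˡ (+-comm N M)) l , nonneg-resp (+-congʳ (+-comm N M)) u

  bounds-convex : ∀ {M D a b c x y z q} →
    0# ≺ D → 0# ≼ a → 0# ≼ b → 0# ≼ c → D ≈ ((a ⊕ b) ⊕ c) →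
    D ⊗ q ≈ ((a ⊗ x) ⊕ (b ⊗ y)) ⊕ (c ⊗ z) →
    Bounds M x → Bounds M y → Bounds M z → Bounds M q
  bounds-convex {M} {D} {a} {b} {c} {x} {y} {z} {q} 0≺D 0≼a 0≼b 0≼c D≈ eq
    (xl , xu) (yl , yu) (zl , zu) =
    nonneg-cancelˡ 0≺D (nonneg-resp
      (≈-sym (≈-trans (distribˡ D q M) (≈-trans (+-cong eq (*-congʳ D≈)) (expand₁ M a b c x y z))))
      (combine xl yl zl)) ,
    nonneg-cancelˡ 0≺D (nonneg-resp
      (≈-sym (≈-trans (expand₃ D M q) (≈-trans (+-cong (*-congʳ D≈) (-‿cong eq))
        (expand₂ M a b c x y z))))
      (combine xu yu zu))
    where
    combine : ∀ {x y z} → 0# ≼ x → 0# ≼ y → 0# ≼ z → 0# ≼ (((a ⊗ x) ⊕ (b ⊗ y)) ⊕ (c ⊗ z))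
    combine p q r = nonneg-+ (nonneg-+ (nonneg-* 0≼a p) (nonneg-* 0≼b q)) (nonneg-* 0≼c r)
    expand₁ : ∀ M a b c x y z →
      (((a ⊗ x) ⊕ (b ⊗ y)) ⊕ (c ⊗ z)) ⊕ (((a ⊕ b) ⊕ c) ⊗ M) ≈
      ((a ⊗ (x ⊕ M)) ⊕ (b ⊗ (y ⊕ M))) ⊕ (c ⊗ (z ⊕ M))
    expand₁ = solve 7 (λ M a b c x y z →
      (((a :* x) :+ (b :* y)) :+ (c :* z)) :+ (((a :+ b) :+ c) :* M) :=
      ((a :* (x :+ M)) :+ (b :* (y :+ M))) :+ (c :* (z :+ M))) ≈-refl
    expand₂ : ∀ M a b c x y z →
      (((a ⊕ b) ⊕ c) ⊗ M) ⊝ (((a ⊗ x) ⊕ (b ⊗ y)) ⊕ (c ⊗ z)) ≈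
      ((a ⊗ (M ⊝ x)) ⊕ (b ⊗ (M ⊝ y))) ⊕ (c ⊗ (M ⊝ z))
    expand₂ = solve 7 (λ M a b c x y z →
      (((a :+ b) :+ c) :* M) :- (((a :* x) :+ (b :* y)) :+ (c :* z)) :=
      ((a :* (M :- x)) :+ (b :* (M :- y))) :+ (c :* (M :- z))) ≈-refl
    expand₃ : ∀ D M q → D ⊗ (M ⊝ q) ≈ (D ⊗ M) ⊝ (D ⊗ q)
    expand₃ = solve 3 (λ D M q → D :* (M :- q) := (D :* M) :- (D :* q)) ≈-refl

module ConvexProperties {c ℓ₁ ℓ₂} (F : OrderedField c ℓ₁ ℓ₂)
  {n : ℕ} (S : Fin n → Plane.Point F) (convexPosition : Plane.ConvexPosition F S) where
  open OrderedField F hiding (zero)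
    renaming (refl to ≈-refl; sym to ≈-sym; trans to ≈-trans)
  open Plane F
  open OrderedFieldProperties F
  open PlaneProperties F
  open BoundProperties F

  private variable u v w x y u′ v′ : Fin n

  convex : ∀ u v w → u Fin.< v → v Fin.< w → Left (S u) (S v) (S w)
  convex u v w u<v v<w = leftTurn⇒left (S u) (S v) (S w) (convexPosition u v w u<v v<w)

  rotateˡ : Left (S u) (S v) (S w) → Left (S v) (S w) (S u)
  rotateˡ = pos-resp (area-cycle (S _) (S _) (S _))

  left-before : x Fin.< u → u Fin.< v → Left (S u) (S v) (S x)
  left-before x<u u<v = rotateˡ (convex _ _ _ x<u u<v)

  right-between : u Fin.< x → x Fin.< v → Left (S v) (S u) (S x)
  right-between u<x x<v = rotateˡ (rotateˡ (convex _ _ _ u<x x<v))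

  left⇒nonzero : Left (S u) (S v) (S x) → ¬ (area (S u) (S v) (S x) ≈ 0#)
  left⇒nonzero = pos⇒nonzero

  right⇒nonzero : Left (S v) (S u) (S x) → ¬ (area (S u) (S v) (S x) ≈ 0#)
  right⇒nonzero {v} {u} {x} r o =
    left-right-⊥ {S u} {S v} {S x} (zero⇒nonneg o) r

  collinear⇒endpoint : u Fin.< v → area (S u) (S v) (S x) ≈ 0# → x ≡ u ⊎ x ≡ v
  collinear⇒endpoint {u} {v} {x} u<v o with Fin.<-cmp x u | Fin.<-cmp x v
  ... | tri≈ _ x≡u _ | _            = inj₁ x≡u
  ... | tri< x<u _ _ | _            = ⊥-elim (left⇒nonzero (left-before x<u u<v) o)
  ... | tri> _ _ u<x | tri< x<v _ _ = ⊥-elim (right⇒nonzero (right-between u<x x<v) o)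
  ... | tri> _ _ u<x | tri≈ _ x≡v _ = inj₂ x≡v
  ... | tri> _ _ u<x | tri> _ _ v<x = ⊥-elim (left⇒nonzero (convex _ _ _ u<v v<x) o)

  Outside : Fin n → Fin n → Fin n → Set
  Outside u v x = x Fin.≤ u ⊎ v Fin.≤ x

  start-weakLeft : WeakLeft (S u) (S v) (S u)
  start-weakLeft = zero⇒nonneg (area-startpoint (S _) (S _))

  end-weakLeft : WeakLeft (S u) (S v) (S v)
  end-weakLeft = zero⇒nonneg (area-endpoint (S _) (S _))

  outside⇒weakLeft : u Fin.< v → Outside u v x → WeakLeft (S u) (S v) (S x)
  outside⇒weakLeft {u} {v} {x} u<v (inj₁ x≤u) with Fin.<-cmp x u
  ... | tri< x<u _ _    = inj₁ (left-before x<u u<v)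
  ... | tri≈ _ ≡.refl _ = start-weakLeft
  ... | tri> _ _ u<x    = ⊥-elim (ℕ.<⇒≱ u<x x≤u)
  outside⇒weakLeft {u} {v} {x} u<v (inj₂ v≤x) with Fin.<-cmp x v
  ... | tri< x<v _ _    = ⊥-elim (ℕ.<⇒≱ x<v v≤x)
  ... | tri≈ _ ≡.refl _ = end-weakLeft
  ... | tri> _ _ v<x    = inj₁ (convex _ _ _ u<v v<x)

  between⇒weakRight : u Fin.≤ x → x Fin.≤ v → WeakLeft (S v) (S u) (S x)
  between⇒weakRight {u} {x} {v} u≤x x≤v with Fin.<-cmp u x | Fin.<-cmp x v
  ... | tri> _ _ x<u    | _               = ⊥-elim (ℕ.<⇒≱ x<u u≤x)
  ... | tri≈ _ ≡.refl _ | _               = end-weakLeft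
  ... | tri< _ _ _      | tri> _ _ v<x    = ⊥-elim (ℕ.<⇒≱ v<x x≤v)
  ... | tri< _ _ _      | tri≈ _ ≡.refl _ = start-weakLeft
  ... | tri< u<x _ _    | tri< x<v _ _    = inj₁ (right-between u<x x<v)

  segment⇒collinear : ∀ {A B} {Q} → Segment A B Q → area A B Q ≈ 0#
  segment⇒collinear {A} {B} {Q} s
    with segment-weakLeft {A} {B} {Q} A B s
           (zero⇒nonneg (area-startpoint A B)) (zero⇒nonneg (area-endpoint A B))
  ... | inj₂ 0≈ = ≈-sym 0≈
  ... | inj₁ l  = ⊥-elim (left-right-⊥ {B} {A} {Q} (segment-weakLeft {A} {B} {Q} B A s
                    (zero⇒nonneg (area-endpoint B A)) (zero⇒nonneg (area-startpoint B A))) l)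

  swap-zero : ∀ A B Q → area A B Q ≈ 0# → area B A Q ≈ 0#
  swap-zero A B Q o = ≈-trans (≈-sym (area-swap A B Q)) (≈-trans (-‿cong o) -0#≈0#)
    where
    open import Algebra.Properties.Ring ring using (-0#≈0#)

  crossing-chords-meet : ∀ u u′ v v′ → u Fin.< u′ → u′ Fin.< v → v Fin.< v′ →
    ∃[ Q ] Segment (S u) (S v) Q × Segment (S u′) (S v′) Q
  crossing-chords-meet u u′ v v′ u<u′ u′<v v<v′ = Q , on-chord , s
    where
    crossing : ∃[ Q ] Segment (S u′) (S v′) Q × area (S v) (S u) Q ≈ 0#
    crossing = crossing-point {S u′} {S v′} (S v) (S u)
      (right-between u<u′ u′<v) (convex u v v′ (ℕ.<-trans u<u′ u′<v) v<v′)
    Q : Point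
    Q = proj₁ crossing
    s : Segment (S u′) (S v′) Q
    s = proj₁ (proj₂ crossing)
    l₁ : Left (S u) (S u′) (S v′)
    l₁ = convex u u′ v′ u<u′ (ℕ.<-trans u′<v v<v′)
    wl₁ : WeakLeft (S u) (S u′) Q
    wl₁ = segment-weakLeft {S u′} {S v′} {Q} (S u) (S u′) s end-weakLeft (inj₁ l₁)
    wl₂ : WeakLeft (S u′) (S v) Q
    wl₂ = segment-weakLeft {S u′} {S v′} {Q} (S u′) (S v) s start-weakLeft
        (inj₁ (convex u′ v v′ u′<v v<v′))
    on-chord : Segment (S u) (S v) Q
    on-chord = segment-of-line {S u} {S v} {S u′} {Q}
      (right⇒nonzero (right-between u<u′ u′<v))
      (swap-zero (S v) (S u) Q (proj₂ (proj₂ crossing)))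
      {S u} {S u′} {S u′} {S v}
      (area-startpoint (S u) (S u′)) (convex u u′ v u<u′ u′<v) wl₁
      (area-endpoint (S u′) (S v)) (left-before u<u′ u′<v) wl₂

  inner-collinear⇒segment : ∀ Q → u Fin.< x → x Fin.< v → u Fin.< y → y Fin.< v →
    Left (S u) (S x) Q → Left (S y) (S v) Q → area (S u) (S v) Q ≈ 0# →
    Segment (S u) (S v) Q
  inner-collinear⇒segment {u} {x} {v} {y} Q u<x x<v u<y y<v lx ly o =
    segment-of-line {S u} {S v} {S x} {Q} (right⇒nonzero (right-between u<x x<v)) o
      {S u} {S x} {S y} {S v}
      (area-startpoint (S u) (S x)) (convex _ _ _ u<x x<v) (inj₁ lx)
      (area-endpoint (S y) (S v)) (left-before u<y y<v) (inj₁ ly)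

  CommonEndpoint : (u v u′ v′ : Fin n) → Point → Set _
  CommonEndpoint u v u′ v′ Q = ∃[ w ] (w ≡ u ⊎ w ≡ v) × (w ≡ u′ ⊎ w ≡ v′) × Q ≋ S w

  oneSided-meet : (∀ x → area (S u) (S v) (S x) ≈ 0# → x ≡ u ⊎ x ≡ v) →
    u′ ≢ v′ → ¬ SameEdge u v u′ v′ →
    WeakLeft (S u) (S v) (S u′) → WeakLeft (S u) (S v) (S v′) →
    ∀ Q → Segment (S u) (S v) Q → Segment (S u′) (S v′) Q → CommonEndpoint u v u′ v′ Q
  oneSided-meet {u} {v} {u′} {v′} endpoints u′≢v′ ≢edge l l′ Q s s′ = go l l′
    where
    o : area (S u) (S v) Q ≈ 0#
    o = segment⇒collinear {S u} {S v} {Q} s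
    go : WeakLeft (S u) (S v) (S u′) → WeakLeft (S u) (S v) (S v′) → CommonEndpoint u v u′ v′ Q
    go (inj₁ l) l′ with segment-left {S u′} {S v′} {Q} (S u) (S v) s′ l l′
    ... | inj₁ lQ = ⊥-elim (pos⇒nonzero lQ o)
    ... | inj₂ Q≋ =
      v′ , endpoints v′ (≈-trans (≈-sym (area-cong (S u) (S v) Q≋)) o) , inj₂ ≡.refl , Q≋
    go l@(inj₂ _) (inj₁ l′) with segment-start-left {S u′} {S v′} {Q} (S u) (S v) s′ l l′
    ... | inj₁ lQ = ⊥-elim (pos⇒nonzero lQ o)
    ... | inj₂ Q≋ =
      u′ , endpoints u′ (≈-trans (≈-sym (area-cong (S u) (S v) Q≋)) o) , inj₁ ≡.refl , Q≋
    go (inj₂ z) (inj₂ z′) with endpoints u′ (≈-sym z) | endpoints v′ (≈-sym z′)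
    ... | inj₁ ≡.refl | inj₁ ≡.refl = ⊥-elim (u′≢v′ ≡.refl)
    ... | inj₁ ≡.refl | inj₂ ≡.refl = ⊥-elim (≢edge (inj₁ (≡.refl , ≡.refl)))
    ... | inj₂ ≡.refl | inj₁ ≡.refl = ⊥-elim (≢edge (inj₂ (≡.refl , ≡.refl)))
    ... | inj₂ ≡.refl | inj₂ ≡.refl = ⊥-elim (u′≢v′ ≡.refl)

  coordinate-bound : ∃[ M ] (∀ v → Bounds M (proj₁ (S v)) × Bounds M (proj₂ (S v)))
  coordinate-bound with bound-all (λ v → proj₁ (S v)) | bound-all (λ v → proj₂ (S v))
  ... | M , 0≼M , bx | N , 0≼N , by = M ⊕ N , λ v →
    bounds-widen N 0≼N (bx v) ,
    let l , r = bounds-widen M 0≼M (by v) in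
    nonneg-resp (+-congˡ (+-comm N M)) l , nonneg-resp (+-congʳ (+-comm N M)) r

  module Polygon {q : ℕ} (T : Vec (Fin n) (3 ℕ.+ q)) (increasing : StrictlyIncreasing T) where

    vertex : Fin (3 ℕ.+ q) → Point
    vertex i = S (lookup T i)

    inject₁<suc : ∀ {m} (j : Fin m) → inject₁ j Fin.< suc j
    inject₁<suc j = s≤s (ℕ.≤-reflexive (Fin.toℕ-inject₁ j))

    forward< : ∀ j → lookup T (inject₁ j) Fin.< lookup T (suc j)
    forward< j = increasing _ _ (inject₁<suc j)

    closing< : lookup T zero Fin.< lookup T (fromℕ (2 ℕ.+ q))
    closing< = increasing _ _ (s≤s z≤n)

    previous : IsSide T u v → ∃[ p ] IsSide T p u × Left (S p) (S u) (S v)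
    previous (forward zero) = _ , closing ,
      rotateˡ (rotateˡ (convex _ _ _ (increasing zero (suc zero) (s≤s z≤n))
        (increasing (suc zero) (fromℕ (2 ℕ.+ q)) (s≤s (s≤s z≤n)))))
    previous (forward (suc j)) = _ , forward (inject₁ j) ,
      convex _ _ _ (forward< (inject₁ j)) (forward< (suc j))
    previous closing = _ , forward (fromℕ (suc q)) ,
      rotateˡ (convex _ _ _ (increasing zero (inject₁ (fromℕ (suc q))) (s≤s z≤n)) (forward< (fromℕ (suc q))))

    next : IsSide T u v → ∃[ w ] IsSide T v w × Left (S v) (S w) (S u)
    next (forward j) with view j
    ... | ‵fromℕ = _ , closing , rotateˡ (rotateˡ (convex _ _ _
        (increasing zero (inject₁ (fromℕ (suc q))) (s≤s z≤n)) (forward< (fromℕ (suc q)))))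
    ... | ‵inject₁ j′ = _ , forward (suc j′) ,
      rotateˡ (convex _ _ _ (forward< (inject₁ j′)) (forward< (suc j′)))
    next closing = _ , forward zero , convex _ _ _ (increasing zero (suc zero) (s≤s z≤n))
        (increasing (suc zero) (fromℕ (2 ℕ.+ q)) (s≤s (s≤s z≤n)))

    interior⇒left : ∀ Q → Interior S T Q → IsSide T u v → Left (S u) (S v) Q
    interior⇒left Q int s =
      leftTurn⇒left _ _ Q (All.lookup int (IsSide⇒∈-sides T s))

    left⇒interior : ∀ Q → (∀ {u v} → IsSide T u v → Left (S u) (S v) Q) → Interior S T Q
    left⇒interior Q l = All.tabulate (λ ∈sides → left⇒leftTurn _ _ Q (l (∈-sides⇒IsSide T ∈sides)))

    interior-convex : ∀ P Q R → Interior S T P → Interior S T Q → Segment P Q R → Interior S T R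
    interior-convex P Q R p q s = left⇒interior R (λ {u} {v} side →
      segment-left-left {P} {Q} {R} (S u) (S v) s (interior⇒left P p side) (interior⇒left Q q side))

    collinear⇒side : ∀ R → (∀ {u v} → IsSide T u v → WeakLeft (S u) (S v) R) →
      IsSide T u v → area (S u) (S v) R ≈ 0# → Segment (S u) (S v) R
    collinear⇒side {u} {v} R weak side o with previous side | next side
    ... | p , pu , l | w , vw , l′ =
      segment-of-line {S u} {S v} {S p} {R} (left⇒nonzero (rotateˡ l)) o
        {S p} {S u} {S v} {S w}
        (area-endpoint (S p) (S u)) l (weak pu)
        (area-startpoint (S v) (S w)) l′ (weak vw)

    cross-boundary : ∀ P Q → Interior S T P →
      Interior S T Q ⊎ ∃[ R ] Segment P Q R × ∃[ u ] ∃[ v ] IsSide T u v × Segment (S u) (S v) R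
    cross-boundary P Q int
      with first-exit P Q (map (λ (u , v) → S u , S v) (sides (toList T)))
             (All.map⁺ (All.map (leftTurn⇒left _ _ P) int))
    ... | inj₁ ls = inj₁ (All.map (left⇒leftTurn _ _ Q) (All.map⁻ ls))
    ... | inj₂ (R , s , weak , A , B , ∈ls , o) with ∈-map⁻ (λ (u , v) → S u , S v) ∈ls
    ...   | (u , v) , ∈sides , ≡.refl = inj₂ (R , s , u , v , uv , collinear⇒side R
        (λ side → All.lookup (All.map⁻ weak) (IsSide⇒∈-sides T side)) uv o)
      where
      uv : IsSide T u v
      uv = ∈-sides⇒IsSide T ∈sides

    vertex-weakLeft : IsSide T u v → ∀ i → WeakLeft (S u) (S v) (vertex i)
    vertex-weakLeft closing i =
      between⇒weakRight (mono z≤n) (mono (Fin.≤fromℕ i))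
      where
      mono : ∀ {i j} → i Fin.≤ j → lookup T i Fin.≤ lookup T j
      mono {i} {j} i≤j with ℕ.m≤n⇒m<n∨m≡n i≤j
      ... | inj₁ i<j = ℕ.<⇒≤ (increasing i j i<j)
      ... | inj₂ i≡j = ℕ.≤-reflexive (≡.cong (λ k → toℕ (lookup T k)) (Fin.toℕ-injective i≡j))
    vertex-weakLeft (forward j) i = outside⇒weakLeft (forward< j) outside
      where
      outside : Outside (lookup T (inject₁ j)) (lookup T (suc j)) (lookup T i)
      outside with Fin.<-cmp i (suc j)
      ... | tri≈ _ ≡.refl _ = inj₂ ℕ.≤-refl
      ... | tri> _ _ j<i    = inj₂ (ℕ.<⇒≤ (increasing _ _ j<i))
      ... | tri< i<j _ _ with ℕ.m≤n⇒m<n∨m≡n (ℕ.≤-pred i<j)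
      ...   | inj₁ i<j′ = inj₁ (ℕ.<⇒≤ (increasing _ _
                (ℕ.<-≤-trans i<j′ (ℕ.≤-reflexive (≡.sym (Fin.toℕ-inject₁ j))))))
      ...   | inj₂ i≡j  = inj₁ (ℕ.≤-reflexive (≡.cong (λ k → toℕ (lookup T k))
                (Fin.toℕ-injective (≡.trans i≡j (≡.sym (Fin.toℕ-inject₁ j))))))

    half : ∃[ h ] 0# ≺ h × (1# ⊕ 1#) ⊗ h ≈ 1#
    half = pos-inverse (pos-+ 0≺1 0≺1)

    h : Carrier
    h = proj₁ half

    0≺h : 0# ≺ h
    0≺h = proj₁ (proj₂ half)

    0≺1-h : 0# ≺ (1# ⊝ h)
    0≺1-h = pos-resp (≈-trans (lemma h) (+-congʳ (proj₂ (proj₂ half)))) 0≺h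
      where
      open IntegerCoefficients commutativeRing using (solve; con; _:=_; _:+_; _:*_; _:-_)
      lemma : ∀ h → h ≈ ((1# ⊕ 1#) ⊗ h) ⊝ h
      lemma = solve 1 (λ h → h := (con (ℤ.+ 1) :+ con (ℤ.+ 1)) :* h :- h) ≈-refl

    midpoint : Point → Point → Point
    midpoint = lerp h

    midpoint-left₁ : ∀ A B P Q → Left A B P → WeakLeft A B Q → Left A B (midpoint P Q)
    midpoint-left₁ A B P Q p q = pos-resp (≈-sym (area-lerp A B h P Q))
      (pos-+-nonneg (*-pos 0≺1-h p) (nonneg-* (inj₁ 0≺h) q))

    midpoint-left₂ : ∀ A B P Q → WeakLeft A B P → Left A B Q → Left A B (midpoint P Q)
    midpoint-left₂ A B P Q p q = pos-resp (≈-sym (area-lerp A B h P Q))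
      (nonneg-+-pos (nonneg-* (inj₁ 0≺1-h) p) (*-pos 0≺h q))

    midpoint-weakLeft : ∀ A B P Q → WeakLeft A B P → WeakLeft A B Q → WeakLeft A B (midpoint P Q)
    midpoint-weakLeft A B P Q p q = nonneg-resp (≈-sym (area-lerp A B h P Q))
      (nonneg-+ (nonneg-* (inj₁ 0≺1-h) p) (nonneg-* (inj₁ 0≺h) q))

    interior-point : ∃[ P ] Interior S T P
    interior-point = midpoint (midpoint P₀ P₁) P₂ , left⇒interior _ left-of
      where
      P₀ P₁ P₂ : Point
      P₀ = vertex zero
      P₁ = vertex (suc zero)
      P₂ = vertex (suc (suc zero))
      left-of : IsSide T u v → Left (S u) (S v) (midpoint (midpoint P₀ P₁) P₂)
      left-of {u} {v} s@(forward zero) = midpoint-left₂ (S u) (S v) (midpoint P₀ P₁) P₂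
        (midpoint-weakLeft (S u) (S v) P₀ P₁ (vertex-weakLeft s zero) (vertex-weakLeft s (suc zero)))
        (convex _ _ _ (forward< zero) (forward< (suc zero)))
      left-of {u} {v} s@(forward (suc j)) = midpoint-left₁ (S u) (S v) (midpoint P₀ P₁) P₂
        (midpoint-left₁ (S u) (S v) P₀ P₁
          (left-before (increasing zero (suc (inject₁ j)) (s≤s z≤n)) (forward< (suc j)))
          (vertex-weakLeft s (suc zero)))
        (vertex-weakLeft s (suc (suc zero)))
      left-of {u} {v} s@closing = midpoint-left₁ (S u) (S v) (midpoint P₀ P₁) P₂
        (midpoint-left₂ (S u) (S v) P₀ P₁ (vertex-weakLeft s zero)
          (right-between (forward< zero) (increasing (suc zero) (fromℕ (2 ℕ.+ q)) (s≤s (s≤s z≤n)))))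
        (vertex-weakLeft s (suc (suc zero)))

    interior-bounds : ∀ {M} → (∀ v → Bounds M (proj₁ (S v)) × Bounds M (proj₂ (S v))) →
      ∀ Q → Interior S T Q → Bounds M (proj₁ Q) × Bounds M (proj₂ Q)
    interior-bounds {M} bounds Q int =
      bounds-convex 0≺D (inj₁ l₀) lA lB D≈ (barycentric-x P₀ A B Q)
        (proj₁ (bounds _)) (proj₁ (bounds _)) (proj₁ (bounds _)) ,
      bounds-convex 0≺D (inj₁ l₀) lA lB D≈ (barycentric-y P₀ A B Q)
        (proj₂ (bounds _)) (proj₂ (bounds _)) (proj₂ (bounds _))
      where
      P₀ : Point
      P₀ = vertex zero
      fan : ∃[ j ] WeakLeft P₀ (vertex (suc (inject₁ j))) Q × Left (vertex (suc (suc j))) P₀ Q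
      fan = discrete-IVT (λ i → WeakLeft P₀ (vertex (suc i)) Q) (λ i → Left (vertex (suc i)) P₀ Q)
        cover (λ i → left-right-⊥ {P₀} {vertex (suc i)} {Q})
        (inj₁ (interior⇒left Q int (forward zero))) (interior⇒left Q int closing)
        where
        cover : ∀ i → WeakLeft P₀ (vertex (suc i)) Q ⊎ Left (vertex (suc i)) P₀ Q
        cover i with side P₀ (vertex (suc i)) Q
        ... | left p  = inj₁ (inj₁ p)
        ... | on p    = inj₁ (zero⇒nonneg p)
        ... | right p = inj₂ p
      j = proj₁ fan
      A B : Point
      A = vertex (suc (inject₁ j))
      B = vertex (suc (suc j))
      l₀ : Left A B Q
      l₀ = interior⇒left Q int (forward (suc j))
      lA : WeakLeft B P₀ Q
      lA = inj₁ (proj₂ (proj₂ fan))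
      lB : WeakLeft P₀ A Q
      lB = proj₁ (proj₂ fan)
      0≺D : Left P₀ A B
      0≺D = convex _ _ _ (increasing zero (suc (inject₁ j)) (s≤s z≤n)) (forward< (suc j))
      D≈ = barycentric-sum P₀ A B Q

    interior-bounded : ∀ {ℓ} {R : Point → Set ℓ} → (∀ {Q} → R Q → Interior S T Q) → Bounded R
    interior-bounded R⊆ with coordinate-bound
    ... | M , bounds = M , λ x y r →
      let (xl , xu) , (yl , yu) = interior-bounds bounds (x , y) (R⊆ r) in
      (lower xl , nonneg⇒≼ xu) , (lower yl , nonneg⇒≼ yu)
      where
      open import Algebra.Properties.Ring ring using (-‿involutive)
      lower : ∀ {x M} → 0# ≼ (x ⊕ M) → (⊖ M) ≼ x
      lower p = nonneg⇒≼ (nonneg-resp (+-congˡ (≈-sym (-‿involutive _))) p)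

-- Faces

increasing-tail : ∀ {n m x} {xs : Vec (Fin n) m} →
  StrictlyIncreasing (x ∷ xs) → StrictlyIncreasing xs
increasing-tail inc i j i<j = inc (suc i) (suc j) (s≤s i<j)

increasing-unique : ∀ {n m m′} (T : Vec (Fin n) m) (T′ : Vec (Fin n) m′) →
  StrictlyIncreasing T → StrictlyIncreasing T′ →
  (∀ i → ∃[ j ] lookup T i ≡ lookup T′ j) → (∀ j → ∃[ i ] lookup T′ j ≡ lookup T i) →
  toList T ≡ toList T′
increasing-unique [] [] inc inc′ ⊆ ⊇ = ≡.refl
increasing-unique [] (y ∷ ys) inc inc′ ⊆ ⊇ with () ← proj₁ (⊇ zero)
increasing-unique (x ∷ xs) [] inc inc′ ⊆ ⊇ with () ← proj₁ (⊆ zero)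
increasing-unique (x ∷ xs) (y ∷ ys) inc inc′ ⊆ ⊇ =
  ≡.cong₂ _∷_ x≡y (increasing-unique xs ys (increasing-tail inc) (increasing-tail inc′) ⊆′ ⊇′)
  where
  x≡y : x ≡ y
  x≡y with ⊆ zero | ⊇ zero
  ... | zero  , x≡  | _           = x≡
  ... | suc j , _   | zero  , y≡  = ≡.sym y≡
  ... | suc j , x≡ys | suc i , y≡xs = ⊥-elim (ℕ.<-asym
    (≡.subst (y Fin.<_) (≡.sym x≡ys) (inc′ zero (suc j) (s≤s z≤n)))
    (≡.subst (x Fin.<_) (≡.sym y≡xs) (inc zero (suc i) (s≤s z≤n))))
  ⊆′ : ∀ i → ∃[ j ] lookup xs i ≡ lookup ys j
  ⊆′ i with ⊆ (suc i)
  ... | suc j , eq = j , eq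
  ... | zero  , eq = ⊥-elim (ℕ.<-irrefl ≡.refl
    (≡.subst (x Fin.<_) (≡.trans eq (≡.sym x≡y)) (inc zero (suc i) (s≤s z≤n))))
  ⊇′ : ∀ j → ∃[ i ] lookup ys j ≡ lookup xs i
  ⊇′ j with ⊇ (suc j)
  ... | suc i , eq = i , eq
  ... | zero  , eq = ⊥-elim (ℕ.<-irrefl ≡.refl
    (≡.subst (y Fin.<_) (≡.trans eq x≡y) (inc′ zero (suc j) (s≤s z≤n))))

module EscapeProperties {c ℓ₁ ℓ₂} (F : OrderedField c ℓ₁ ℓ₂) where
  open OrderedField F hiding (zero)
    renaming (refl to ≈-refl; sym to ≈-sym; trans to ≈-trans)
  open OrderedFieldProperties F
  open BoundProperties F
  open IntegerCoefficients commutativeRing using (solve; con; _:=_; _:+_; _:*_; _:-_; :-_)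

  private
    upward : ∀ M x a → (M ⊝ (x ⊕ ((1# ⊕ (M ⊕ M)) ⊗ a))) ⊕ (x ⊕ M) ≈
      ⊖ (((1# ⊕ (M ⊕ M)) ⊗ a) ⊝ (M ⊕ M))
    upward = solve 3 (λ M x a →
      (M :- (x :+ (con (ℤ.+ 1) :+ (M :+ M)) :* a)) :+ (x :+ M) :=
      :- (((con (ℤ.+ 1) :+ (M :+ M)) :* a) :- (M :+ M))) ≈-refl

    downward : ∀ M x a → ((x ⊕ ((1# ⊕ (M ⊕ M)) ⊗ (⊖ a))) ⊕ M) ⊕ (M ⊝ x) ≈
      ⊖ (((1# ⊕ (M ⊕ M)) ⊗ a) ⊝ (M ⊕ M))
    downward = solve 3 (λ M x a →
      ((x :+ (con (ℤ.+ 1) :+ (M :+ M)) :* (:- a)) :+ M) :+ (M :- x) :=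
      :- (((con (ℤ.+ 1) :+ (M :+ M)) :* a) :- (M :+ M))) ≈-refl

    remainder : ∀ N → ((1# ⊕ N) ⊗ 1#) ⊝ N ≈ 1#
    remainder = solve 1 (λ N → ((con (ℤ.+ 1) :+ N) :* con (ℤ.+ 1)) :- N := con (ℤ.+ 1)) ≈-refl

    shift : ∀ a i e → (a ⊗ i) ⊗ e ≈ a ⊗ (e ⊗ i)
    shift = solve 3 (λ a i e → (a :* i) :* e := a :* (e :* i)) ≈-refl

    shift⁻ : ∀ a i e → (a ⊗ i) ⊗ e ≈ a ⊗ (⊖ ((⊖ e) ⊗ i))
    shift⁻ = solve 3 (λ a i e → (a :* i) :* e := a :* (:- ((:- e) :* i))) ≈-refl

    width : ∀ x M → (x ⊕ M) ⊕ (M ⊝ x) ≈ M ⊕ M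
    width = solve 2 (λ x M → (x :+ M) :+ (M :- x) := M :+ M) ≈-refl

    overshoot : ∀ M a → a ≈ 1# → ((1# ⊕ (M ⊕ M)) ⊗ a) ⊝ (M ⊕ M) ≈ 1#
    overshoot M a a≈1 = ≈-trans (+-congʳ (*-congˡ a≈1)) (remainder (M ⊕ M))

  escape : ∀ M x e → Bounds M x → ¬ (e ≈ 0#) → ∃[ s ] 0# ≺ s × ¬ Bounds M (x ⊕ (s ⊗ e))
  escape M x e (l , u) e≉0 = go (sign e)
    where
    0≺1+2M : 0# ≺ (1# ⊕ (M ⊕ M))
    0≺1+2M = pos-+-nonneg 0≺1 (nonneg-resp (width x M) (nonneg-+ l u))
    go : Signed e → ∃[ s ] 0# ≺ s × ¬ Bounds M (x ⊕ (s ⊗ e))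
    go (null e≈0) = ⊥-elim (e≉0 e≈0)
    go (positive 0≺e) with pos-inverse 0≺e
    ... | i , 0≺i , ei≈1 = (1# ⊕ (M ⊕ M)) ⊗ i , *-pos 0≺1+2M 0≺i , λ (_ , u′) →
      nonneg-pos-⊥
        (nonneg-resp (≈-trans (+-congʳ (+-congˡ (-‿cong (+-congˡ (shift _ i e))))) (upward M x (e ⊗ i)))
          (nonneg-+ u′ l))
        (pos-resp (≈-sym (≈-trans (-‿involutive _) (overshoot M (e ⊗ i) ei≈1))) 0≺1)
      where open import Algebra.Properties.Ring ring using (-‿involutive)
    go (negative 0≺-e) with pos-inverse 0≺-e
    ... | i , 0≺i , ei≈1 = (1# ⊕ (M ⊕ M)) ⊗ i , *-pos 0≺1+2M 0≺i , λ (l′ , _) →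
      nonneg-pos-⊥
        (nonneg-resp (≈-trans (+-congʳ (+-congʳ (+-congˡ (shift⁻ _ i e)))) (downward M x ((⊖ e) ⊗ i)))
          (nonneg-+ l′ u))
        (pos-resp (≈-sym (≈-trans (-‿involutive _) (overshoot M ((⊖ e) ⊗ i) ei≈1))) 0≺1)
      where open import Algebra.Properties.Ring ring using (-‿involutive)

module FaceProperties {c ℓ₁ ℓ₂} (F : OrderedField c ℓ₁ ℓ₂)
  {n : ℕ} (S : Fin n → Plane.Point F) (convexPosition : Plane.ConvexPosition F S)
  (G : Graph n) where
  open OrderedField F hiding (zero)
    renaming (refl to ≈-refl; sym to ≈-sym; trans to ≈-trans)
  open Plane F
  open OrderedFieldProperties F
  open PlaneProperties F
  open BoundProperties F
  open EscapeProperties F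
  open ConvexProperties F S convexPosition

  SidesAdjacent : ∀ {q} → Vec (Fin n) (suc q) → Set
  SidesAdjacent T = ∀ {u v} → IsSide T u v → Adj G u v

  EdgesOutside : ∀ {q} → Vec (Fin n) (suc q) → Set _
  EdgesOutside T = ∀ u v → Adj G u v →
    ∃[ a ] ∃[ b ] IsSide T a b × WeakLeft (S b) (S a) (S u) × WeakLeft (S b) (S a) (S v)

  undrawn-resp : ∀ {P Q} → P ≋ Q → ¬ Drawing S G P → ¬ Drawing S G Q
  undrawn-resp {P} {Q} P≋Q ¬drawn (u , v , uv , s) =
    ¬drawn (u , v , uv , segment-resp {S u} {S v} {Q} {P} (≋-sym P≋Q) s)

  face-undrawn : ∀ {P Q} → ¬ Drawing S G P → Face S G P Q → ¬ Drawing S G Q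
  face-undrawn ¬drawn ε                   = ¬drawn
  face-undrawn {P} ¬drawn (_◅_ {j = R} visible face) = face-undrawn (visible R (endpoint P R)) face

  module _ {q : ℕ} (T : Vec (Fin n) (3 ℕ.+ q)) (increasing : StrictlyIncreasing T) where
    open Polygon T increasing

    interior-undrawn : EdgesOutside T → ∀ Q → Interior S T Q → ¬ Drawing S G Q
    interior-undrawn outside Q int (u , v , uv , s) with outside u v uv
    ... | a , b , ab , wu , wv = left-right-⊥ {S b} {S a} {Q}
      (segment-weakLeft {S u} {S v} {Q} (S b) (S a) s wu wv) (interior⇒left Q int ab)

    interior⊆face : EdgesOutside T → ∀ P Q → Interior S T P → Interior S T Q → Face S G P Q
    interior⊆face outside P Q p q =
      (λ R s → interior-undrawn outside R (interior-convex P Q R p q s)) ◅ ε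

    face⊆interior : SidesAdjacent T → ∀ {P Q} → Interior S T P → Face S G P Q → Interior S T Q
    face⊆interior adjacent p ε = p
    face⊆interior adjacent {P} p (_◅_ {j = R} visible face) with cross-boundary P R p
    ... | inj₁ r = face⊆interior adjacent r face
    ... | inj₂ (R′ , s , u , v , uv , s′) = ⊥-elim (visible R′ s (u , v , adjacent uv , s′))

    polygon-is-face : SidesAdjacent T → EdgesOutside T → ∀ P → Interior S T P →
      InternalFaceAt S G P × FaceIsPolygon S G P T
    polygon-is-face adjacent outside P p =
      (interior-undrawn outside P p , interior-bounded (face⊆interior adjacent p)) ,
      increasing , All.tabulate (λ ∈sides → adjacent (∈-sides⇒IsSide T ∈sides)) ,
      face⊆interior adjacent p , λ {Q} → interior⊆face outside P Q p

    side-collinear⇒vertex : ∀ {u v x} → IsSide T u v → area (S u) (S v) (S x) ≈ 0# →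
      ∃[ i ] x ≡ lookup T i
    side-collinear⇒vertex (forward j) o with collinear⇒endpoint (forward< j) o
    ... | inj₁ x≡ = inject₁ j , x≡
    ... | inj₂ x≡ = suc j , x≡
    side-collinear⇒vertex {u} {v} {x} closing o
      with collinear⇒endpoint closing< (swap-zero (S u) (S v) (S x) o)
    ... | inj₁ x≡ = zero , x≡
    ... | inj₂ x≡ = fromℕ _ , x≡

  module _ {q q′ : ℕ} (T : Vec (Fin n) (3 ℕ.+ q)) (increasing : StrictlyIncreasing T)
    (T′ : Vec (Fin n) (3 ℕ.+ q′)) (increasing′ : StrictlyIncreasing T′) where
    private
      module T  = Polygon T increasing
      module T′ = Polygon T′ increasing′

    -- A segment from a point of the face to a vertex of T′ stays in the face,
    -- hence can leave T only at its end.
    face-vertices-⊆ : SidesAdjacent T → SidesAdjacent T′ → ∀ P → ¬ Drawing S G P →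
      Face S G P ≐ Interior S T → Face S G P ≐ Interior S T′ →
      ∀ i → ∃[ j ] lookup T′ i ≡ lookup T j
    face-vertices-⊆ adjacent adjacent′ P ¬drawn (⊆T , T⊆) (⊆T′ , T′⊆) i
      with T.cross-boundary P (T′.vertex i) (⊆T ε)
    ... | inj₁ int = ⊥-elim (face-undrawn ¬drawn (T⊆ int)
      (lookup T′ i , proj₁ (out-side T′ i) , adjacent′ (proj₂ (out-side T′ i)) ,
       startpoint (T′.vertex i) (S (proj₁ (out-side T′ i)))))
    ... | inj₂ (R , s , u , v , uv , s′) with segment-end-cases {P} {T′.vertex i} {R} s
    ...   | inj₁ R≋ = side-collinear⇒vertex T increasing uv
      (≈-trans (≈-sym (area-cong (S u) (S v) R≋)) (segment⇒collinear {S u} {S v} {R} s′))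
    ...   | inj₂ l = ⊥-elim (face-undrawn ¬drawn
      (T′⊆ (T′.left⇒interior R λ {a} {b} ab → l (S a) (S b) (T′.interior⇒left P (⊆T′ ε) ab)
                                                (T′.vertex-weakLeft ab i)))
      (u , v , adjacent uv , s′))

  adjacent-sides : ∀ {q} (T : Vec (Fin n) (suc q)) →
    All (λ (u , v) → Adj G u v) (sides (toList T)) → SidesAdjacent T
  adjacent-sides T all uv = All.lookup all (IsSide⇒∈-sides T uv)

  face-polygon-unique : ∀ {q q′} (T : Vec (Fin n) (3 ℕ.+ q)) (T′ : Vec (Fin n) (3 ℕ.+ q′)) P →
    ¬ Drawing S G P → FaceIsPolygon S G P T → FaceIsPolygon S G P T′ → toList T ≡ toList T′
  face-polygon-unique T T′ P ¬drawn (inc , adj , ≐T) (inc′ , adj′ , ≐T′) =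
    increasing-unique T T′ inc inc′
      (face-vertices-⊆ T′ inc′ T inc (adjacent-sides T′ adj′) (adjacent-sides T adj) P ¬drawn ≐T′ ≐T)
      (face-vertices-⊆ T inc T′ inc′ (adjacent-sides T adj) (adjacent-sides T′ adj′) P ¬drawn ≐T ≐T′)

  polygon-size : ∀ {k} → IsKAngulation S (3 ℕ.+ k) G → ∀ {q} (T : Vec (Fin n) (3 ℕ.+ q)) →
    StrictlyIncreasing T → SidesAdjacent T → EdgesOutside T → q ≡ k
  polygon-size {k} (_ , _ , _ , faces) {q} T increasing adjacent outside =
    let P , int         = Polygon.interior-point T increasing
        internal , face = polygon-is-face T increasing adjacent outside P int
        T′ , face′      = faces P internal
    in size T′ (face-polygon-unique T T′ P (proj₁ internal) face face′)
    where
    size : ∀ (T′ : Vec (Fin n) (3 ℕ.+ k)) → toList T ≡ toList T′ → q ≡ k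
    size T′ eq = ℕ.+-cancelˡ-≡ 3 q k
      (≡.trans (≡.sym (length-toList T)) (≡.trans (≡.cong length eq) (length-toList T′)))

  HullSide : Fin n → Fin n → Set _
  HullSide u v = (∀ x → WeakLeft (S u) (S v) (S x)) × ∃[ x ] Left (S u) (S v) (S x)

  right-of-hull⇒undrawn : ∀ {u v} → HullSide u v → ∀ Q → Left (S v) (S u) Q → ¬ Drawing S G Q
  right-of-hull⇒undrawn {u} {v} (weak , _) Q r (a , b , ab , s) =
    left-right-⊥ {S u} {S v} {Q} (segment-weakLeft {S a} {S b} {Q} (S u) (S v) s (weak a) (weak b)) r

  beyond-hull⇒unbounded : ∀ {u v} → HullSide u v → ∀ P → ¬ Drawing S G P →
    WeakLeft (S v) (S u) P → ¬ Bounded (Face S G P)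
  beyond-hull⇒unbounded {u} {v} hull@(_ , x , lx) P ¬drawn r (M , bounded) = contradiction
    where
    open import Algebra.Properties.Ring ring using (-‿involutive)
    dx dy : Carrier
    dx = proj₁ (S v) ⊝ proj₁ (S u)
    dy = proj₂ (S v) ⊝ proj₂ (S u)
    ray : Carrier → Point
    ray s = proj₁ P ⊕ (s ⊗ dy) , proj₂ P ⊕ (s ⊗ (⊖ dx))
    d≉0 : ¬ (dy ≈ 0#) ⊎ ¬ (dx ≈ 0#)
    d≉0 with sign dy
    ... | positive p = inj₁ (pos⇒nonzero p)
    ... | null p     = inj₂ λ dx≈0 → left⇒distinct (S u) (S v) (S x) lx dx≈0 p
    ... | negative p = inj₁ λ dy≈0 → nonneg-pos-⊥ (zero⇒nonneg dy≈0) p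
    0≺d² : 0# ≺ ((dx ⊗ dx) ⊕ (dy ⊗ dy))
    0≺d² with d≉0
    ... | inj₁ dy≉0 = nonneg-+-pos (square-nonneg dx) (nonzero⇒square-pos dy≉0)
    ... | inj₂ dx≉0 = pos-+-nonneg (nonzero⇒square-pos dx≉0) (square-nonneg dy)
    ray-right : ∀ s → 0# ≺ s → Left (S v) (S u) (ray s)
    ray-right s 0≺s = pos-resp (≈-sym (area-normal (S u) (S v) P s)) (nonneg-+-pos r (*-pos 0≺s 0≺d²))
    ray-visible : ∀ s → 0# ≺ s → Visible S G P (ray s)
    ray-visible s 0≺s R seg with segment-start-left {P} {ray s} {R} (S v) (S u) seg r (ray-right s 0≺s)
    ... | inj₁ l   = right-of-hull⇒undrawn hull R l
    ... | inj₂ R≋P = undrawn-resp (≋-sym R≋P) ¬drawn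
    inBounds : ∀ Q → Face S G P Q → Bounds M (proj₁ Q) × Bounds M (proj₂ Q)
    inBounds (x , y) face with bounded x y face
    ... | (xl , xu) , (yl , yu) = (lower xl , ≼⇒nonneg xu) , (lower yl , ≼⇒nonneg yu)
      where
      lower : ∀ {z} → (⊖ M) ≼ z → 0# ≼ (z ⊕ M)
      lower p = nonneg-resp (+-congˡ (-‿involutive M)) (≼⇒nonneg p)
    ray-inBounds : ∀ s → 0# ≺ s → Bounds M (proj₁ (ray s)) × Bounds M (proj₂ (ray s))
    ray-inBounds s 0≺s = inBounds (ray s) (ray-visible s 0≺s ◅ ε)
    contradiction : ⊥
    contradiction with d≉0
    ... | inj₁ dy≉0 = let s , 0≺s , out = escape M (proj₁ P) dy (proj₁ (inBounds P ε)) dy≉0 in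
      out (proj₁ (ray-inBounds s 0≺s))
    ... | inj₂ dx≉0 = let s , 0≺s , out = escape M (proj₂ P) (⊖ dx) (proj₂ (inBounds P ε))
                            (λ -dx≈0 → dx≉0 (≈-trans (≈-sym (-‿involutive dx))
                              (≈-trans (-‿cong -dx≈0) -0#≈0#))) in
      out (proj₂ (ray-inBounds s 0≺s))
      where open import Algebra.Properties.Ring ring using (-0#≈0#)

  internal⇒left-of-hull : ∀ {u v} → HullSide u v → ∀ P → InternalFaceAt S G P → Left (S u) (S v) P
  internal⇒left-of-hull {u} {v} hull P (¬drawn , bounded) with side (S u) (S v) P
  ... | left l  = l
  ... | on o    = ⊥-elim (beyond-hull⇒unbounded hull P ¬drawn
                    (zero⇒nonneg (swap-zero (S u) (S v) P o)) bounded)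
  ... | right r = ⊥-elim (beyond-hull⇒unbounded hull P ¬drawn (inj₁ r) bounded)

-- Chains

open import Data.Nat using (_+_; _*_; _∸_; _⊓_; _<_; s<s; z<s)
open import Data.Nat.Properties
open ≡ using (refl; sym; trans; cong; cong₂; subst; subst₂; ≢-sym; module ≡-Reasoning)

Apart : ℕ → ℕ → ℕ → Set
Apart lo hi x = x ≤ lo ⊎ hi ≤ x

Crossing : ℕ → ℕ → ℕ → ℕ → Set
Crossing x y x′ y′ = x < x′ × x′ < y × y < y′

-- For a decreasing f, the polygon with corners f 0, …, f q has the points x and
-- y weakly on the outer side of one and the same of its sides.
Separated : (ℕ → ℕ) → ℕ → ℕ → ℕ → Set
Separated f q x y =
  (∃[ s ] s < q × f (suc s) ≤ x × y ≤ f s) ⊎ (Apart (f q) (f 0) x × Apart (f q) (f 0) y)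

module Chains (κ : ℕ) where

  -- A chain of m edge-rooted dissections with i polygons in total, placed side by
  -- side on the vertices 0, 1, 2, …, in the form of a Łukasiewicz word: poly turns
  -- the last k − 1 = κ + 2 members of a chain into the sides of a new polygon, whose
  -- remaining side takes their place.
  data Chain : ℕ → ℕ → Set where
    nil  : Chain 0 0
    edge : ∀ {m i} → Chain m i → Chain (suc m) i
    poly : ∀ {m i} → Chain (suc κ + suc m) i → Chain (suc m) (suc i)

  private variable m i m′ i′ : ℕ

  -- The end points of the members, counted from the right; front c j is 0 (junk)
  -- for j > m.
  front : Chain m i → ℕ → ℕ
  front nil      _       = 0
  front (edge c) zero    = suc (front c 0)
  front (edge c) (suc j) = front c j
  front (poly c) zero    = front c 0
  front (poly c) (suc j) = front c (suc (suc κ) + j)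

  data Edge : Chain m i → ℕ → ℕ → Set where
    new-edge : ∀ {c : Chain m i} → Edge (edge c) (front c 0) (suc (front c 0))
    old-edge : ∀ {c : Chain m i} {x y} → Edge c x y → Edge (edge c) x y
    new-poly : ∀ {c : Chain (suc κ + suc m) i} → Edge (poly c) (front c (suc (suc κ))) (front c 0)
    old-poly : ∀ {c : Chain (suc κ + suc m) i} {x y} → Edge c x y → Edge (poly c) x y

  edge-inv : {c : Chain m i} → ∀ {x y} → Edge (edge c) x y →
    (x ≡ front c 0 × y ≡ suc (front c 0)) ⊎ Edge c x y
  edge-inv new-edge     = inj₁ (refl , refl)
  edge-inv (old-edge e) = inj₂ e

  poly-inv : {c : Chain (suc κ + suc m) i} → ∀ {x y} → Edge (poly c) x y →
    (x ≡ front c (suc (suc κ)) × y ≡ front c 0) ⊎ Edge c x y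
  poly-inv new-poly     = inj₁ (refl , refl)
  poly-inv (old-poly e) = inj₂ e

  edge? : (c : Chain m i) → ∀ x y → Dec (Edge c x y)
  edge? nil x y = no λ ()
  edge? (edge c) x y with x ≟ front c 0 | y ≟ suc (front c 0) | edge? c x y
  ... | yes refl | yes refl | _      = yes new-edge
  ... | _        | _        | yes e  = yes (old-edge e)
  ... | no x≢    | _        | no ¬e  = no λ where
    new-edge     → x≢ refl
    (old-edge e) → ¬e e
  ... | yes _    | no y≢    | no ¬e  = no λ where
    new-edge     → y≢ refl
    (old-edge e) → ¬e e
  edge? (poly c) x y with x ≟ front c (suc (suc κ)) | y ≟ front c 0 | edge? c x y
  ... | yes refl | yes refl | _      = yes new-poly
  ... | _        | _        | yes e  = yes (old-poly e)
  ... | no x≢    | _        | no ¬e  = no λ where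
    new-poly     → x≢ refl
    (old-poly e) → ¬e e
  ... | yes _    | no y≢    | no ¬e  = no λ where
    new-poly     → y≢ refl
    (old-poly e) → ¬e e

  front-end : (c : Chain m i) → front c m ≡ 0
  front-end nil              = refl
  front-end (edge c)         = front-end c
  front-end (poly {m = m} c) =
    trans (cong (front c) (sym (+-suc (suc κ) m))) (front-end c)

  long : ∀ m → suc (suc κ) ≤ suc κ + suc m
  long m = subst (suc (suc κ) ≤_) (sym (+-suc (suc κ) m)) (s≤s (m≤m+n (suc κ) m))

  front-step : (c : Chain m i) → ∀ {j} → j < m → front c (suc j) < front c j
  front-< : (c : Chain m i) → ∀ {j l} → j < l → l ≤ m → front c l < front c j

  front-step (edge c) {zero}  j<m       = ≤-refl
  front-step (edge c) {suc j} (s≤s j<m) = front-step c j<m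
  front-step (poly {m = m} c) {zero} j<m =
    subst (λ l → front c l < front c 0) (cong suc (sym (+-identityʳ (suc κ))))
      (front-< c z<s (long m))
  front-step (poly {m = m} c) {suc j} (s≤s j<m) =
    subst (λ l → front c l < front c (suc (suc κ) + j)) (cong suc (sym (+-suc (suc κ) j)))
      (front-step c (subst (suc (suc κ) + j <_) (sym (+-suc (suc κ) m))
        (s≤s (subst (_≤ suc κ + m) (+-suc (suc κ) j) (+-monoʳ-≤ (suc κ) j<m)))))

  front-< c {j} {suc l} (s≤s j≤l) l<m with m≤n⇒m<n∨m≡n j≤l
  ... | inj₁ j<l  = <-trans (front-step c l<m) (front-< c j<l (<⇒≤ l<m))
  ... | inj₂ refl = front-step c l<m

  front-≤ : (c : Chain m i) → ∀ {j l} → j ≤ l → l ≤ m → front c l ≤ front c j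
  front-≤ c j≤l l≤m with m≤n⇒m<n∨m≡n j≤l
  ... | inj₁ j<l  = <⇒≤ (front-< c j<l l≤m)
  ... | inj₂ refl = ≤-refl

  front-reflect-≤ : (c : Chain m i) → ∀ {j l} → l ≤ m → front c j ≤ front c l → l ≤ j
  front-reflect-≤ c {j} {l} l≤m fj≤fl with ≤-<-connex l j
  ... | inj₁ l≤j = l≤j
  ... | inj₂ j<l = ⊥-elim (<⇒≱ (front-< c j<l l≤m) fj≤fl)

  front-reflect-< : (c : Chain m i) → ∀ {j l} → j ≤ m → front c j < front c l → l < j
  front-reflect-< c {j} {l} j≤m fj<fl with ≤-<-connex j l
  ... | inj₂ l<j = l<j
  ... | inj₁ j≤l with ≤-<-connex l _
  ...   | inj₁ l≤m = ⊥-elim (<⇒≱ fj<fl (front-≤ c j≤l l≤m))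
  ...   | inj₂ m<l = ⊥-elim (<⇒≱ fj<fl (subst (_≤ front c j) (sym (past-end c (<⇒≤ m<l))) z≤n))
    where
    past-end : (c : Chain m i) → ∀ {l} → m ≤ l → front c l ≡ 0
    past-end nil      _         = refl
    past-end (edge c) (s≤s m≤l) = past-end c m≤l
    past-end (poly {m = m} c) {suc l} (s≤s m≤l) = past-end c
      (subst (_≤ suc (suc κ) + l) (sym (+-suc (suc κ) m)) (+-monoʳ-≤ (suc (suc κ)) m≤l))

  front-length : (c : Chain m i) → front c 0 ≡ m + suc κ * i
  front-length nil = sym (*-zeroʳ (suc κ))
  front-length (edge c) = cong suc (front-length c)
  front-length (poly {m = m} {i = i} c) = trans (front-length c) (arithmetic κ m i)
    where
    arithmetic : ∀ κ m i → suc κ + suc m + suc κ * i ≡ suc m + suc κ * suc i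
    arithmetic = solve-∀

  InSection : Chain m i → ℕ → ℕ → Set
  InSection {m = m} c x y = ∃[ j ] j < m × front c (suc j) ≤ x × y ≤ front c j

  edge-inSection : (c : Chain m i) → ∀ {x y} → Edge c x y → x < y × InSection c x y
  edge-inSection (edge c) new-edge = ≤-refl , 0 , z<s , ≤-refl , ≤-refl
  edge-inSection (edge c) (old-edge e) with edge-inSection c e
  ... | x<y , j , j<m , lo , hi = x<y , suc j , s<s j<m , lo , hi
  edge-inSection (poly {m = m} c) new-poly = front-< c z<s (long m) , 0 , z<s ,
    ≤-reflexive (cong (front c) (+-identityʳ (suc (suc κ)))) , ≤-refl
  edge-inSection (poly {m = m} c) {x} {y} (old-poly e) with edge-inSection c e
  ... | x<y , j , j<m , lo , hi with ≤-<-connex (suc (suc κ)) j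
  ...   | inj₂ j<k = x<y , 0 , z<s ,
    ≤-trans (subst (λ l → front c l ≤ front c (suc j)) (sym (+-identityʳ (suc (suc κ))))
      (front-≤ c j<k (long m))) lo ,
    ≤-trans hi (front-≤ c z≤n (<⇒≤ j<m))
  ...   | inj₁ k≤j with m≤n⇒∃[o]m+o≡n k≤j
  ...     | o , refl = x<y , suc o ,
    s<s (+-cancelˡ-< (suc κ) _ _ (≤-pred (subst (suc (suc κ) + o <_) (+-suc (suc κ) m) j<m))) ,
    subst (λ l → front c l ≤ x) (cong suc (sym (+-suc (suc κ) o))) lo , hi

  edge-≤-front : (c : Chain m i) → ∀ {x y} → Edge c x y → y ≤ front c 0
  edge-≤-front c e with edge-inSection c e
  ... | _ , j , j<m , _ , hi = ≤-trans hi (front-≤ c z≤n (<⇒≤ j<m))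

  section-edge : (c : Chain m i) → ∀ {j} → j < m → Edge c (front c (suc j)) (front c j)
  section-edge (edge c) {zero}  j<m       = new-edge
  section-edge (edge c) {suc j} (s≤s j<m) = old-edge (section-edge c j<m)
  section-edge (poly {m = m} c) {zero} j<m =
    subst (λ l → Edge (poly c) (front c l) (front c 0)) (sym (+-identityʳ (suc (suc κ)))) new-poly
  section-edge (poly {m = m} c) {suc j} (s≤s j<m) = old-poly
    (subst (λ l → Edge c (front c l) (front c (suc (suc κ) + j))) (cong suc (sym (+-suc (suc κ) j)))
      (section-edge c (subst (suc (suc κ) + j <_) (sym (+-suc (suc κ) m))
        (s≤s (subst (_≤ suc κ + m) (+-suc (suc κ) j) (+-monoʳ-≤ (suc κ) j<m))))))

  hull-edge : (c : Chain m i) → ∀ {x} → x < front c 0 → Edge c x (suc x)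
  hull-edge nil ()
  hull-edge (edge c) (s≤s x≤) with m≤n⇒m<n∨m≡n x≤
  ... | inj₁ x<   = old-edge (hull-edge c x<)
  ... | inj₂ refl = new-edge
  hull-edge (poly c) x< = old-poly (hull-edge c x<)

  no-front-inside : (c : Chain m i) → ∀ {x y l} → InSection c x y → l ≤ m →
    x < front c l → ¬ (front c l < y)
  no-front-inside c (j , j<m , lo , hi) l≤m x<f f<y =
    <⇒≱ (front-reflect-< c l≤m (<-≤-trans f<y hi))
        (≤-pred (front-reflect-< c j<m (≤-<-trans lo x<f)))

  edges-noncrossing : (c : Chain m i) → ∀ {x y x′ y′} → Edge c x y → Edge c x′ y′ →
    ¬ Crossing x y x′ y′
  edges-noncrossing (edge c) new-edge new-edge (x<x′ , _) = <-irrefl refl x<x′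
  edges-noncrossing (edge c) new-edge (old-edge e′) (_ , _ , y<y′) =
    <⇒≱ y<y′ (m≤n⇒m≤1+n (edge-≤-front c e′))
  edges-noncrossing (edge c) (old-edge e) new-edge (_ , x′<y , _) = <⇒≱ x′<y (edge-≤-front c e)
  edges-noncrossing (edge c) (old-edge e) (old-edge e′) = edges-noncrossing c e e′
  edges-noncrossing (poly c) new-poly new-poly (x<x′ , _) = <-irrefl refl x<x′
  edges-noncrossing (poly c) new-poly (old-poly e′) (_ , _ , y<y′) =
    <⇒≱ y<y′ (edge-≤-front c e′)
  edges-noncrossing (poly {m = m} c) (old-poly e) new-poly (x<x′ , x′<y , _) =
    no-front-inside c (proj₂ (edge-inSection c e)) (long m) x<x′ x′<y
  edges-noncrossing (poly c) (old-poly e) (old-poly e′) = edges-noncrossing c e e′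

  lowest-neighbour : (c : Chain m i) → ∀ {j x} → j < m → Edge c x (front c j) → front c (suc j) ≤ x
  lowest-neighbour c {j} j<m e with edge-inSection c e
  ... | _ , j′ , j′<m , lo , hi =
    ≤-trans (front-≤ c (s≤s (front-reflect-≤ c (<⇒≤ j′<m) hi)) j<m) lo

  Includes : Chain m i → Chain m′ i′ → Set
  Includes c c′ = ∀ {x y} → Edge c x y → Edge c′ x y

  fronts-≡ : (c c′ : Chain m i) → Includes c c′ → Includes c′ c →
    ∀ j → j ≤ m → front c j ≡ front c′ j
  fronts-≡ c c′ ⊆ ⊇ zero    j≤m = trans (front-length c) (sym (front-length c′))
  fronts-≡ c c′ ⊆ ⊇ (suc j) j<m = ≤-antisym
    (lowest-neighbour c j<m (⊇ (subst (Edge c′ _) (sym IH) (section-edge c′ j<m))))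
    (lowest-neighbour c′ j<m (⊆ (subst (Edge c _) IH (section-edge c j<m))))
    where
    IH : front c j ≡ front c′ j
    IH = fronts-≡ c c′ ⊆ ⊇ j (<⇒≤ j<m)

  edges-injective : (c c′ : Chain m i) → Includes c c′ → Includes c′ c → c ≡ c′
  edges-injective nil nil ⊆ ⊇ = refl
  edges-injective (edge c) (edge c′) ⊆ ⊇ =
    cong edge (edges-injective c c′ (restrict c c′ f≡ ⊆) (restrict c′ c (sym f≡) ⊇))
    where
    f≡ : front c 0 ≡ front c′ 0
    f≡ = fronts-≡ (edge c) (edge c′) ⊆ ⊇ 1 (s≤s z≤n)
    restrict : (c c′ : Chain m i) → front c 0 ≡ front c′ 0 →
      Includes (edge c) (edge c′) → Includes c c′
    restrict c c′ f≡ ⊆ e with ⊆ (old-edge e)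
    ... | old-edge e′ = e′
    ... | new-edge    = ⊥-elim (1+n≰n (subst (suc (front c′ 0) ≤_) f≡ (edge-≤-front c e)))
  edges-injective (poly {m = m} c) (poly c′) ⊆ ⊇ =
    cong poly (edges-injective c c′ (restrict c c′ f≡ g≡ ⊆) (restrict c′ c (sym f≡) (sym g≡) ⊇))
    where
    f≡ : front c 0 ≡ front c′ 0
    f≡ = fronts-≡ (poly c) (poly c′) ⊆ ⊇ 0 z≤n
    g≡ : front c (suc (suc κ)) ≡ front c′ (suc (suc κ))
    g≡ = subst (λ l → front c l ≡ front c′ l) (+-identityʳ (suc (suc κ)))
      (fronts-≡ (poly c) (poly c′) ⊆ ⊇ 1 (s≤s z≤n))
    restrict : ∀ {m i} (c c′ : Chain (suc κ + suc m) i) → front c 0 ≡ front c′ 0 →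
      front c (suc (suc κ)) ≡ front c′ (suc (suc κ)) →
      Includes (poly c) (poly c′) → Includes c c′
    restrict {m} c c′ f≡ g≡ ⊆ {x} {y} e with ⊆ (old-poly e)
    ... | old-poly e′ = e′
    ... | new-poly = ⊥-elim (<⇒≱ (front-< c (s<s z<s) (long m))
      (subst (front c 1 ≤_) (sym g≡) (lowest-neighbour c z<s (subst (Edge c x) (sym f≡) e))))
  edges-injective (edge c) (poly {m = m} c′) ⊆ ⊇ = ⊥-elim (edge≢poly m c c′
    (fronts-≡ (edge c) (poly c′) ⊆ ⊇ 0 z≤n) (fronts-≡ (edge c) (poly c′) ⊆ ⊇ 1 (s≤s z≤n)))
    where
    edge≢poly : ∀ m {i i′} (c : Chain m (suc i)) (c′ : Chain (suc κ + suc m) i′) →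
      suc (front c 0) ≡ front c′ 0 → ¬ (front c 0 ≡ front c′ (suc (suc κ) + 0))
    edge≢poly m c c′ f≡ g≡ = <⇒≱
      (<-≤-trans (s<s (front-< c′ (s<s z<s) (long m))) (front-step c′ z<s))
      (≤-reflexive (trans (sym f≡) (cong suc (trans g≡ (cong (front c′) (+-identityʳ (suc (suc κ))))))))
  edges-injective (poly {m = m} c) (edge c′) ⊆ ⊇ = sym (edges-injective (edge c′) (poly c) ⊇ ⊆)

  -- The chain on the right is the one to which a poly step of the chain on the left
  -- applies, so it stands for a face.
  data _∋_ : Chain m i → Chain (suc κ + suc m′) i′ → Set where
    this     : {c : Chain (suc κ + suc m) i} → poly c ∋ c
    in-edge  : {c : Chain m i} {d : Chain (suc κ + suc m′) i′} → c ∋ d → edge c ∋ d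
    in-poly  : {c : Chain (suc κ + suc m) i} {d : Chain (suc κ + suc m′) i′} → c ∋ d → poly c ∋ d

  module _ {m′ i′ : ℕ} {d : Chain (suc κ + suc m′) i′} where

    private
      lo hi : ℕ
      lo = front d (suc (suc κ))
      hi = front d 0

    face-edges : {c : Chain m i} → c ∋ d → Includes d c
    face-edges this        e = old-poly e
    face-edges (in-edge p) e = old-edge (face-edges p e)
    face-edges (in-poly p) e = old-poly (face-edges p e)

    face-closing : {c : Chain m i} → c ∋ d → Edge c lo hi
    face-closing this        = new-poly
    face-closing (in-edge p) = old-edge (face-closing p)
    face-closing (in-poly p) = old-poly (face-closing p)

    face-separated : {c : Chain m i} → c ∋ d → ∀ {x y} → Edge c x y →
      Separated (front d) (suc (suc κ)) x y
    face-separated (in-edge p) (old-edge e) = face-separated p e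
    face-separated {c = edge c} (in-edge p) new-edge =
      inj₂ (inj₂ hi≤ , inj₂ (m≤n⇒m≤1+n hi≤))
      where
      hi≤ : hi ≤ front c 0
      hi≤ = edge-≤-front c (face-closing p)
    face-separated (in-poly p) (old-poly e) = face-separated p e
    face-separated {c = poly {m = m} c} (in-poly p) new-poly with edge-inSection c (face-closing p)
    ... | lo<hi , j , j<m , l , h = inj₂ (below , inj₂ (edge-≤-front c (face-closing p)))
      where
      below : Apart lo hi (front c (suc (suc κ)))
      below with ≤-<-connex (front c (suc (suc κ))) lo | ≤-<-connex hi (front c (suc (suc κ)))
      ... | inj₁ ≤lo | _        = inj₁ ≤lo
      ... | inj₂ _   | inj₁ hi≤ = inj₂ hi≤
      ... | inj₂ lo< | inj₂ <hi = ⊥-elim (no-front-inside c (j , j<m , l , h) (long m) lo< <hi)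
    face-separated this new-poly = inj₂ (inj₁ ≤-refl , inj₂ ≤-refl)
    face-separated this (old-poly e) with edge-inSection d e
    ... | x<y , j , j<m , l , h with ≤-<-connex (suc (suc κ)) j
    ...   | inj₂ j<k = inj₁ (j , j<k , l , h)
    ...   | inj₁ k≤j = inj₂ (inj₁ (≤-trans (<⇒≤ x<y) y≤) , inj₁ y≤)
      where
      y≤ = ≤-trans h (front-≤ d k≤j (<⇒≤ j<m))

  face-ends-distinct : ∀ {m m′ i i′} {c : Chain (suc κ + suc m) i} {d : Chain (suc κ + suc m′) i′} →
    c ∋ d → front d 0 ≡ front c 0 → front d (suc (suc κ)) ≢ front c (suc (suc κ))
  face-ends-distinct {m} {c = c} {d} p hi≡ lo≡ with edge-inSection c (face-closing p)
  ... | _ , j , j<m , l , h = <⇒≱ (front-< c (s<s z<s) (long m))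
    (≤-trans (front-≤ c (s≤s (front-reflect-≤ c (<⇒≤ j<m) (subst (_≤ front c j) hi≡ h))) (s≤s z≤n))
      (≤-trans l (≤-reflexive lo≡)))

  -- For m = 1 these are the polygons at the last vertex, one more than the root
  -- degree.
  lead : Chain m i → ℕ
  lead nil      = 0
  lead (edge c) = 0
  lead (poly c) = suc (lead c)

  chains : ∀ m i → List (Chain m i)
  chains zero    zero    = nil ∷ []
  chains zero    (suc i) = []
  chains (suc m) zero    = map edge (chains m zero)
  chains (suc m) (suc i) = map edge (chains m (suc i)) ++ map poly (chains (suc κ + suc m) i)

  edge-injective : {c c′ : Chain m i} → edge c ≡ edge c′ → c ≡ c′
  edge-injective refl = refl

  poly-injective : {c c′ : Chain (suc κ + suc m) i} → poly c ≡ poly c′ → c ≡ c′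
  poly-injective refl = refl

  ∈-chains : (c : Chain m i) → c ∈ chains m i
  ∈-chains nil = here refl
  ∈-chains (edge {i = zero} c)  = ∈-map⁺ edge (∈-chains c)
  ∈-chains (edge {i = suc i} c) = ∈-++⁺ˡ (∈-map⁺ edge (∈-chains c))
  ∈-chains (poly {m = m} {i} c) = ∈-++⁺ʳ (map edge (chains m (suc i))) (∈-map⁺ poly (∈-chains c))

  chains-unique : ∀ m i → Unique (chains m i)
  chains-unique zero    zero    = [] ∷ []
  chains-unique zero    (suc i) = []
  chains-unique (suc m) zero    = Unique.map⁺ edge-injective (chains-unique m zero)
  chains-unique (suc m) (suc i) = Unique.++⁺
    (Unique.map⁺ edge-injective (chains-unique m (suc i)))
    (Unique.map⁺ poly-injective (chains-unique (suc κ + suc m) i))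
    λ (∈edges , ∈polys) → disjoint
      (proj₂ (proj₂ (∈-map⁻ edge ∈edges))) (proj₂ (proj₂ (∈-map⁻ poly ∈polys)))
    where
    disjoint : ∀ {c} {d : Chain m (suc i)} {e : Chain (suc κ + suc m) i} → c ≡ edge d → ¬ (c ≡ poly e)
    disjoint refl ()

  leadChains : ∀ m i → ℕ → List (Chain m i)
  leadChains zero    i       d       = []
  leadChains (suc m) i       zero    = map edge (chains m i)
  leadChains (suc m) zero    (suc d) = []
  leadChains (suc m) (suc i) (suc d) = map poly (leadChains (suc κ + suc m) i d)

  ∈-leadChains : (c : Chain (suc m) i) → c ∈ leadChains (suc m) i (lead c)
  ∈-leadChains (edge c) = ∈-map⁺ edge (∈-chains c)
  ∈-leadChains (poly c) = ∈-map⁺ poly (∈-leadChains c)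

  lead-leadChains : ∀ m i d {c} → c ∈ leadChains m i d → lead c ≡ d
  lead-leadChains (suc m) i zero ∈cs with ∈-map⁻ edge ∈cs
  ... | _ , _ , refl = refl
  lead-leadChains (suc m) (suc i) (suc d) ∈cs with ∈-map⁻ poly ∈cs
  ... | c , ∈cs′ , refl = cong suc (lead-leadChains (suc κ + suc m) i d ∈cs′)

  leadChains-unique : ∀ m i d → Unique (leadChains m i d)
  leadChains-unique zero    i       d       = []
  leadChains-unique (suc m) i       zero    = Unique.map⁺ edge-injective (chains-unique m i)
  leadChains-unique (suc m) zero    (suc d) = []
  leadChains-unique (suc m) (suc i) (suc d) =
    Unique.map⁺ poly-injective (leadChains-unique (suc κ + suc m) i d)

-- The graph of a chain

opaque
  clamp : ∀ L → ℕ → Fin (suc L)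
  clamp L x = fromℕ< (s≤s (m⊓n≤n x L))

  toℕ-clamp : ∀ {L x} → x ≤ L → toℕ (clamp L x) ≡ x
  toℕ-clamp {L} {x} x≤L = trans (Fin.toℕ-fromℕ< (s≤s (m⊓n≤n x L))) (m≤n⇒m⊓n≡m x≤L)

toℕ≤ : ∀ {L} (u : Fin (suc L)) → toℕ u ≤ L
toℕ≤ u = ≤-pred (Fin.toℕ<n u)

clamp-toℕ : ∀ {L} (u : Fin (suc L)) → clamp L (toℕ u) ≡ u
clamp-toℕ u = Fin.toℕ-injective (toℕ-clamp (toℕ≤ u))

card-empty : ∀ {n} (f : Fin n → Bool) → (∀ x → f x ≡ false) → ∣ tabulate f ∣ ≡ 0
card-empty {zero}  f none = refl
card-empty {suc n} f none with f zero | none zero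
... | false | refl = card-empty (f ∘ suc) (none ∘ suc)

card-insert : ∀ {n} (f g : Fin n → Bool) z → f z ≡ false → g z ≡ true →
  (∀ x → x ≢ z → f x ≡ g x) → ∣ tabulate g ∣ ≡ suc ∣ tabulate f ∣
card-insert f g zero fz gz agree with f zero | g zero | fz | gz
... | false | true | refl | refl =
  cong suc (sym (cong ∣_∣ (tabulate-cong (λ x → agree (suc x) λ ()))))
card-insert f g (suc z) fz gz agree with f zero | g zero | agree zero (λ ())
... | true  | .true  | refl = cong suc
  (card-insert (f ∘ suc) (g ∘ suc) z fz gz (λ x x≢z → agree (suc x) (x≢z ∘ Fin.suc-injective)))
... | false | .false | refl =
  card-insert (f ∘ suc) (g ∘ suc) z fz gz (λ x x≢z → agree (suc x) (x≢z ∘ Fin.suc-injective))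

noncrossing⇒sides : ∀ {x y x′ y′} → x < y → x′ < y′ →
  ¬ Crossing x y x′ y′ → ¬ Crossing x′ y′ x y →
  (Apart x y x′ × Apart x y y′) ⊎ (x ≤ x′ × y′ ≤ y)
noncrossing⇒sides {x} {y} {x′} {y′} x<y x′<y′ ¬c ¬c′ with ≤-<-connex y x′
... | inj₁ y≤x′ = inj₁ (inj₂ y≤x′ , inj₂ (≤-trans y≤x′ (<⇒≤ x′<y′)))
... | inj₂ x′<y with ≤-<-connex y′ y | ≤-<-connex x x′
...   | inj₁ y′≤y | inj₁ x≤x′ = inj₂ (x≤x′ , y′≤y)
...   | inj₂ y<y′ | inj₁ x≤x′ with m≤n⇒m<n∨m≡n x≤x′
...     | inj₁ x<x′ = ⊥-elim (¬c (x<x′ , x′<y , y<y′))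
...     | inj₂ refl = inj₁ (inj₁ ≤-refl , inj₂ (<⇒≤ y<y′))
noncrossing⇒sides {x} {y} {x′} {y′} x<y x′<y′ ¬c ¬c′
    | inj₂ x′<y | _ | inj₂ x′<x with ≤-<-connex y′ x | ≤-<-connex y y′
...     | inj₁ y′≤x | _         = inj₁ (inj₁ (<⇒≤ x′<x) , inj₁ y′≤x)
...     | inj₂ _    | inj₁ y≤y′ = inj₁ (inj₁ (<⇒≤ x′<x) , inj₂ y≤y′)
...     | inj₂ x<y′ | inj₂ y′<y = ⊥-elim (¬c′ (x′<x , x<y′ , y′<y))

polygonOf : ∀ L q → (ℕ → ℕ) → Vec (Fin (suc L)) (suc q)
polygonOf L q f = tabulate (λ i → clamp L (f (toℕ (opposite i))))

module PolygonOf {L q : ℕ} (f : ℕ → ℕ) (step : ∀ s → s < q → f (suc s) < f s) (f₀≤L : f 0 ≤ L) where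

  polygon : Vec (Fin (suc L)) (suc q)
  polygon = polygonOf L q f

  f-< : ∀ {s t} → s < t → t ≤ q → f t < f s
  f-< {s} {suc t} (s≤s s≤t) t<q with m≤n⇒m<n∨m≡n s≤t
  ... | inj₁ s<t  = <-trans (step t t<q) (f-< s<t (<⇒≤ t<q))
  ... | inj₂ refl = step s t<q

  f≤L : ∀ {s} → s ≤ q → f s ≤ L
  f≤L {zero}  s≤q = f₀≤L
  f≤L {suc s} s≤q = ≤-trans (<⇒≤ (f-< z<s s≤q)) f₀≤L

  corner : ∀ i → lookup polygon i ≡ clamp L (f (toℕ (opposite i)))
  corner = lookup∘tabulate (λ i → clamp L (f (toℕ (opposite i))))

  toℕ-corner : ∀ i → toℕ (lookup polygon i) ≡ f (toℕ (opposite i))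
  toℕ-corner i = trans (cong toℕ (corner i)) (toℕ-clamp (f≤L (toℕ≤ (opposite i))))

  last-corner : lookup polygon (fromℕ q) ≡ clamp L (f 0)
  last-corner = trans (corner (fromℕ q)) (cong (clamp L ∘ f)
    (trans (Fin.opposite-prop (fromℕ q)) (trans (cong (q ∸_) (Fin.toℕ-fromℕ q)) (n∸n≡0 q))))

  first-corner : lookup polygon zero ≡ clamp L (f q)
  first-corner = trans (corner zero) (cong (clamp L ∘ f) (Fin.toℕ-fromℕ q))

  source-corner : ∀ j → lookup polygon (inject₁ j) ≡ clamp L (f (suc (toℕ (opposite j))))
  source-corner j = trans (corner (inject₁ j)) (cong (clamp L ∘ f) (begin
    toℕ (opposite (inject₁ j))   ≡⟨ Fin.opposite-prop (inject₁ j) ⟩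
    q ∸ toℕ (inject₁ j)          ≡⟨ cong (q ∸_) (Fin.toℕ-inject₁ j) ⟩
    q ∸ toℕ j                    ≡⟨ +-∸-assoc 1 (Fin.toℕ<n j) ⟩
    suc (q ∸ suc (toℕ j))        ≡⟨ cong suc (Fin.opposite-prop j) ⟨
    suc (toℕ (opposite j))       ∎))
    where open ≡-Reasoning

  target-corner : ∀ j → lookup polygon (suc j) ≡ clamp L (f (toℕ (opposite j)))
  target-corner j = trans (corner (suc j)) (cong (clamp L ∘ f) (Fin.opposite-suc j))

  increasing : StrictlyIncreasing polygon
  increasing i j i<j = subst₂ _<_ (sym (toℕ-corner i)) (sym (toℕ-corner j))
    (f-< (subst₂ _<_ (sym (Fin.opposite-prop j)) (sym (Fin.opposite-prop i))
      (∸-monoʳ-< (s≤s i<j) (Fin.toℕ<n j))) (toℕ≤ (opposite i)))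

  IsSide-elim : ∀ {p} (P : Fin (suc L) → Fin (suc L) → Set p) →
    (∀ s → s < q → P (clamp L (f (suc s))) (clamp L (f s))) → P (clamp L (f 0)) (clamp L (f q)) →
    ∀ {u v} → IsSide polygon u v → P u v
  IsSide-elim P fwd cls (forward j) = subst₂ P (sym (source-corner j)) (sym (target-corner j))
    (fwd (toℕ (opposite j)) (Fin.toℕ<n (opposite j)))
  IsSide-elim P fwd cls closing = subst₂ P (sym last-corner) (sym first-corner) cls

  forward-side : ∀ s → s < q → IsSide polygon (clamp L (f (suc s))) (clamp L (f s))
  forward-side s s<q = subst₂ (IsSide polygon)
    (trans (source-corner j) (cong (clamp L ∘ f ∘ suc) ≡s))
    (trans (target-corner j) (cong (clamp L ∘ f) ≡s)) (forward j)
    where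
    j : Fin q
    j = opposite (fromℕ< s<q)
    ≡s : toℕ (opposite j) ≡ s
    ≡s = trans (cong toℕ (Fin.opposite-involutive (fromℕ< s<q))) (Fin.toℕ-fromℕ< s<q)

  closing-side : IsSide polygon (clamp L (f 0)) (clamp L (f q))
  closing-side = subst₂ (IsSide polygon) last-corner first-corner closing

does-true : ∀ {p} {P : Set p} (P? : Dec P) → does P? ≡ true → P
does-true (yes p) _ = p

module GraphOf {κ L : ℕ} where
  open Chains κ

  private variable m i : ℕ

  Linked : Chain m i → ℕ → ℕ → Set
  Linked c x y = Edge c x y ⊎ Edge c y x

  linked? : (c : Chain m i) → ∀ x y → Dec (Linked c x y)
  linked? c x y = edge? c x y ⊎-dec edge? c y x

  opaque
    graphOf : Chain m i → Graph (suc L)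
    graphOf c = tabulate λ u → tabulate λ v → does (linked? c (toℕ u) (toℕ v))

    row-graphOf : (c : Chain m i) → ∀ u →
      lookup (graphOf c) u ≡ tabulate λ v → does (linked? c (toℕ u) (toℕ v))
    row-graphOf c = lookup∘tabulate (λ u → tabulate λ v → does (linked? c (toℕ u) (toℕ v)))

  lookup-graphOf : (c : Chain m i) → ∀ u v →
    lookup (lookup (graphOf c) u) v ≡ does (linked? c (toℕ u) (toℕ v))
  lookup-graphOf c u v = trans (cong (λ p → lookup p v) (row-graphOf c u))
    (lookup∘tabulate (λ v → does (linked? c (toℕ u) (toℕ v))) v)

  adj⇒linked : (c : Chain m i) → ∀ {u v} → Adj (graphOf c) u v → Linked c (toℕ u) (toℕ v)
  adj⇒linked c {u} {v} uv = does-true (linked? c (toℕ u) (toℕ v))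
    (trans (sym (lookup-graphOf c u v)) ([]=⇒lookup uv))

  linked⇒adj : (c : Chain m i) → ∀ {u v} → Linked c (toℕ u) (toℕ v) → Adj (graphOf c) u v
  linked⇒adj c {u} {v} e = lookup⇒[]= v _
    (trans (lookup-graphOf c u v) (dec-true (linked? c (toℕ u) (toℕ v)) e))

  linked⇒adj-clamp : (c : Chain m i) → ∀ {x y} → x ≤ L → y ≤ L → Linked c x y →
    Adj (graphOf c) (clamp L x) (clamp L y)
  linked⇒adj-clamp c x≤L y≤L e =
    linked⇒adj c (subst₂ (Linked c) (sym (toℕ-clamp x≤L)) (sym (toℕ-clamp y≤L)) e)

  edge-< : (c : Chain m i) → ∀ {x y} → Edge c x y → x < y
  edge-< c e = proj₁ (edge-inSection c e)

  graphOf-simple : (c : Chain m i) → IsSimple (graphOf c)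
  graphOf-simple c =
    (λ u v uv → linked⇒adj c (swap (adj⇒linked c uv))) ,
    (λ u uu → [ (λ e → <-irrefl refl (edge-< c e)) , (λ e → <-irrefl refl (edge-< c e)) ]′
                (adj⇒linked c uu))

  graphOf-injective : (c c′ : Chain m i) → front c 0 ≤ L → graphOf c ≡ graphOf c′ → c ≡ c′
  graphOf-injective c c′ f≤L eq =
    edges-injective c c′ (includes c c′ f≤L eq) (includes c′ c f′≤L (sym eq))
    where
    f′≤L : front c′ 0 ≤ L
    f′≤L = subst (_≤ L) (trans (front-length c) (sym (front-length c′))) f≤L
    includes : ∀ (c c′ : Chain m i) → front c 0 ≤ L → graphOf c ≡ graphOf c′ → Includes c c′
    includes c c′ f≤L eq {x} {y} e =
      [ subst₂ (Edge c′) (toℕ-clamp x≤L) (toℕ-clamp y≤L)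
      , (λ e′ → ⊥-elim (<-asym (edge-< c e)
          (subst₂ _<_ (toℕ-clamp y≤L) (toℕ-clamp x≤L) (edge-< c′ e′)))) ]′
      (adj⇒linked c′ {clamp L x} {clamp L y} (subst (λ G → Adj G (clamp L x) (clamp L y)) eq
        (linked⇒adj-clamp c x≤L y≤L (inj₁ e))))
      where
      y≤L : y ≤ L
      y≤L = ≤-trans (edge-≤-front c e) f≤L
      x≤L : x ≤ L
      x≤L = ≤-trans (<⇒≤ (edge-< c e)) y≤L

  neighbours : Chain m i → Fin (suc L) → Bool
  neighbours c v = does (edge? c (toℕ v) (front c 0))

  neighbours-card : (c : Chain (suc m) i) → front c 0 ≤ L → ∣ tabulate (neighbours c) ∣ ≡ suc (lead c)
  neighbours-card (edge c) f≤L = trans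
    (card-insert (λ _ → false) (neighbours (edge c)) z refl
      (dec-true (edge? (edge c) (toℕ z) (suc (front c 0))) (subst (λ x → Edge (edge c) x _) (sym z≡) new-edge))
      (λ x x≢z → sym (dec-false (edge? (edge c) (toℕ x) (suc (front c 0))) (only x x≢z))))
    (cong suc (card-empty {suc L} (λ _ → false) (λ _ → refl)))
    where
    z : Fin (suc L)
    z = clamp L (front c 0)
    z≡ : toℕ z ≡ front c 0
    z≡ = toℕ-clamp (≤-trans (n≤1+n _) f≤L)
    only : ∀ x → x ≢ z → ¬ Edge (edge c) (toℕ x) (suc (front c 0))
    only x x≢z e with edge-inv e
    ... | inj₁ (x≡ , _) = x≢z (Fin.toℕ-injective (trans x≡ (sym z≡)))
    ... | inj₂ e′       = 1+n≰n (edge-≤-front c e′)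
  neighbours-card (poly {m = m} c) f≤L = trans
    (card-insert (neighbours c) (neighbours (poly c)) z
      (dec-false (edge? c (toℕ z) (front c 0)) λ e → <⇒≱ (front-< c (s<s z<s) (long m))
        (≤-trans (lowest-neighbour c z<s e) (≤-reflexive z≡)))
      (dec-true (edge? (poly c) (toℕ z) (front c 0)) (subst (λ x → Edge (poly c) x _) (sym z≡) new-poly))
      agree)
    (cong suc (neighbours-card c f≤L))
    where
    z : Fin (suc L)
    z = clamp L (front c (suc (suc κ)))
    z≡ : toℕ z ≡ front c (suc (suc κ))
    z≡ = toℕ-clamp (≤-trans (front-≤ c z≤n (long m)) f≤L)
    agree : ∀ x → x ≢ z → neighbours c x ≡ neighbours (poly c) x
    agree x x≢z = does-⇔ (mk⇔ old-poly λ e →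
        [ (λ (x≡ , _) → ⊥-elim (x≢z (Fin.toℕ-injective (trans x≡ (sym z≡))))) , (λ e′ → e′) ]′
          (poly-inv e))
      (edge? c (toℕ x) (front c 0)) (edge? (poly c) (toℕ x) (front c 0))

  root-degree : (c : Chain (suc m) i) → front c 0 ≡ L → degree (graphOf c) (fromℕ L) ≡ suc (lead c)
  root-degree c f≡L = trans
    (cong ∣_∣ (trans (row-graphOf c (fromℕ L))
      (tabulate-cong agree)))
    (neighbours-card c (≤-reflexive f≡L))
    where
    root≡ : toℕ (fromℕ L) ≡ front c 0
    root≡ = trans (Fin.toℕ-fromℕ L) (sym f≡L)
    agree : ∀ v → does (linked? c (toℕ (fromℕ L)) (toℕ v)) ≡ neighbours c v
    agree v = does-⇔ (mk⇔
      [ (λ e → ⊥-elim (<⇒≱ (edge-< c e) (≤-trans (toℕ≤ v) (≤-reflexive (sym (Fin.toℕ-fromℕ L))))))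
      , subst (Edge c (toℕ v)) root≡ ]′
      (λ e → inj₂ (subst (Edge c (toℕ v)) (sym root≡) e)))
      (linked? c (toℕ (fromℕ L)) (toℕ v)) (edge? c (toℕ v) (front c 0))

module HullCycle {L : ℕ} (G : Graph (suc L))
  (symmetric : ∀ u v → Adj G u v → Adj G v u)
  (consecutive : ∀ x → x < L → Adj G (clamp L x) (clamp L (suc x)))
  (closed : Adj G (clamp L 0) (clamp L L)) where

  ascend : ∀ {r} (R : Fin (suc L) → Fin (suc L) → Set r) x d → x + d ≤ L →
    (∀ z → x ≤ z → z < x + d → R (clamp L z) (clamp L (suc z))) →
    Star R (clamp L x) (clamp L (x + d))
  ascend R x zero    _     steps = subst (Star R (clamp L x)) (cong (clamp L) (sym (+-identityʳ x))) ε
  ascend R x (suc d) x+d<L steps = ascend R x d (≤-trans (+-monoʳ-≤ x (n≤1+n d)) x+d<L)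
      (λ z x≤z z< → steps z x≤z (<-≤-trans z< (+-monoʳ-≤ x (n≤1+n d)))) ◅◅
    subst (Star R (clamp L (x + d))) (cong (clamp L) (sym (+-suc x d)))
      (steps (x + d) (m≤m+n x d) (≤-reflexive (sym (+-suc x d))) ◅ ε)

  ascend-to : ∀ {r} (R : Fin (suc L) → Fin (suc L) → Set r) {x y} → x ≤ y → y ≤ L →
    (∀ z → x ≤ z → z < y → R (clamp L z) (clamp L (suc z))) → Star R (clamp L x) (clamp L y)
  ascend-to R {x} {y} x≤y y≤L steps =
    subst (λ y → Star R (clamp L x) (clamp L y)) (m+[n∸m]≡n x≤y)
      (ascend R x (y ∸ x) (subst (_≤ L) (sym (m+[n∸m]≡n x≤y)) y≤L)
        (λ z x≤z z< → steps z x≤z (subst (z <_) (m+[n∸m]≡n x≤y) z<)))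

  connected : ∀ u v → Star (Adj G) u v
  connected u v = subst₂ (Star (Adj G)) (clamp-toℕ u) (clamp-toℕ v)
    ([ (λ u≤v → up u≤v (toℕ≤ v)) , (λ v≤u → reverse (symmetric _ _) (up v≤u (toℕ≤ u))) ]′
      (≤-total (toℕ u) (toℕ v)))
    where
    up : ∀ {x y} → x ≤ y → y ≤ L → Star (Adj G) (clamp L x) (clamp L y)
    up x≤y y≤L = ascend-to (Adj G) x≤y y≤L (λ z _ z<y → consecutive z (<-≤-trans z<y y≤L))

  module _ (w : Fin (suc L)) where

    avoid-symmetric : ∀ {u v} → AdjAvoiding G w u v → AdjAvoiding G w v u
    avoid-symmetric (uv , u≢w , v≢w) = symmetric _ _ uv , v≢w , u≢w

    clamp≢ : ∀ {z} → z ≤ L → z ≢ toℕ w → clamp L z ≢ w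
    clamp≢ z≤L z≢w eq = z≢w (trans (sym (toℕ-clamp z≤L)) (cong toℕ eq))

    ascend-avoiding : ∀ {x y} → x ≤ y → y ≤ L → toℕ w < x ⊎ y < toℕ w →
      Star (AdjAvoiding G w) (clamp L x) (clamp L y)
    ascend-avoiding {x} {y} x≤y y≤L apart = ascend-to (AdjAvoiding G w) x≤y y≤L λ z x≤z z<y →
      consecutive z (<-≤-trans z<y y≤L) ,
      clamp≢ (<⇒≤ (<-≤-trans z<y y≤L)) (avoids x≤z (<⇒≤ z<y)) ,
      clamp≢ (<-≤-trans z<y y≤L) (avoids (m≤n⇒m≤1+n x≤z) z<y)
      where
      avoids : ∀ {z} → x ≤ z → z ≤ y → z ≢ toℕ w
      avoids x≤z z≤y refl = [ (λ w<x → <⇒≱ w<x x≤z) , (λ y<w → <⇒≱ y<w z≤y) ]′ apart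

    path-avoiding : ∀ {x y} → x ≤ y → y ≤ L → x ≢ toℕ w → y ≢ toℕ w →
      Star (AdjAvoiding G w) (clamp L x) (clamp L y)
    path-avoiding {x} {y} x≤y y≤L x≢w y≢w with <-cmp x (toℕ w) | <-cmp (toℕ w) y
    ... | tri≈ _ x≡w _ | _            = ⊥-elim (x≢w x≡w)
    ... | _            | tri≈ _ w≡y _ = ⊥-elim (y≢w (sym w≡y))
    ... | tri> _ _ w<x | _            = ascend-avoiding x≤y y≤L (inj₁ w<x)
    ... | tri< _ _ _   | tri> _ _ y<w = ascend-avoiding x≤y y≤L (inj₂ y<w)
    ... | tri< x<w _ _ | tri< w<y _ _ =
      reverse avoid-symmetric (ascend-avoiding z≤n (≤-trans x≤y y≤L) (inj₂ x<w)) ◅◅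
      (closed , clamp≢ z≤n (<⇒≢ (≤-<-trans z≤n x<w)) ,
        clamp≢ ≤-refl (≢-sym (<⇒≢ (<-≤-trans w<y y≤L)))) ◅
      reverse avoid-symmetric (ascend-avoiding y≤L ≤-refl (inj₁ w<y))

    connected-avoiding : ∀ u v → u ≢ w → v ≢ w → Star (AdjAvoiding G w) u v
    connected-avoiding u v u≢w v≢w = subst₂ (Star (AdjAvoiding G w)) (clamp-toℕ u) (clamp-toℕ v)
      ([ (λ u≤v → path-avoiding u≤v (toℕ≤ v) (u≢w ∘ Fin.toℕ-injective) (v≢w ∘ Fin.toℕ-injective))
       , (λ v≤u → reverse avoid-symmetric
           (path-avoiding v≤u (toℕ≤ u) (v≢w ∘ Fin.toℕ-injective) (u≢w ∘ Fin.toℕ-injective))) ]′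
        (≤-total (toℕ u) (toℕ v)))

  hullCycle⇒twoConnected : 1 < L → TwoConnected G
  hullCycle⇒twoConnected 1<L = s≤s 1<L , connected , connected-avoiding

all-or-any : ∀ {p q} {P : ℕ → Set p} {Q : ℕ → Set q} N → (∀ s → s < N → P s ⊎ Q s) →
  (∀ s → s < N → P s) ⊎ ∃[ s ] s < N × Q s
all-or-any zero    cover = inj₁ λ _ ()
all-or-any {P = P} (suc N) cover with all-or-any N (λ s s<N → cover s (m≤n⇒m≤1+n s<N)) | cover N ≤-refl
... | inj₂ (s , s<N , q) | _      = inj₂ (s , m≤n⇒m≤1+n s<N , q)
... | inj₁ ps            | inj₂ q = inj₂ (N , ≤-refl , q)
... | inj₁ ps            | inj₁ p = inj₁ λ s s≤N →
  [ (λ s<N → ps s s<N) , (λ s≡N → subst P (sym s≡N) p) ]′ (m≤n⇒m<n∨m≡n (≤-pred s≤N))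

module PolygonFace {c ℓ₁ ℓ₂} (F : OrderedField c ℓ₁ ℓ₂) {L : ℕ}
  (S : Fin (suc L) → Plane.Point F) (convexPosition : Plane.ConvexPosition F S)
  (G : Graph (suc L)) (simple : IsSimple G)
  {q : ℕ} (f : ℕ → ℕ) (step : ∀ s → s < 2 + q → f (suc s) < f s) (f₀≤L : f 0 ≤ L) where
  open Plane F
  open PlaneProperties F
  open ConvexProperties F S convexPosition
  open FaceProperties F S convexPosition G
  open PolygonOf f step f₀≤L public
  open Polygon polygon increasing

  sidesAdjacent : (∀ s → s < 2 + q → Adj G (clamp L (f (suc s))) (clamp L (f s))) →
    Adj G (clamp L (f 0)) (clamp L (f (2 + q))) → SidesAdjacent polygon
  sidesAdjacent = IsSide-elim (Adj G)

  OuterSide : Fin (suc L) → Fin (suc L) → Set _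
  OuterSide u v =
    ∃[ a ] ∃[ b ] IsSide polygon a b × WeakLeft (S b) (S a) (S u) × WeakLeft (S b) (S a) (S v)

  outer : ∀ u v → u Fin.< v → Separated f (2 + q) (toℕ u) (toℕ v) → OuterSide u v
  outer u v u<v (inj₁ (s , s<q , l , h)) = _ , _ , forward-side s s<q ,
    between⇒weakRight l′ (≤-trans (<⇒≤ u<v) h′) , between⇒weakRight (≤-trans l′ (<⇒≤ u<v)) h′
    where
    l′ : clamp L (f (suc s)) Fin.≤ u
    l′ = subst (_≤ toℕ u) (sym (toℕ-clamp (f≤L s<q))) l
    h′ : v Fin.≤ clamp L (f s)
    h′ = subst (toℕ v ≤_) (sym (toℕ-clamp (f≤L (<⇒≤ s<q)))) h
  outer u v u<v (inj₂ (au , av)) = _ , _ , closing-side ,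
    outside⇒weakLeft lo<hi (outside au) , outside⇒weakLeft lo<hi (outside av)
    where
    lo≡ = toℕ-clamp (f≤L {2 + q} ≤-refl)
    hi≡ = toℕ-clamp f₀≤L
    lo<hi : clamp L (f (2 + q)) Fin.< clamp L (f 0)
    lo<hi = subst₂ _<_ (sym lo≡) (sym hi≡) (f-< z<s ≤-refl)
    outside : ∀ {x} → Apart (f (2 + q)) (f 0) (toℕ x) → Outside (clamp L (f (2 + q))) (clamp L (f 0)) x
    outside {x} = Sum.map (subst (toℕ x ≤_) (sym lo≡)) (subst (_≤ toℕ x) (sym hi≡))

  edgesOutside : (∀ u v → Adj G u v → u Fin.< v → Separated f (2 + q) (toℕ u) (toℕ v)) →
    EdgesOutside polygon
  edgesOutside separated u v uv with Fin.<-cmp u v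
  ... | tri≈ _ refl _ = ⊥-elim (proj₂ simple u uv)
  ... | tri< u<v _ _  = outer u v u<v (separated u v uv u<v)
  ... | tri> _ _ v<u with outer v u v<u (separated v u (proj₁ simple u v uv) v<u)
  ...   | a , b , ab , wv , wu = a , b , ab , wu , wv

module ChainAngulation {c ℓ₁ ℓ₂} (F : OrderedField c ℓ₁ ℓ₂) (κ i : ℕ) (1≤i : 1 ≤ i)
  (S : Fin (2 + suc κ * i) → Plane.Point F) (convexPosition : Plane.ConvexPosition F S)
  (C : Chains.Chain κ 1 i) where
  open Chains κ
  open OrderedField F using (0#; _≈_)
  open OrderedFieldProperties F using (pos⇒nonzero)
  open Plane F
  open PlaneProperties F
  open ConvexProperties F S convexPosition

  L : ℕ
  L = suc (suc κ * i)

  open GraphOf {κ} {L}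

  G : Graph (suc L)
  G = graphOf C

  open FaceProperties F S convexPosition G

  front≡L : front C 0 ≡ L
  front≡L = front-length C

  1<L : 1 < L
  1<L = s≤s (≤-trans 1≤i (m≤m+n i (κ * i)))

  simple : IsSimple G
  simple = graphOf-simple C

  CommonEndpoints : (u v u′ v′ : Fin (suc L)) → Set _
  CommonEndpoints u v u′ v′ = ¬ SameEdge u v u′ v′ →
    ∀ Q → Segment (S u) (S v) Q → Segment (S u′) (S v′) Q → CommonEndpoint u v u′ v′ Q

  swap-edge : ∀ {u v u′ v′ : Fin (suc L)} → SameEdge v u u′ v′ → SameEdge u v u′ v′
  swap-edge (inj₁ (p , q)) = inj₂ (q , p)
  swap-edge (inj₂ (p , q)) = inj₁ (q , p)

  swap-endpoint : ∀ {u v u′ v′} {Q} → CommonEndpoint v u u′ v′ Q → CommonEndpoint u v u′ v′ Q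
  swap-endpoint (w , w∈ , w∈′ , Q≋) = w , swap w∈ , w∈′ , Q≋

  edges-meet : ∀ {u v u′ v′} → Edge C (toℕ u) (toℕ v) → Edge C (toℕ u′) (toℕ v′) →
    CommonEndpoints u v u′ v′
  edges-meet {u} {v} {u′} {v′} e e′ ≢edge Q s s′ =
    [ (λ (au , av) → oneSided-meet (λ x → collinear⇒endpoint u<v) u′≢v′ ≢edge
        (outside⇒weakLeft u<v au) (outside⇒weakLeft u<v av) Q s s′)
    , (λ (u≤u′ , v′≤v) → swap-endpoint (oneSided-meet {v} {u}
        (λ x o → swap (collinear⇒endpoint u<v (swap-zero (S v) (S u) (S x) o))) u′≢v′ (≢edge ∘ swap-edge)
        (between⇒weakRight u≤u′ (≤-trans (<⇒≤ u′<v′) v′≤v))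
        (between⇒weakRight (≤-trans u≤u′ (<⇒≤ u′<v′)) v′≤v)
        Q (segment-sym {S u} {S v} {Q} s) s′)) ]′
      (noncrossing⇒sides u<v u′<v′ (edges-noncrossing C e e′) (edges-noncrossing C e′ e))
    where
    u<v : u Fin.< v
    u<v = edge-< C e
    u′<v′ : u′ Fin.< v′
    u′<v′ = edge-< C e′
    u′≢v′ : u′ ≢ v′
    u′≢v′ refl = <-irrefl refl u′<v′

  flip₁ : ∀ u v u′ v′ → CommonEndpoints v u u′ v′ → CommonEndpoints u v u′ v′
  flip₁ u v u′ v′ meet ≢edge Q s s′ =
    swap-endpoint (meet (≢edge ∘ swap-edge) Q (segment-sym {S u} {S v} {Q} s) s′)

  flip₂ : ∀ u v u′ v′ → CommonEndpoints u v v′ u′ → CommonEndpoints u v u′ v′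
  flip₂ u v u′ v′ meet ≢edge Q s s′ =
    let w , w∈ , w∈′ , Q≋ = meet (≢edge ∘ swap-edge′) Q s (segment-sym {S u′} {S v′} {Q} s′)
    in w , w∈ , swap w∈′ , Q≋
    where
    swap-edge′ : SameEdge u v v′ u′ → SameEdge u v u′ v′
    swap-edge′ (inj₁ (p , q)) = inj₂ (p , q)
    swap-edge′ (inj₂ (p , q)) = inj₁ (p , q)

  plane : IsPlane S G
  plane u v u′ v′ uv uv′ with adj⇒linked C {u} {v} uv | adj⇒linked C {u′} {v′} uv′
  ... | inj₁ e | inj₁ e′ = edges-meet e e′
  ... | inj₂ e | inj₁ e′ = flip₁ u v u′ v′ (edges-meet e e′)
  ... | inj₁ e | inj₂ e′ = flip₂ u v u′ v′ (edges-meet e e′)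
  ... | inj₂ e | inj₂ e′ = flip₁ u v u′ v′ (flip₂ v u u′ v′ (edges-meet e e′))

  root-edge : Edge C 0 L
  root-edge = subst₂ (Edge C) (front-end C) front≡L (section-edge C z<s)

  twoConnected : TwoConnected G
  twoConnected = HullCycle.hullCycle⇒twoConnected G (proj₁ simple)
    (λ x x<L → linked⇒adj-clamp C (<⇒≤ x<L) x<L (inj₁ (hull-edge C (subst (x <_) (sym front≡L) x<L))))
    (linked⇒adj-clamp C z≤n ≤-refl (inj₁ root-edge)) 1<L

  module Face {m′ i′ : ℕ} (D : Chain (suc κ + suc m′) i′) (C∋D : C ∋ D) where
    open PolygonFace F S convexPosition G simple {κ} (front D)
      (λ s s<k → front-step D (<-≤-trans s<k (long m′)))
      (≤-trans (edge-≤-front C (face-closing C∋D)) (≤-reflexive front≡L)) public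

    adjacent : SidesAdjacent polygon
    adjacent = sidesAdjacent
      (λ s s<k → linked⇒adj-clamp C (f≤L s<k) (f≤L (<⇒≤ s<k))
        (inj₁ (face-edges C∋D (section-edge D (<-≤-trans s<k (long m′))))))
      (linked⇒adj-clamp C (f≤L z≤n) (f≤L ≤-refl) (inj₂ (face-closing C∋D)))

    outside : EdgesOutside polygon
    outside = edgesOutside λ u v uv u<v →
      [ face-separated C∋D , (λ e → ⊥-elim (<-asym u<v (edge-< C e))) ]′ (adj⇒linked C {u} {v} uv)

    isFace : ∀ P → Interior S polygon P → InternalFaceAt S G P × FaceIsPolygon S G P polygon
    isFace = polygon-is-face polygon increasing adjacent outside

  hull-consecutive : ∀ x → x < L → HullSide (clamp L x) (clamp L (suc x))
  hull-consecutive x x<L = (λ y → outside⇒weakLeft <suc (outside y)) , third x x<L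
    where
    x≡ = toℕ-clamp (<⇒≤ x<L)
    sx≡ = toℕ-clamp x<L
    <suc : clamp L x Fin.< clamp L (suc x)
    <suc = subst₂ _<_ (sym x≡) (sym sx≡) ≤-refl
    outside : ∀ y → Outside (clamp L x) (clamp L (suc x)) y
    outside y = Sum.map (subst (toℕ y ≤_) (sym x≡)) (subst (_≤ toℕ y) (sym sx≡)) (≤-<-connex (toℕ y) x)
    third : ∀ x → x < L → ∃[ y ] Left (S (clamp L x)) (S (clamp L (suc x))) (S y)
    third zero x<L = clamp L 2 , convex _ _ _
      (subst₂ _<_ (sym (toℕ-clamp {L} {0} z≤n)) (sym (toℕ-clamp (<⇒≤ 1<L))) z<s)
      (subst₂ _<_ (sym (toℕ-clamp (<⇒≤ 1<L))) (sym (toℕ-clamp 1<L)) (s<s z<s))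
    third (suc x) x<L = clamp L 0 , left-before
      (subst₂ _<_ (sym (toℕ-clamp {L} {0} z≤n)) (sym (toℕ-clamp (<⇒≤ x<L))) z<s)
      (subst₂ _<_ (sym (toℕ-clamp (<⇒≤ x<L))) (sym (toℕ-clamp x<L)) ≤-refl)

  hull-closing : HullSide (clamp L L) (clamp L 0)
  hull-closing =
    (λ y → between⇒weakRight (subst (_≤ toℕ y) (sym (toℕ-clamp {L} {0} z≤n)) z≤n)
      (subst (toℕ y ≤_) (sym (toℕ-clamp {L} {L} ≤-refl)) (toℕ≤ y))) ,
    clamp L 1 , right-between
      (subst₂ _<_ (sym (toℕ-clamp {L} {0} z≤n)) (sym (toℕ-clamp (<⇒≤ 1<L))) z<s)
      (subst₂ _<_ (sym (toℕ-clamp (<⇒≤ 1<L))) (sym (toℕ-clamp {L} {L} ≤-refl)) 1<L)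

  module Locate (P : Point) (internal : InternalFaceAt S G P) where

    RightOf : ℕ → ℕ → Set _
    RightOf x y = Left (S (clamp L y)) (S (clamp L x)) P

    left-of-hull : ∀ x → x < L → Left (S (clamp L x)) (S (clamp L (suc x))) P
    left-of-hull x x<L = internal⇒left-of-hull (hull-consecutive x x<L) P internal

    not-right-of-hull : ∀ x → x < L → ¬ RightOf x (suc x)
    not-right-of-hull x x<L = left-right-⊥ {S (clamp L x)} {S (clamp L (suc x))} {P}
      (inj₁ (left-of-hull x x<L))

    not-on-edge : ∀ {x y} → Edge C x y → ¬ (area (S (clamp L x)) (S (clamp L y)) P ≈ 0#)
    not-on-edge {y = zero} e = ⊥-elim (n≮0 (edge-< C e))
    not-on-edge {x} {suc y} e o = split (m≤n⇒m<n∨m≡n (≤-pred (edge-< C e)))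
      where
      y<L : y < L
      y<L = ≤-trans (edge-≤-front C e) (≤-reflexive front≡L)
      clamp-< : ∀ {z w} → z < w → w ≤ L → clamp L z Fin.< clamp L w
      clamp-< z<w w≤L = subst₂ _<_ (sym (toℕ-clamp (≤-trans (<⇒≤ z<w) w≤L))) (sym (toℕ-clamp w≤L)) z<w
      split : x < y ⊎ x ≡ y → ⊥
      split (inj₂ x≡y) = pos⇒nonzero
        (subst (λ z → Left (S (clamp L z)) (S (clamp L (suc y))) P) (sym x≡y) (left-of-hull y y<L)) o
      split (inj₁ x<y) = proj₁ internal (clamp L x , clamp L (suc y) ,
        linked⇒adj-clamp C (≤-trans (<⇒≤ x<y) (<⇒≤ y<L)) y<L (inj₁ e) ,
        inner-collinear⇒segment P
          (clamp-< ≤-refl (≤-trans x<y (<⇒≤ y<L))) (clamp-< (s≤s x<y) y<L)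
          (clamp-< x<y (<⇒≤ y<L)) (clamp-< ≤-refl y<L)
          (left-of-hull x (<-trans x<y y<L)) (left-of-hull y y<L) o)

    Located : ∀ {m i′} → Chain m i′ → Set _
    Located c = Σ[ m′ ∈ ℕ ] Σ[ i″ ∈ ℕ ] Σ[ D ∈ Chain (suc κ + suc m′) i″ ]
      c ∋ D × Interior S (polygonOf L (2 + κ) (front D)) P

    inside-or-beyond : ∀ {m′ i′} (D : Chain (suc κ + suc m′) i′) → Includes D C → C ∋ D →
      RightOf (front D (2 + κ)) (front D 0) →
      Interior S (polygonOf L (2 + κ) (front D)) P ⊎
      ∃[ s ] s < 2 + κ × RightOf (front D (suc s)) (front D s)
    inside-or-beyond {m′} D D⊆C C∋D beyond = Sum.map interior (λ r → r) (all-or-any (2 + κ) cover)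
      where
      cover : ∀ s → s < 2 + κ →
        Left (S (clamp L (front D (suc s)))) (S (clamp L (front D s))) P ⊎ RightOf (front D (suc s)) (front D s)
      cover s s<k with side (S (clamp L (front D (suc s)))) (S (clamp L (front D s))) P
      ... | left l  = inj₁ l
      ... | right r = inj₂ r
      ... | on o    = ⊥-elim (not-on-edge (D⊆C (section-edge D (<-≤-trans s<k (long m′)))) o)
      interior : (∀ s → s < 2 + κ → Left (S (clamp L (front D (suc s)))) (S (clamp L (front D s))) P) →
        Interior S (polygonOf L (2 + κ) (front D)) P
      interior ls = Polygon.left⇒interior polygon increasing P
        (IsSide-elim (λ u v → Left (S u) (S v) P) ls beyond)
        where open Face D C∋D

    -- The part of the plane beyond a member of a chain is cut by the polygon below
    -- that member into the polygon itself and the parts beyond its other sides.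
    locate : ∀ {m i′} (c : Chain m i′) → Includes c C →
      (∀ {m′ i″} {D : Chain (suc κ + suc m′) i″} → c ∋ D → C ∋ D) →
      ∀ j → j < m → RightOf (front c (suc j)) (front c j) → Located c
    locate (edge c) c⊆C lift zero j<m beyond = ⊥-elim (not-right-of-hull (front c 0)
      (≤-trans (edge-≤-front C (c⊆C new-edge)) (≤-reflexive front≡L)) beyond)
    locate (edge c) c⊆C lift (suc j) (s≤s j<m) beyond
      with locate c (c⊆C ∘ old-edge) (lift ∘ in-edge) j j<m beyond
    ... | _ , _ , D , c∋D , int = _ , _ , D , in-edge c∋D , int
    locate (poly {m = m} c) c⊆C lift (suc j) (s≤s j<m) beyond
      with locate c (c⊆C ∘ old-poly) (lift ∘ in-poly) (suc (suc κ) + j)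
        (subst (suc (suc κ) + j <_) (sym (+-suc (suc κ) m)) (+-monoʳ-< (suc (suc κ)) j<m))
        (subst (λ l → RightOf (front c l) (front c (suc (suc κ) + j))) (+-suc (suc (suc κ)) j) beyond)
    ... | _ , _ , D , c∋D , int = _ , _ , D , in-poly c∋D , int
    locate (poly {m = m} c) c⊆C lift zero j<m beyond
      with inside-or-beyond c (c⊆C ∘ old-poly) (lift this)
        (subst (λ l → RightOf (front c l) (front c 0)) (+-identityʳ (suc (suc κ))) beyond)
    ... | inj₁ int = _ , _ , c , this , int
    ... | inj₂ (s , s<k , r) with locate c (c⊆C ∘ old-poly) (lift ∘ in-poly) s (<-≤-trans s<k (long m)) r
    ...   | _ , _ , D , c∋D , int = _ , _ , D , in-poly c∋D , int

    located : Located C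
    located = locate C (λ e → e) (λ p → p) 0 z<s
      (subst₂ RightOf (sym (front-end C)) (sym front≡L) (internal⇒left-of-hull hull-closing P internal))

  faces : ∀ {m i′} → Chain m i′ → List (Vec (Fin (suc L)) (3 + κ))
  faces nil      = []
  faces (edge c) = faces c
  faces (poly c) = polygonOf L (2 + κ) (front c) ∷ faces c

  length-faces : ∀ {m i′} (c : Chain m i′) → length (faces c) ≡ i′
  length-faces nil      = refl
  length-faces (edge c) = length-faces c
  length-faces (poly c) = cong suc (length-faces c)

  ∋⇒∈-faces : ∀ {m i′ m′ i″} {c : Chain m i′} {D : Chain (suc κ + suc m′) i″} → c ∋ D →
    polygonOf L (2 + κ) (front D) ∈ faces c
  ∋⇒∈-faces this        = here refl
  ∋⇒∈-faces (in-edge p) = ∋⇒∈-faces p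
  ∋⇒∈-faces (in-poly p) = there (∋⇒∈-faces p)

  ∈-faces⇒∋ : ∀ {m i′} (c : Chain m i′) {T} → T ∈ faces c →
    Σ[ m′ ∈ ℕ ] Σ[ i″ ∈ ℕ ] Σ[ D ∈ Chain (suc κ + suc m′) i″ ]
      c ∋ D × T ≡ polygonOf L (2 + κ) (front D)
  ∈-faces⇒∋ (edge c) ∈faces with ∈-faces⇒∋ c ∈faces
  ... | _ , _ , D , c∋D , T≡ = _ , _ , D , in-edge c∋D , T≡
  ∈-faces⇒∋ (poly c) (here T≡) = _ , _ , c , this , T≡
  ∈-faces⇒∋ (poly c) (there ∈faces) with ∈-faces⇒∋ c ∈faces
  ... | _ , _ , D , c∋D , T≡ = _ , _ , D , in-poly c∋D , T≡

  faces-unique : ∀ {m i′} (c : Chain m i′) →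
    (∀ {m′ i″} {D : Chain (suc κ + suc m′) i″} → c ∋ D → C ∋ D) → Unique (faces c)
  faces-unique nil      lift = []
  faces-unique (edge c) lift = faces-unique c (lift ∘ in-edge)
  faces-unique (poly c) lift = All.tabulate distinct ∷ faces-unique c (lift ∘ in-poly)
    where
    distinct : ∀ {T} → T ∈ faces c → polygonOf L (2 + κ) (front c) ≢ T
    distinct ∈faces refl with ∈-faces⇒∋ c ∈faces
    ... | _ , _ , D , c∋D , T≡ = face-ends-distinct c∋D
      (ends-≡ (fromℕ (2 + κ)) D.last-corner c.last-corner (D.f≤L z≤n) (c.f≤L z≤n))
      (ends-≡ zero D.first-corner c.first-corner (D.f≤L ≤-refl) (c.f≤L ≤-refl))
      where
      module D = Face D (lift (in-poly c∋D))
      module c = Face c (lift this)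
      ends-≡ : ∀ j {x y} → lookup D.polygon j ≡ clamp L x → lookup c.polygon j ≡ clamp L y →
        x ≤ L → y ≤ L → x ≡ y
      ends-≡ j {x} {y} x≡ y≡ x≤L y≤L = begin
        x                ≡⟨ toℕ-clamp x≤L ⟨
        toℕ (clamp L x)  ≡⟨ cong toℕ (trans (sym x≡) (trans (cong (λ T → lookup T j) (sym T≡)) y≡)) ⟩
        toℕ (clamp L y)  ≡⟨ toℕ-clamp y≤L ⟩
        y                ∎
        where open ≡-Reasoning

  isKAngulation : IsKAngulation S (3 + κ) G
  isKAngulation = simple , plane , twoConnected , face
    where
    face : ∀ P → InternalFaceAt S G P → Σ[ T ∈ Vec (Fin (suc L)) (3 + κ) ] FaceIsPolygon S G P T
    face P internal with Locate.located P internal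
    ... | _ , _ , D , C∋D , int = polygonOf L (2 + κ) (front D) , proj₂ (Face.isFace D C∋D P int)

  hasKGons : HasKGons S (3 + κ) i G
  hasKGons = faces C , faces-unique C (λ p → p) , (λ T → mk⇔ to from) , length-faces C
    where
    to : ∀ {T} → T ∈ faces C → ∃[ P ] InternalFaceAt S G P × FaceIsPolygon S G P T
    to {T} ∈faces =
      let _ , _ , D , C∋D , T≡ = ∈-faces⇒∋ C ∈faces
          P , int = Polygon.interior-point (Face.polygon D C∋D) (Face.increasing D C∋D)
      in subst (λ T → ∃[ P ] InternalFaceAt S G P × FaceIsPolygon S G P T) (sym T≡)
           (P , Face.isFace D C∋D P int)
    from : ∀ {T} → ∃[ P ] InternalFaceAt S G P × FaceIsPolygon S G P T → T ∈ faces C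
    from {T} (P , internal , face) with Locate.located P internal
    ... | _ , _ , D , C∋D , int = subst (_∈ faces C)
      (trans (sym (cast-is-id refl _)) (toList-injective refl (polygonOf L (2 + κ) (front D)) T
        (face-polygon-unique (polygonOf L (2 + κ) (front D)) T P (proj₁ internal)
          (proj₂ (Face.isFace D C∋D P int)) face)))
      (∋⇒∈-faces C∋D)

  rootDegree : degree G (fromℕ L) ≡ suc (lead C)
  rootDegree = root-degree C front≡L

-- The chain of an angulation

none-or-maximum : ∀ {n p} {P : Fin n → Set p} → (∀ x → Dec (P x)) → (ρ : Fin n → ℕ) →
  (∀ x → ¬ P x) ⊎ ∃[ m ] P m × (∀ y → P y → ρ y ≤ ρ m)
none-or-maximum {zero}  P? ρ = inj₁ λ ()
none-or-maximum {suc n} P? ρ with P? zero | none-or-maximum (P? ∘ suc) (ρ ∘ suc)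
... | no ¬p | inj₁ none = inj₁ λ { zero → ¬p ; (suc x) → none x }
... | yes p | inj₁ none = inj₂ (zero , p , λ { zero _ → ≤-refl ; (suc y) q → ⊥-elim (none y q) })
... | no ¬p | inj₂ (m , q , max) =
  inj₂ (suc m , q , λ { zero p → ⊥-elim (¬p p) ; (suc y) r → max y r })
... | yes p | inj₂ (m , q , max) with ≤-total (ρ zero) (ρ (suc m))
...   | inj₁ ≤m = inj₂ (suc m , q , λ { zero _ → ≤m ; (suc y) r → max y r })
...   | inj₂ m≤ = inj₂ (zero , p , λ { zero _ → ≤-refl ; (suc y) r → ≤-trans (max y r) m≤ })

maximum : ∀ {n p} {P : Fin n → Set p} → (∀ x → Dec (P x)) → (ρ : Fin n → ℕ) → ∀ x → P x →
  ∃[ m ] P m × (∀ y → P y → ρ y ≤ ρ m)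
maximum P? ρ x px with none-or-maximum P? ρ
... | inj₁ none = ⊥-elim (none x px)
... | inj₂ max  = max

least-from : ∀ {p} {P : ℕ → Set p} → (∀ x → Dec (P x)) → ∀ l d → P (l + d) →
  ∃[ y ] l ≤ y × y ≤ l + d × P y × (∀ z → l ≤ z → P z → y ≤ z)
least-from {P = P} P? l zero px = l , ≤-refl , m≤m+n l 0 , subst P (+-identityʳ l) px , λ z l≤z _ → l≤z
least-from {P = P} P? l (suc d) px with P? l
... | yes pl = l , ≤-refl , m≤m+n l (suc d) , pl , λ z l≤z _ → l≤z
... | no ¬pl with least-from P? (suc l) d (subst P (+-suc l d) px)
...   | y , l<y , y≤ , py , min = y , <⇒≤ l<y , subst (y ≤_) (sym (+-suc l d)) y≤ , py , λ z l≤z pz →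
  [ (λ l<z → min z l<z pz) , (λ { refl → ⊥-elim (¬pl pz) }) ]′ (m≤n⇒m<n∨m≡n l≤z)

least : ∀ {p} {P : ℕ → Set p} → (∀ x → Dec (P x)) → ∀ {l x} → l ≤ x → P x →
  ∃[ y ] l ≤ y × y ≤ x × P y × (∀ z → l ≤ z → P z → y ≤ z)
least {P = P} P? {l} {x} l≤x px with m≤n⇒∃[o]m+o≡n l≤x
... | d , refl = least-from P? l d px

NonCrossing : ∀ {n} → Graph n → (Fin n → ℕ) → Set
NonCrossing G ρ = ∀ x y z w → Adj G x z → Adj G y w → ¬ (ρ x < ρ y × ρ y < ρ z × ρ z < ρ w)

-- A path from b to a that avoids the neighbour m of b farthest from b would have
-- to cross the edge from b to m.
extremes-adjacent : ∀ {n} (G : Graph n) → IsSimple G → TwoConnected G → (ρ : Fin n → ℕ) →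
  (∀ x y → ρ x ≡ ρ y → x ≡ y) → NonCrossing G ρ →
  ∀ a b → a ≢ b → (∀ x → ρ b ≤ ρ x) → (∀ x → ρ x ≤ ρ a) → Adj G b a
extremes-adjacent G (symmetric , loopless) (_ , connected , avoiding) ρ injective noncrossing
  a b a≢b b-min a-max with a ∈? lookup G b
... | yes ba = ba
... | no ¬ba = ⊥-elim (first-step (connected b a))
  where
  strictly : ∀ {x y} → x ≢ y → ρ x ≤ ρ y → ρ x < ρ y
  strictly x≢y x≤y = ≤∧≢⇒< x≤y (x≢y ∘ injective _ _)
  first-step : ¬ Star (Adj G) b a
  first-step ε = a≢b refl
  first-step (_◅_ {j = z} bz _) with maximum (λ x → x ∈? lookup G b) ρ z bz
  ... | m , bm , max = no-crossing-path (strictly b≢m (b-min m)) (avoiding m b a b≢m a≢m)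
    where
    b≢m : b ≢ m
    b≢m refl = loopless b bm
    a≢m : a ≢ m
    a≢m refl = ¬ba bm
    no-crossing-path : ∀ {x} → ρ x < ρ m → ¬ Star (AdjAvoiding G m) x a
    no-crossing-path a<m ε = <⇒≱ a<m (a-max m)
    no-crossing-path {x} x<m (_◅_ {j = y} (xy , _ , y≢m) path) with <-cmp (ρ y) (ρ m)
    ... | tri< y<m _ _ = no-crossing-path y<m path
    ... | tri≈ _ y≡m _ = y≢m (injective y m y≡m)
    ... | tri> _ _ m<y = noncrossing b x m y bm xy (strictly b≢x (b-min x) , x<m , m<y)
      where
      b≢x : b ≢ x
      b≢x refl = <⇒≱ m<y (max y xy)

module Rotation {L : ℕ} (t : ℕ) where

  rotate : Fin (suc L) → ℕ
  rotate x with toℕ x <? t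
  ... | yes _ = toℕ x + suc L
  ... | no  _ = toℕ x

  data Rotate (x : Fin (suc L)) : ℕ → Set where
    wrapped : toℕ x < t → Rotate x (toℕ x + suc L)
    kept    : t ≤ toℕ x → Rotate x (toℕ x)

  rotate-view : ∀ x → Rotate x (rotate x)
  rotate-view x with toℕ x <? t
  ... | yes x<t = wrapped x<t
  ... | no x≮t  = kept (≮⇒≥ x≮t)

  wrapped≮kept : ∀ x (y : Fin (suc L)) → ¬ (x + suc L < toℕ y)
  wrapped≮kept x y x<y = <⇒≱ (Fin.toℕ<n y) (<⇒≤ (≤-<-trans (m≤n+m (suc L) x) x<y))

  rotate-injective : ∀ x y → rotate x ≡ rotate y → x ≡ y
  rotate-injective x y eq with rotate x | rotate-view x | rotate y | rotate-view y
  ... | _ | kept _    | _ | kept _    = Fin.toℕ-injective eq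
  ... | _ | wrapped _ | _ | wrapped _ = Fin.toℕ-injective (+-cancelʳ-≡ (suc L) _ _ eq)
  ... | _ | kept _    | _ | wrapped _ = 
    ⊥-elim (<⇒≱ (Fin.toℕ<n x) (subst (suc L ≤_) (sym eq) (m≤n+m _ (toℕ y))))
  ... | _ | wrapped _ | _ | kept _    = 
    ⊥-elim (<⇒≱ (Fin.toℕ<n y) (subst (suc L ≤_) eq (m≤n+m _ (toℕ x))))

  unwrap : ∀ {x y} → x + suc L < y + suc L → x < y
  unwrap {x} {y} = +-cancelʳ-< (suc L) x y

  rotate-noncrossing : ∀ (G : Graph (suc L)) → (∀ u v → Adj G u v → Adj G v u) →
    NonCrossing G toℕ → NonCrossing G rotate
  rotate-noncrossing G symmetric noncrossing x y z w xz yw (x<y , y<z , z<w)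
    with rotate x | rotate-view x | rotate y | rotate-view y
       | rotate z | rotate-view z | rotate w | rotate-view w
  ... | _ | kept _   | _ | kept _    | _ | kept _    | _ | kept _    =
    noncrossing x y z w xz yw (x<y , y<z , z<w)
  ... | _ | kept t≤x | _ | kept _    | _ | kept _    | _ | wrapped w<t =
    noncrossing w x y z (symmetric y w yw) xz (<-≤-trans w<t t≤x , x<y , y<z)
  ... | _ | kept t≤x | _ | kept _    | _ | wrapped _ | _ | wrapped w<t =
    noncrossing z w x y (symmetric x z xz) (symmetric y w yw) (unwrap z<w , <-≤-trans w<t t≤x , x<y)
  ... | _ | kept t≤x | _ | wrapped _ | _ | wrapped _ | _ | wrapped w<t =
    noncrossing y z w x yw (symmetric x z xz) (unwrap y<z , unwrap z<w , <-≤-trans w<t t≤x)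
  ... | _ | wrapped _ | _ | wrapped _ | _ | wrapped _ | _ | wrapped _ =
    noncrossing x y z w xz yw (unwrap x<y , unwrap y<z , unwrap z<w)
  ... | _ | wrapped _ | _ | kept _    | _ | _ | _ | _ = wrapped≮kept (toℕ x) y x<y
  ... | _ | _ | _ | wrapped _ | _ | kept _    | _ | _ = wrapped≮kept (toℕ y) z y<z
  ... | _ | _ | _ | _ | _ | wrapped _ | _ | kept _    = wrapped≮kept (toℕ z) w z<w

module _ {L : ℕ} (G : Graph (suc L)) (simple : IsSimple G) (twoConnected : TwoConnected G)
  (noncrossing : NonCrossing G toℕ) where

  clamp-≢ : ∀ {x y} → x ≤ L → y ≤ L → x ≢ y → clamp L x ≢ clamp L y
  clamp-≢ x≤L y≤L x≢y eq = x≢y (trans (sym (toℕ-clamp x≤L)) (trans (cong toℕ eq) (toℕ-clamp y≤L)))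

  ends-adjacent : 0 < L → Adj G (clamp L 0) (clamp L L)
  ends-adjacent 0<L = extremes-adjacent G simple twoConnected toℕ (λ _ _ → Fin.toℕ-injective) noncrossing
    (clamp L L) (clamp L 0) (clamp-≢ ≤-refl z≤n (≢-sym (<⇒≢ 0<L)))
    (λ x → subst (_≤ toℕ x) (sym (toℕ-clamp {L} z≤n)) z≤n)
    (λ x → subst (toℕ x ≤_) (sym (toℕ-clamp {L} ≤-refl)) (toℕ≤ x))

  consecutive-adjacent : ∀ x → x < L → Adj G (clamp L x) (clamp L (suc x))
  consecutive-adjacent x x<L = proj₁ simple _ _
    (extremes-adjacent G simple twoConnected rotate rotate-injective
      (rotate-noncrossing G (proj₁ simple) noncrossing)
      (clamp L x) (clamp L (suc x)) (clamp-≢ (<⇒≤ x<L) x<L (<⇒≢ ≤-refl)) lowest highest)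
    where
    open Rotation {L} (suc x)
    x≡ = toℕ-clamp (<⇒≤ x<L)
    sx≡ = toℕ-clamp x<L
    lowest : ∀ y → rotate (clamp L (suc x)) ≤ rotate y
    lowest y with rotate (clamp L (suc x)) | rotate-view (clamp L (suc x)) | rotate y | rotate-view y
    ... | _ | wrapped sx<sx | _ | _ = ⊥-elim (<-irrefl sx≡ sx<sx)
    ... | _ | kept _ | _ | wrapped _ =
      ≤-trans (toℕ≤ (clamp L (suc x))) (≤-trans (n≤1+n L) (m≤n+m _ (toℕ y)))
    ... | _ | kept _ | _ | kept sx≤y = subst (_≤ toℕ y) (sym sx≡) sx≤y
    highest : ∀ y → rotate y ≤ rotate (clamp L x)
    highest y with rotate (clamp L x) | rotate-view (clamp L x) | rotate y | rotate-view y
    ... | _ | kept sx≤x | _ | _ = ⊥-elim (<-irrefl (sym x≡) sx≤x)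
    ... | _ | wrapped _ | _ | wrapped y<sx =
      +-monoˡ-≤ (suc L) (subst (toℕ y ≤_) (sym x≡) (≤-pred y<sx))
    ... | _ | wrapped _ | _ | kept _ =
      ≤-trans (toℕ≤ y) (≤-trans (n≤1+n L) (m≤n+m _ (toℕ (clamp L x))))

cons : ℕ → (ℕ → ℕ) → ℕ → ℕ
cons x p zero    = x
cons x p (suc j) = p j

module Greedy {a} (A : ℕ → ℕ → Set a) (A? : ∀ x y → Dec (A x y)) (L : ℕ)
  (consecutive : ∀ x → x < L → A x (suc x))
  (noncrossing : ∀ {x y x′ y′} → y′ ≤ L → A x y → A x′ y′ → ¬ Crossing x y x′ y′) where

  record Walk (s : ℕ) (g : ℕ → ℕ) : Set a where
    field
      step : ∀ j → j < s → g (suc j) < g j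
      link : ∀ j → j < s → A (g (suc j)) (g j)

  Covered : ℕ → (ℕ → ℕ) → ℕ → ℕ → Set
  Covered s g u v = ∃[ j ] j < s × g (suc j) ≤ u × v ≤ g j

  record Descent (x b : ℕ) (p : ℕ → ℕ) : Set a where
    field
      s     : ℕ
      g     : ℕ → ℕ
      start : g 0 ≡ x
      tail  : ∀ j → g (s + j) ≡ p j
      walk  : Walk s g
      cover : ∀ {u v} → b ≤ u → u < v → v ≤ x → A u v → Covered s g u v
    open Walk walk public

  extend : ∀ {b x y p} → x ≤ L → (d : Descent y b p) → y < x → A y x →
    Walk (suc (Descent.s d)) (cons x (Descent.g d))
  extend {x = x} {y} x≤L d y<x yx = record
    { step = λ { zero _ → subst (_< x) (sym start) y<x ; (suc j) (s≤s j<s) → step j j<s }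
    ; link = λ { zero _ → subst (λ y → A y x) (sym start) yx ; (suc j) (s≤s j<s) → link j j<s }
    }
    where open Descent d

  extend-cover : ∀ {b x y p} → x ≤ L → (d : Descent y b p) → y < x → A y x →
    ∀ {u v} → b ≤ u → u < v → v ≤ x → A u v → (v ≡ x → y ≤ u) →
    Covered (suc (Descent.s d)) (cons x (Descent.g d)) u v
  extend-cover {b} {x} {y} x≤L d y<x yx {u} {v} b≤u u<v v≤x uv lowest with ≤-<-connex v y
  ... | inj₁ v≤y with Descent.cover d b≤u u<v v≤y uv
  ...   | j , j<s , l , h = suc j , s<s j<s , l , h
  extend-cover {b} {x} {y} x≤L d y<x yx {u} {v} b≤u u<v v≤x uv lowest | inj₂ y<v =
    0 , z<s , subst (_≤ u) (sym (Descent.start d)) y≤u , v≤x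
    where
    y≤u : y ≤ u
    y≤u with ≤-<-connex y u | m≤n⇒m<n∨m≡n v≤x
    ... | inj₁ y≤u | _        = y≤u
    ... | inj₂ _   | inj₂ v≡x = lowest v≡x
    ... | inj₂ u<y | inj₁ v<x = ⊥-elim (noncrossing x≤L uv yx (u<y , y<v , v<x))

  lowest-from : ∀ {l x} → l < x → x ≤ L →
    ∃[ y ] l ≤ y × y < x × A y x × (∀ z → l ≤ z → A z x → y ≤ z)
  lowest-from {l} {suc x} (s≤s l≤x) x<L with least (λ y → A? y (suc x)) l≤x (consecutive x x<L)
  ... | y , l≤y , y≤x , yx , min = y , l≤y , s≤s y≤x , yx , min

  descend : ∀ N x b p → x ≤ b + N → b ≤ x → x ≤ L → p 0 ≡ b → Descent x b p
  descend N x b p x≤b+N b≤x x≤L p₀ with m≤n⇒m<n∨m≡n b≤x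
  descend N x b p x≤b+N b≤x x≤L p₀ | inj₂ refl = record
    { s = 0 ; g = p ; start = p₀ ; tail = λ _ → refl
    ; walk = record { step = λ _ () ; link = λ _ () }
    ; cover = λ b≤u u<v v≤b _ → ⊥-elim (<⇒≱ u<v (≤-trans v≤b b≤u)) }
  descend zero x b p x≤b+N b≤x x≤L p₀ | inj₁ b<x =
    ⊥-elim (<⇒≱ b<x (subst (x ≤_) (+-identityʳ b) x≤b+N))
  descend (suc N) x b p x≤b+N b≤x x≤L p₀ | inj₁ b<x with lowest-from b<x x≤L
  ... | y , b≤y , y<x , yx , min = record
    { s = suc (Descent.s d) ; g = cons x (Descent.g d) ; start = refl ; tail = Descent.tail d
    ; walk = extend x≤L d y<x yx
    ; cover = λ b≤u u<v v≤x uv → extend-cover x≤L d y<x yx b≤u u<v v≤x uv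
        (λ { refl → min _ b≤u uv }) }
    where
    d : Descent y b p
    d = descend N y b p (≤-pred (≤-trans y<x (subst (x ≤_) (+-suc b N) x≤b+N))) b≤y
          (≤-trans (<⇒≤ y<x) x≤L) p₀

  record GreedyFace (x b : ℕ) (p : ℕ → ℕ) : Set a where
    field
      s     : ℕ
      g     : ℕ → ℕ
      start : g 0 ≡ x
      tail  : ∀ j → g (2 + s + j) ≡ p j
      walk  : Walk (2 + s) g
      cover : ∀ {u v} → b ≤ u → u < v → v ≤ x → A u v → ¬ (u ≡ b × v ≡ x) →
        Covered (2 + s) g u v
    open Walk walk public

  face-below : ∀ x b p → suc b < x → x ≤ L → p 0 ≡ b → GreedyFace x b p
  face-below x b p b<x x≤L p₀ with lowest-from b<x x≤L
  ... | y , b<y , y<x , yx , min = result (Descent.s d) refl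
    where
    d : Descent y b p
    d = descend y y b p (m≤n+m y b) (<⇒≤ b<y) (≤-trans (<⇒≤ y<x) x≤L) p₀
    result : ∀ s → Descent.s d ≡ s → GreedyFace x b p
    result zero s≡ = ⊥-elim (<-irrefl (trans (sym p₀) (trans (sym (Descent.tail d 0))
      (trans (cong (λ s → Descent.g d (s + 0)) s≡) (Descent.start d)))) b<y)
    result (suc s) s≡ = record
      { s = s ; g = cons x (Descent.g d) ; start = refl
      ; tail = λ j → subst (λ s → Descent.g d (s + j) ≡ p j) s≡ (Descent.tail d j)
      ; walk = subst (λ s → Walk (suc s) (cons x (Descent.g d))) s≡ (extend x≤L d y<x yx)
      ; cover = λ b≤u u<v v≤x uv ≢bx → subst (λ s → Covered (suc s) (cons x (Descent.g d)) _ _) s≡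
          (extend-cover x≤L d y<x yx b≤u u<v v≤x uv
            (λ { refl → min _ (≤∧≢⇒< b≤u (λ b≡u → ≢bx (sym b≡u , refl))) uv }))
      }

  module Build (κ : ℕ)
    (face-size : ∀ {x b p} → x ≤ L → A b x → (f : GreedyFace x b p) → p 0 ≡ b → GreedyFace.s f ≡ κ) where
    open Chains κ

    record Built (m : ℕ) (p : ℕ → ℕ) : Set a where
      field
        {i}      : ℕ
        chain    : Chain m i
        fronts   : ∀ j → j ≤ m → front chain j ≡ p j
        sound    : ∀ {x y} → Edge chain x y → A x y
        complete : ∀ {x y} → x < y → A x y → Covered m p x y → Edge chain x y

    walk-tail : ∀ {m p} → Walk (suc m) p → Walk m (p ∘ suc)
    walk-tail w = record
      { step = λ j j<m → step (suc j) (s<s j<m) ; link = λ j j<m → link (suc j) (s<s j<m) }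
      where open Walk w

    walk-length : ∀ m p → Walk m p → m ≤ p 0
    walk-length zero    p w = z≤n
    walk-length (suc m) p w = ≤-<-trans
      (walk-length m (p ∘ suc) (walk-tail w)) (Walk.step w 0 z<s)

    build : ∀ N m p → p 0 + p 0 ≤ N + m → p 0 ≤ L → p m ≡ 0 → Walk m p → Built m p
    build N zero p fuel p₀≤L pₘ w = record
      { chain = nil ; fronts = λ { zero _ → sym pₘ } ; sound = λ () ; complete = λ _ _ () }
    build zero (suc m) p fuel p₀≤L pₘ w =
      ⊥-elim (<⇒≱ (m<m+n (p 0) (≤-<-trans z≤n (Walk.step w 0 z<s)))
        (≤-trans fuel (walk-length (suc m) p w)))
    build (suc N) (suc m) p fuel p₀≤L pₘ w with m≤n⇒m<n∨m≡n (Walk.step w 0 z<s)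
    ... | inj₂ p₁+1≡p₀ = record
      { chain = edge B.chain
      ; fronts = λ { zero _ → trans (cong suc (B.fronts 0 z≤n)) p₁+1≡p₀
                   ; (suc j) (s≤s j≤m) → B.fronts j j≤m }
      ; sound = λ e → [ (λ (x≡ , y≡) → subst₂ A
          (sym (trans x≡ (B.fronts 0 z≤n))) (sym (trans y≡ (trans (cong suc (B.fronts 0 z≤n)) p₁+1≡p₀)))
          (link 0 z<s)) , B.sound ]′ (edge-inv e)
      ; complete = complete }
      where
      open Walk w
      built : Built m (p ∘ suc)
      built = build N m (p ∘ suc)
        (≤-pred (≤-pred (≤-trans
          (≤-reflexive (trans (cong suc (sym (+-suc (p 1) (p 1)))) (cong (λ q → q + q) p₁+1≡p₀)))
          (≤-trans fuel (≤-reflexive (cong suc (+-suc N m)))))))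
        (≤-trans (<⇒≤ (step 0 z<s)) p₀≤L) pₘ
        (walk-tail w)
      module B = Built built
      complete : ∀ {x y} → x < y → A x y → Covered (suc m) p x y → Edge (edge B.chain) x y
      complete x<y xy (suc j , s≤s j<m , l , h) = old-edge (B.complete x<y xy (j , j<m , l , h))
      complete {x} {y} x<y xy (zero , _ , l , h) =
        subst₂ (Edge (edge B.chain)) (trans (B.fronts 0 z≤n) (sym x≡))
          (trans (cong suc (B.fronts 0 z≤n)) (sym y≡)) new-edge
        where
        x≡ : x ≡ p 1
        x≡ = ≤-antisym (≤-pred (≤-trans x<y (≤-trans h (≤-reflexive (sym p₁+1≡p₀))))) l
        y≡ : y ≡ suc (p 1)
        y≡ = ≤-antisym (≤-trans h (≤-reflexive (sym p₁+1≡p₀))) (≤-trans (s≤s l) x<y)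
    ... | inj₁ p₁+1<p₀ = split f (face-size p₀≤L (link 0 z<s) f refl)
      where
      open Walk w
      f : GreedyFace (p 0) (p 1) (p ∘ suc)
      f = face-below (p 0) (p 1) (p ∘ suc) p₁+1<p₀ p₀≤L refl
      split : (f : GreedyFace (p 0) (p 1) (p ∘ suc)) → GreedyFace.s f ≡ κ → Built (suc m) p
      split f refl = record
        { chain = poly B.chain
        ; fronts = λ { zero _ → trans (B.fronts 0 z≤n) f.start
                     ; (suc j) (s≤s j≤m) → trans (B.fronts (2 + κ + j) (index-≤ j≤m)) (f.tail j) }
        ; sound = λ e → [ (λ (x≡ , y≡) → subst₂ A
            (sym (trans x≡ low≡)) (sym (trans y≡ (trans (B.fronts 0 z≤n) f.start)))
            (link 0 z<s)) , B.sound ]′ (poly-inv e)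
        ; complete = complete }
        where
        module f = GreedyFace f
        index : suc κ + suc m ≡ 2 + κ + m
        index = +-suc (suc κ) m
        index-≤ : ∀ {j} → j ≤ m → 2 + κ + j ≤ suc κ + suc m
        index-≤ {j} j≤m = subst (2 + κ + j ≤_) (sym index) (+-monoʳ-≤ (2 + κ) j≤m)
        g-tail : ∀ j → f.g (suc (2 + κ + j)) ≡ p (suc (suc j))
        g-tail j = trans (cong f.g (sym (+-suc (2 + κ) j))) (f.tail (suc j))
        g-walk : Walk (suc κ + suc m) f.g
        g-walk = record { step = λ j j< → proj₁ (both j j<) ; link = λ j j< → proj₂ (both j j<) }
          where
          both : ∀ j → j < suc κ + suc m → f.g (suc j) < f.g j × A (f.g (suc j)) (f.g j)
          both j j< with ≤-<-connex (2 + κ) j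
          ... | inj₂ j<k = f.step j j<k , f.link j j<k
          ... | inj₁ k≤j with m≤n⇒∃[o]m+o≡n k≤j
          ...   | o , refl =
            subst₂ _<_ (sym (g-tail o)) (sym (f.tail o)) (step (suc o) (s<s o<m)) ,
            subst₂ A (sym (g-tail o)) (sym (f.tail o)) (link (suc o) (s<s o<m))
            where
            o<m : o < m
            o<m = +-cancelˡ-< (2 + κ) o m (subst (2 + κ + o <_) index j<)
        built : Built (suc κ + suc m) f.g
        built = build N (suc κ + suc m) f.g
          (≤-trans (≤-reflexive (cong₂ _+_ f.start f.start))
            (≤-trans fuel (≤-trans (≤-reflexive (sym (+-suc N (suc m))))
              (+-monoʳ-≤ N (s≤s (m≤n+m (suc m) κ))))))
          (≤-trans (≤-reflexive f.start) p₀≤L)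
          (trans (cong f.g index) (trans (f.tail m) pₘ)) g-walk
        module B = Built built
        low≡ : front B.chain (2 + κ) ≡ p 1
        low≡ = trans (B.fronts (2 + κ) (subst (2 + κ ≤_) (sym index) (m≤m+n (2 + κ) m)))
          (trans (cong f.g (sym (+-identityʳ (2 + κ)))) (f.tail 0))
        inner-edge : ∀ {x y} → x < y → A x y → Covered (2 + κ) f.g x y → Edge (poly B.chain) x y
        inner-edge x<y xy (j , j<k , l , h) = old-poly (B.complete x<y xy
          (j , <-≤-trans j<k (subst (2 + κ ≤_) (sym index) (m≤m+n (2 + κ) m)) , l , h))
        complete : ∀ {x y} → x < y → A x y → Covered (suc m) p x y → Edge (poly B.chain) x y
        complete x<y xy (suc j , s≤s j<m , l , h) = old-poly (B.complete x<y xy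
          (2 + κ + j , subst (2 + κ + j <_) (sym index) (+-monoʳ-< (2 + κ) j<m) ,
           ≤-trans (≤-reflexive (g-tail j)) l , ≤-trans h (≤-reflexive (sym (f.tail j)))))
        complete {x} {y} x<y xy (zero , _ , l , h) with x ℕ.≟ p 1 | y ℕ.≟ p 0
        ... | yes x≡ | yes y≡ = subst₂ (Edge (poly B.chain)) (trans low≡ (sym x≡))
              (trans (B.fronts 0 z≤n) (trans f.start (sym y≡))) new-poly
        ... | no x≢ | _     = inner-edge x<y xy (f.cover l x<y h xy (λ (x≡ , _) → x≢ x≡))
        ... | yes _ | no y≢ = inner-edge x<y xy (f.cover l x<y h xy (λ (_ , y≡) → y≢ y≡))

graph-≡ : ∀ {n} (G H : Graph n) →
  (∀ u v → Adj G u v → Adj H u v) → (∀ u v → Adj H u v → Adj G u v) → G ≡ H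
graph-≡ G H G⊆H H⊆G = begin
  G                    ≡⟨ tabulate∘lookup G ⟨
  tabulate (lookup G)  ≡⟨ tabulate-cong (λ u → ⊆-antisym (λ {v} → G⊆H u v) (λ {v} → H⊆G u v)) ⟩
  tabulate (lookup H)  ≡⟨ tabulate∘lookup H ⟩
  H                    ∎
  where open ≡-Reasoning

≢⇒<∨> : ∀ {x y : ℕ} → x ≢ y → x < y ⊎ y < x
≢⇒<∨> {x} {y} x≢y with <-cmp x y
... | tri< x<y _ _ = inj₁ x<y
... | tri≈ _ x≡y _ = ⊥-elim (x≢y x≡y)
... | tri> _ _ y<x = inj₂ y<x

module AngulationChain {c ℓ₁ ℓ₂} (F : OrderedField c ℓ₁ ℓ₂) (κ i : ℕ)
  (S : Fin (2 + suc κ * i) → Plane.Point F) (convexPosition : Plane.ConvexPosition F S)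
  (G : Graph (2 + suc κ * i)) (angulation : Plane.IsKAngulation F S (3 + κ) G) where
  open Chains κ
  open Plane F
  open ConvexProperties F S convexPosition
  open FaceProperties F S convexPosition G

  L : ℕ
  L = suc (suc κ * i)

  open GraphOf {κ} {L}

  simple : IsSimple G
  simple = proj₁ angulation

  noncrossing : NonCrossing G toℕ
  noncrossing x y z w xz yw (x<y , y<z , z<w) =
    let Q , s , s′ = crossing-chords-meet x y z w x<y y<z z<w
        v , v∈xz , v∈yw , _ = proj₁ (proj₂ angulation) x z y w xz yw ≢edge Q s s′
    in no-common v v∈xz v∈yw
    where
    ≢edge : ¬ SameEdge x z y w
    ≢edge (inj₁ (refl , _)) = <-irrefl refl x<y
    ≢edge (inj₂ (refl , _)) = <-irrefl refl (<-trans x<y (<-trans y<z z<w))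
    no-common : ∀ v → v ≡ x ⊎ v ≡ z → v ≡ y ⊎ v ≡ w → ⊥
    no-common v (inj₁ refl) (inj₁ refl) = <-irrefl refl x<y
    no-common v (inj₁ refl) (inj₂ refl) = <-irrefl refl (<-trans x<y (<-trans y<z z<w))
    no-common v (inj₂ refl) (inj₁ refl) = <-irrefl refl y<z
    no-common v (inj₂ refl) (inj₂ refl) = <-irrefl refl z<w

  A : ℕ → ℕ → Set
  A x y = Adj G (clamp L x) (clamp L y)

  A⇒Adj : ∀ {u v} → A (toℕ u) (toℕ v) → Adj G u v
  A⇒Adj {u} {v} = subst₂ (Adj G) (clamp-toℕ u) (clamp-toℕ v)

  Adj⇒A : ∀ {u v} → Adj G u v → A (toℕ u) (toℕ v)
  Adj⇒A {u} {v} = subst₂ (Adj G) (sym (clamp-toℕ u)) (sym (clamp-toℕ v))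

  A-noncrossing : ∀ {x y x′ y′} → y′ ≤ L → A x y → A x′ y′ → ¬ Crossing x y x′ y′
  A-noncrossing {x} {y} {x′} {y′} y′≤L xy xy′ (x<x′ , x′<y , y<y′) =
    noncrossing _ _ _ _ xy xy′ (clamp-< x<x′ x′≤L , clamp-< x′<y y≤L , clamp-< y<y′ y′≤L)
    where
    y≤L = ≤-trans (<⇒≤ y<y′) y′≤L
    x′≤L = ≤-trans (<⇒≤ x′<y) y≤L
    clamp-< : ∀ {z w} → z < w → w ≤ L → toℕ (clamp L z) < toℕ (clamp L w)
    clamp-< z<w w≤L = subst₂ _<_ (sym (toℕ-clamp (≤-trans (<⇒≤ z<w) w≤L))) (sym (toℕ-clamp w≤L)) z<w

  twoConnected : TwoConnected G
  twoConnected = proj₁ (proj₂ (proj₂ angulation))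

  open Greedy A (λ x y → clamp L y ∈? lookup G (clamp L x)) L
    (consecutive-adjacent G simple twoConnected noncrossing) A-noncrossing

  face-size : ∀ {x b p} → x ≤ L → A b x → (f : GreedyFace x b p) → p 0 ≡ b → GreedyFace.s f ≡ κ
  face-size {x} {b} {p} x≤L bx f p₀ = polygon-size angulation polygon increasing
      (sidesAdjacent f.link (proj₁ simple _ _ (subst₂ A (sym last≡) (sym f.start) bx)))
      (edgesOutside separated)
    where
    module f = GreedyFace f
    q : ℕ
    q = 2 + f.s
    last≡ : f.g q ≡ b
    last≡ = trans (cong f.g (sym (+-identityʳ q))) (trans (f.tail 0) p₀)
    open PolygonFace F S convexPosition G simple {f.s} f.g f.step (≤-trans (≤-reflexive f.start) x≤L)
    b<x : b < x
    b<x = subst₂ _<_ last≡ f.start (f-< z<s ≤-refl)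
    within : ∀ {u v} → b ≤ u → u < v → v ≤ x → A u v → Separated f.g q u v
    within {u} {v} b≤u u<v v≤x uv with u ℕ.≟ b | v ℕ.≟ x
    ... | yes u≡b | yes v≡x = inj₂ (inj₁ (≤-reflexive (trans u≡b (sym last≡))) ,
                                    inj₂ (≤-reflexive (trans f.start (sym v≡x))))
    ... | no u≢b  | _       = inj₁ (f.cover b≤u u<v v≤x uv (λ (u≡b , _) → u≢b u≡b))
    ... | yes _   | no v≢x  = inj₁ (f.cover b≤u u<v v≤x uv (λ (_ , v≡x) → v≢x v≡x))
    separated : ∀ u v → Adj G u v → u Fin.< v → Separated f.g q (toℕ u) (toℕ v)
    separated u v uv u<v with noncrossing⇒sides b<x u<v
      (A-noncrossing (toℕ≤ v) bx (Adj⇒A {u} {v} uv)) (A-noncrossing x≤L (Adj⇒A {u} {v} uv) bx)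
    ... | inj₁ (au , av)    = inj₂ (apart au , apart av)
      where
      apart : ∀ {z} → Apart b x z → Apart (f.g q) (f.g 0) z
      apart {z} = subst₂ (λ lo hi → Apart lo hi z) (sym last≡) (sym f.start)
    ... | inj₂ (b≤u , v≤x) = within b≤u u<v v≤x (Adj⇒A {u} {v} uv)

  open Build κ face-size

  corners : ℕ → ℕ
  corners zero    = L
  corners (suc _) = 0

  module FromBuilt (built : Built 1 corners) where
    module built = Built built

    nodes≡ : built.i ≡ i
    nodes≡ = *-cancelˡ-≡ built.i i (suc κ)
      (suc-injective (trans (sym (front-length built.chain)) (built.fronts 0 z≤n)))

    edge-of : ∀ u v → Adj G u v → u Fin.< v → Edge built.chain (toℕ u) (toℕ v)
    edge-of u v uv u<v = built.complete u<v (Adj⇒A {u} {v} uv) (0 , z<s , z≤n , toℕ≤ v)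

    link-of : ∀ u v → Adj G u v → Linked built.chain (toℕ u) (toℕ v)
    link-of u v uv =
      [ (λ u<v → inj₁ (edge-of u v uv u<v)) , (λ v<u → inj₂ (edge-of v u (proj₁ simple u v uv) v<u)) ]′
      (≢⇒<∨> (λ u≡v → proj₂ simple v (subst (λ w → Adj G w v) (Fin.toℕ-injective u≡v) uv)))

    adj-of : ∀ u v → Linked built.chain (toℕ u) (toℕ v) → Adj G u v
    adj-of u v (inj₁ e) = A⇒Adj {u} {v} (built.sound {toℕ u} {toℕ v} e)
    adj-of u v (inj₂ e) = proj₁ simple v u (A⇒Adj {v} {u} (built.sound {toℕ v} {toℕ u} e))

    graph≡ : graphOf built.chain ≡ G
    graph≡ = graph-≡ (graphOf built.chain) G
      (λ u v uv → adj-of u v (adj⇒linked built.chain {u} {v} uv))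
      (λ u v uv → linked⇒adj built.chain {u} {v} (link-of u v uv))

    angulation-chain : ∃[ C ] graphOf {m = 1} {i = i} C ≡ G
    angulation-chain =
      subst (λ i′ → Σ[ C ∈ Chain 1 i′ ] graphOf C ≡ G) nodes≡ (built.chain , graph≡)

  angulation-chain : ∃[ C ] graphOf {m = 1} {i = i} C ≡ G
  angulation-chain = FromBuilt.angulation-chain
    (build (L + L) 1 corners (m≤m+n (L + L) 1) ≤-refl refl record
      { step = λ { zero _ → z<s ; (suc j) (s≤s ()) }
      ; link = λ { zero _ → ends-adjacent G simple twoConnected noncrossing z<s ; (suc j) (s≤s ()) } })

-- Counting

sumTo : ℕ → (ℕ → ℕ) → ℕ
sumTo n f = sum +-*-semiring {n} (λ q → f (toℕ q))

sumTo-cong : ∀ n {f g : ℕ → ℕ} → (∀ s → s < n → f s ≡ g s) → sumTo n f ≡ sumTo n g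
sumTo-cong zero    f≡g = refl
sumTo-cong (suc n) f≡g = cong₂ _+_ (f≡g 0 z<s) (sumTo-cong n (λ s s<n → f≡g (suc s) (s<s s<n)))

sumTo-zero : ∀ n {f : ℕ → ℕ} → (∀ s → s < n → f s ≡ 0) → sumTo n f ≡ 0
sumTo-zero zero    f≡0 = refl
sumTo-zero (suc n) f≡0 = cong₂ _+_ (f≡0 0 z<s) (sumTo-zero n (λ s s<n → f≡0 (suc s) (s<s s<n)))

module Counting (κ : ℕ) where
  open Chains κ
  open import Data.Nat.Combinatorics using (_C_; nCn≡1; nCk+nC[k+1]≡[n+1]C[k+1])

  #chains : ℕ → ℕ → ℕ
  #chains m i = length (chains m i)

  #chains-suc : ∀ m i → #chains (suc m) (suc i) ≡ #chains m (suc i) + #chains (suc κ + suc m) i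
  #chains-suc m i = trans (length-++ (map edge (chains m (suc i))))
    (cong₂ _+_ (length-map edge (chains m (suc i))) (length-map poly (chains (suc κ + suc m) i)))

  #chains-zero : ∀ m → #chains m 0 ≡ 1
  #chains-zero zero    = refl
  #chains-zero (suc m) = trans (length-map edge (chains m 0)) (#chains-zero m)

  -- Σ_{s ≤ j} w s · #chains (M + (κ + 1) s) (j ∸ s).
  convolve : (ℕ → ℕ) → ℕ → ℕ → ℕ
  convolve w M zero    = w 0 * #chains M 0
  convolve w M (suc j) = w 0 * #chains M (suc j) + convolve (λ s → w (suc s)) (suc κ + M) j

  convolve-cong : ∀ {w w′ : ℕ → ℕ} → (∀ s → w s ≡ w′ s) →
    ∀ M j → convolve w M j ≡ convolve w′ M j
  convolve-cong w≡ M zero    = cong (_* #chains M 0) (w≡ 0)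
  convolve-cong w≡ M (suc j) = cong₂ _+_ (cong (_* #chains M (suc j)) (w≡ 0))
    (convolve-cong (λ s → w≡ (suc s)) (suc κ + M) j)

  convolve-+ : ∀ (w w′ : ℕ → ℕ) M j →
    convolve w M j + convolve w′ M j ≡ convolve (λ s → w s + w′ s) M j
  convolve-+ w w′ M zero    = sym (*-distribʳ-+ (#chains M 0) (w 0) (w′ 0))
  convolve-+ w w′ M (suc j) = trans
    (interchange (w 0) (w′ 0) (#chains M (suc j)) _ _)
    (cong ((w 0 + w′ 0) * #chains M (suc j) +_)
      (convolve-+ (λ s → w (suc s)) (λ s → w′ (suc s)) (suc κ + M) j))
    where
    interchange : ∀ x y z u v → x * z + u + (y * z + v) ≡ (x + y) * z + (u + v)
    interchange = solve-∀

  -- With A the generating function of the edge-rooted dissections and B = x A^(κ+1),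
  -- A = 1 + A B gives A^(m+1) = Σ_s C(m+s, m) B^s; this is multiplied by A^M.
  #chains-expand : ∀ m M j → #chains (suc (m + M)) j ≡ convolve (λ s → (m + s) C m) M j
  #chains-expand m M zero = begin
    #chains (suc (m + M)) 0
      ≡⟨ #chains-zero (suc (m + M)) ⟩
    1
      ≡⟨ cong₂ _*_ (trans (cong (_C m) (+-identityʳ m)) (nCn≡1 m)) (#chains-zero M) ⟨
    ((m + 0) C m) * #chains M 0 ∎
    where open ≡-Reasoning
  #chains-expand m M (suc j) = begin
    #chains (suc (m + M)) (suc j)
      ≡⟨ #chains-suc (m + M) j ⟩
    #chains (m + M) (suc j) + #chains (suc κ + suc (m + M)) j
      ≡⟨ cong (λ x → #chains (m + M) (suc j) + #chains x j) (shift κ m M) ⟩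
    #chains (m + M) (suc j) + #chains (suc (m + (suc κ + M))) j
      ≡⟨ cong (#chains (m + M) (suc j) +_) (#chains-expand m (suc κ + M) j) ⟩
    #chains (m + M) (suc j) + convolve (λ s → (m + s) C m) (suc κ + M) j
      ≡⟨ pascal m ⟩
    convolve (λ s → (m + s) C m) M (suc j) ∎
    where
    open ≡-Reasoning
    shift : ∀ κ m M → suc κ + suc (m + M) ≡ suc (m + (suc κ + M))
    shift = solve-∀
    pascal : ∀ m → #chains (m + M) (suc j) + convolve (λ s → (m + s) C m) (suc κ + M) j ≡
      convolve (λ s → (m + s) C m) M (suc j)
    pascal zero = cong₂ _+_ (sym (*-identityˡ (#chains M (suc j))))
      (convolve-cong (λ s → refl) (suc κ + M) j)
    pascal (suc m) = begin
      #chains (suc (m + M)) (suc j) + convolve (λ s → (suc m + s) C suc m) (suc κ + M) j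
        ≡⟨ cong (_+ convolve (λ s → (suc m + s) C suc m) (suc κ + M) j) (#chains-expand m M (suc j)) ⟩
      ((m + 0) C m) * #chains M (suc j) + convolve (λ s → (m + suc s) C m) (suc κ + M) j
        + convolve (λ s → (suc m + s) C suc m) (suc κ + M) j
        ≡⟨ +-assoc (((m + 0) C m) * #chains M (suc j)) _ _ ⟩
      ((m + 0) C m) * #chains M (suc j) + (convolve (λ s → (m + suc s) C m) (suc κ + M) j
        + convolve (λ s → (suc m + s) C suc m) (suc κ + M) j)
        ≡⟨ cong₂ _+_ (cong (_* #chains M (suc j)) (trans (n+0Cn≡1 m) (sym (n+0Cn≡1 (suc m)))))
             (trans (convolve-+ (λ s → (m + suc s) C m) (λ s → (suc m + s) C suc m) (suc κ + M) j)
               (convolve-cong pascal′ (suc κ + M) j)) ⟩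
      ((suc m + 0) C suc m) * #chains M (suc j) + convolve (λ s → (suc m + suc s) C suc m) (suc κ + M) j ∎
      where
      n+0Cn≡1 : ∀ n → ((n + 0) C n) ≡ 1
      n+0Cn≡1 n = trans (cong (_C n) (+-identityʳ n)) (nCn≡1 n)
      pascal′ : ∀ s → ((m + suc s) C m) + ((suc m + s) C suc m) ≡ ((suc m + suc s) C suc m)
      pascal′ s = trans (cong (λ n → ((m + suc s) C m) + (n C suc m)) (sym (+-suc m s)))
        (nCk+nC[k+1]≡[n+1]C[k+1] (m + suc s) m)

  #leadChains : ∀ m d i → length (leadChains (suc m) (d + i) d) ≡ #chains (suc κ * d + m) i
  #leadChains m zero    i = trans (length-map edge (chains m i))
    (cong (λ x → #chains (x + m) i) (sym (*-zeroʳ (suc κ))))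
  #leadChains m (suc d) i = trans (length-map poly (leadChains (suc κ + suc m) (d + i) d))
    (trans (#leadChains (κ + suc m) d i) (cong (λ x → #chains x i) (shift κ d m)))
    where
    shift : ∀ κ d m → suc κ * d + (κ + suc m) ≡ suc κ * suc d + m
    shift = solve-∀

  #leadChains-small : ∀ m d i → i < d → length (leadChains (suc m) i d) ≡ 0
  #leadChains-small m (suc d) zero    i<d       = refl
  #leadChains-small m (suc d) (suc i) (s≤s i<d) =
    trans (length-map poly (leadChains (suc κ + suc m) i d)) (#leadChains-small (κ + suc m) d i i<d)

  degreeCount : ℕ → ℕ → ℕ
  degreeCount i j = length (leadChains 1 i (suc j))

  degreeCount-≡ : ∀ j t → degreeCount (suc j + t) j ≡ #chains (suc κ * suc j) t
  degreeCount-≡ j t = trans (#leadChains 0 (suc j) t) (cong (λ x → #chains x t) (+-identityʳ (suc κ * suc j)))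

  degreeCount-small : ∀ i j → i ≤ j → degreeCount i j ≡ 0
  degreeCount-small i j i≤j = #leadChains-small 0 (suc j) i (s≤s i≤j)

  convolve-sum : ∀ (w v : ℕ → ℕ) M j e → j < e →
    (∀ s t → s + t ≡ j → v s ≡ #chains (suc κ * s + M) t) → (∀ s → j < s → v s ≡ 0) →
    sumTo e (λ s → w s * v s) ≡ convolve w M j
  convolve-sum w v M zero (suc e) j<e v≡ v≡0 = trans
    (cong₂ _+_ (cong (w 0 *_) (trans (v≡ 0 0 refl) (cong (λ x → #chains (x + M) 0) (*-zeroʳ (suc κ)))))
      (sumTo-zero e (λ s _ → trans (cong (w (suc s) *_) (v≡0 (suc s) z<s)) (*-zeroʳ (w (suc s))))))
    (+-identityʳ _)
  convolve-sum w v M (suc j) (suc e) (s≤s j<e) v≡ v≡0 = cong₂ _+_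
    (cong (w 0 *_) (trans (v≡ 0 (suc j) refl) (cong (λ x → #chains (x + M) (suc j)) (*-zeroʳ (suc κ)))))
    (convolve-sum (λ s → w (suc s)) (λ s → v (suc s)) (suc κ + M) j e j<e
      (λ s t eq → trans (v≡ (suc s) t (cong suc eq)) (cong (λ x → #chains x t) (shift κ s M)))
      (λ s j<s → v≡0 (suc s) (s<s j<s)))
    where
    shift : ∀ κ s M → suc κ * suc s + M ≡ suc κ * s + (suc κ + M)
    shift = solve-∀

  entry : ℕ → ℕ → ℕ
  entry p q =
    if does (p ≤? q)
    then (suc κ + (q ∸ p)) C κ
    else (if does (p ≟ suc q) then 1 else 0)

  entry-suc : ∀ p q → entry (suc p) (suc q) ≡ entry p q
  entry-suc zero    q = refl
  entry-suc (suc p) q = refl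

  row-sum : ∀ p e (v : ℕ → ℕ) → sumTo (suc p + e) (λ q → entry (suc p) q * v q) ≡
    v p + sumTo e (λ s → ((suc κ + s) C κ) * v (suc p + s))
  row-sum zero    e v = cong₂ _+_ (+-identityʳ (v 0))
    (sumTo-cong e (λ s _ → cong (_* v (suc s)) (entry-suc 0 s)))
  row-sum (suc p) e v = trans
    (sumTo-cong (suc p + e) {λ q → entry (suc (suc p)) (suc q) * v (suc q)}
      (λ s _ → cong (_* v (suc s)) (entry-suc (suc p) s)))
    (row-sum p e (λ q → v (suc q)))

  entry-below : ∀ p q → suc q < p → entry p q ≡ 0
  entry-below (suc (suc p)) zero    (s≤s (s≤s q<p)) = refl
  entry-below (suc p)       (suc q) (s≤s q<p)       = trans (entry-suc p q) (entry-below p q q<p)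

  upper-sum : ∀ p j e → j < e →
    sumTo e (λ s → ((suc κ + s) C κ) * degreeCount (p + suc j) (p + s)) ≡
    convolve (λ s → (κ + suc s) C κ) (suc κ + suc κ * p) j
  upper-sum p j e j<e = trans
    (convolve-sum (λ s → (suc κ + s) C κ) (λ s → degreeCount (p + suc j) (p + s)) (suc κ + suc κ * p) j e j<e
      (λ { s t refl → trans (cong (λ i → degreeCount i (p + s)) (split p s t))
             (trans (degreeCount-≡ (p + s) t) (cong (λ x → #chains x t) (shift κ p s))) })
      (λ s j<s → degreeCount-small (p + suc j) (p + s) (+-monoʳ-≤ p j<s)))
    (convolve-cong (λ s → cong (_C κ) (sym (+-suc κ s))) (suc κ + suc κ * p) j)
    where
    split : ∀ p s t → p + suc (s + t) ≡ suc (p + s) + t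
    split = solve-∀
    shift : ∀ κ p s → suc κ * suc (p + s) ≡ suc κ * s + (suc κ + suc κ * p)
    shift = solve-∀

  production-≡ : ∀ p j e → j < e → ∀ x → x ≡ #chains (suc κ * p) j →
    degreeCount (suc (p + j)) p ≡ x + sumTo e (λ s → ((suc κ + s) C κ) * degreeCount (p + j) (p + s))
  production-≡ p j e j<e x x≡ = begin
    degreeCount (suc p + j) p
      ≡⟨ degreeCount-≡ p j ⟩
    #chains (suc κ * suc p) j
      ≡⟨ cong (λ x → #chains x j) (*-suc (suc κ) p) ⟩
    #chains (suc (κ + suc κ * p)) j
      ≡⟨ #chains-expand κ (suc κ * p) j ⟩
    convolve (λ s → (κ + s) C κ) (suc κ * p) j
      ≡⟨ sum-form j j<e ⟩
    #chains (suc κ * p) j + sumTo e (λ s → ((suc κ + s) C κ) * degreeCount (p + j) (p + s))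
      ≡⟨ cong (_+ sumTo e (λ s → ((suc κ + s) C κ) * degreeCount (p + j) (p + s))) x≡ ⟨
    x + sumTo e (λ s → ((suc κ + s) C κ) * degreeCount (p + j) (p + s)) ∎
    where
    open ≡-Reasoning
    first : ∀ y → ((κ + 0) C κ) * y ≡ y
    first y = trans (cong (_* y) (trans (cong (_C κ) (+-identityʳ κ)) (nCn≡1 κ))) (*-identityˡ y)
    sum-form : ∀ j → j < e → convolve (λ s → (κ + s) C κ) (suc κ * p) j ≡
      #chains (suc κ * p) j + sumTo e (λ s → ((suc κ + s) C κ) * degreeCount (p + j) (p + s))
    sum-form zero j<e = trans (first _) (sym (trans (cong (#chains (suc κ * p) 0 +_) (sumTo-zero e (λ s _ →
      trans (cong (((suc κ + s) C κ) *_) (degreeCount-small (p + 0) (p + s) (+-monoʳ-≤ p z≤n)))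
        (*-zeroʳ ((suc κ + s) C κ)))))
      (+-identityʳ _)))
    sum-form (suc j) j<e = cong₂ _+_ (first _) (sym (upper-sum p j e (<⇒≤ j<e)))

  production : ∀ i r p → 1 ≤ i → i < r → p < r →
    degreeCount (suc i) p ≡ sumTo r (λ q → entry p q * degreeCount i q)
  production i r p 1≤i i<r p<r with ≤-<-connex p i
  production i r p 1≤i i<r p<r | inj₂ i<p = trans (degreeCount-small (suc i) p i<p)
    (sym (sumTo-zero r vanish))
    where
    vanish : ∀ q → q < r → entry p q * degreeCount i q ≡ 0
    vanish q _ with ≤-<-connex i q
    ... | inj₁ i≤q = trans (cong (entry p q *_) (degreeCount-small i q i≤q)) (*-zeroʳ (entry p q))
    ... | inj₂ q<i = cong (_* degreeCount i q) (entry-below p q (≤-<-trans q<i i<p))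
  production i r zero 1≤i i<r p<r | inj₁ p≤i =
    production-≡ 0 i r i<r 0 (sym (trans (cong (λ x → #chains x i) (*-zeroʳ (suc κ))) (none 1≤i)))
    where
    none : ∀ {i} → 1 ≤ i → #chains 0 i ≡ 0
    none {suc i} _ = refl
  production i r (suc p) 1≤i i<r p<r | inj₁ p≤i
    with m≤n⇒∃[o]m+o≡n p≤i | m≤n⇒∃[o]m+o≡n (<⇒≤ p<r)
  ... | j , refl | e , refl = trans
    (production-≡ (suc p) j e (+-cancelˡ-< (suc p) j e i<r) (degreeCount (suc p + j) p) (degreeCount-≡ p j))
    (sym (row-sum p e (degreeCount (suc p + j))))

module DegreeVector {c ℓ₁ ℓ₂} (F : OrderedField c ℓ₁ ℓ₂) (κ i : ℕ) (1≤i : 1 ≤ i)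
  (S : Fin (2 + suc κ * i) → Plane.Point F) (convexPosition : Plane.ConvexPosition F S) where
  open Plane F
  open Chains κ
  open Counting κ
  open GraphOf {κ} {suc (suc κ * i)}

  RootedAngulation : ℕ → Graph (2 + suc κ * i) → Set _
  RootedAngulation j G = IsKAngulation S (3 + κ) G × HasKGons S (3 + κ) i G × HasRootDegree G j

  rootedAngulations : ℕ → List (Graph (2 + suc κ * i))
  rootedAngulations j = map graphOf (leadChains 1 i (suc j))

  sound : ∀ j {G} → G ∈ rootedAngulations j → RootedAngulation j G
  sound j ∈graphs with ∈-map⁻ graphOf ∈graphs
  ... | C , ∈chains , refl = isKAngulation , hasKGons ,
    trans rootDegree (trans (cong suc (lead-leadChains 1 i (suc j) ∈chains)) (+-comm 2 j))
    where open ChainAngulation F κ i 1≤i S convexPosition C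

  complete : ∀ j {G} → RootedAngulation j G → G ∈ rootedAngulations j
  complete j {G} (angulation , _ , degree≡) =
    from (AngulationChain.angulation-chain F κ i S convexPosition G angulation)
    where
    from : Σ[ C ∈ Chain 1 i ] graphOf C ≡ G → G ∈ rootedAngulations j
    from (C , refl) = ∈-map⁺ graphOf (subst (λ d → C ∈ leadChains 1 i d) lead≡ (∈-leadChains C))
      where
      lead≡ : lead C ≡ suc j
      lead≡ = suc-injective (trans (sym (root-degree C (front-length C))) (trans degree≡ (+-comm j 2)))

  count : ∀ j → HasCount (RootedAngulation j) (degreeCount i j)
  count j = rootedAngulations j ,
    Unique.map⁺ (λ {C} {C′} → graphOf-injective C C′ (≤-reflexive (front-length C)))
      (leadChains-unique 1 i (suc j)) ,
    (λ G → mk⇔ (sound j) (complete j)) ,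
    length-map graphOf (leadChains 1 i (suc j))

theorem5 : ∀ {c ℓ₁ ℓ₂} (F : OrderedField c ℓ₁ ℓ₂) (k r : ℕ) → 3 ≤ k → 1 ≤ r →
    (S : ∀ i → Fin (order k i) → Plane.Point F) →
    (∀ i → 1 ≤ i → i ≤ r → Plane.ConvexPosition F (S i)) →
    IsProductionMatrix F k r S (K k r)
theorem5 F .(suc (suc (suc κ))) .(suc r) (s≤s (s≤s (s≤s {n = κ} z≤n))) (s≤s {n = r} z≤n) S convex =
  (λ i j → degreeCount i (toℕ j)) ,
  (λ i 1≤i i≤r j → DegreeVector.count F κ i 1≤i (S i) (convex i 1≤i i≤r) (toℕ j)) ,
  (λ i 1≤i i≤r p → production i (suc r) (toℕ p) 1≤i (s≤s i≤r) (Fin.toℕ<n p))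
  where open Counting κ
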